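{- Let $n,a,a',d$ be nonnegative integers such that $n>0$, $\max\{a,a'\}\le n$, $a\equiv a'\equiv n\pmod 2$, and $d\le\min\{a,a',\frac{n-a}{2},\frac{n-a'}{2}\}$. For $b\in\{a,a'\}$ let $R(\mathcal{M}_{n,b})_d$ be the degree $d$ component of the orbit harmonics ring of the locus $\mathcal{M}_{n,b}$ of permutation matrices of involutions in $\mathfrak{S}_n$ with exactly $b$ fixed points. Then there is an isomorphism of $\mathfrak{S}_n$-modules $$R(\mathcal{M}_{n,a})_d\cong R(\mathcal{M}_{n,a'})_d.$$
   Context: Let $\mathcal{M}_{n,a}=\{w\in\mathfrak{S}_n : w^2=1 \text{ and } w \text{ has exactly } a \text{ fixed points}\}$, with each $w$ identified with its $n\times n$ permutation matrix, so $\mathcal{M}_{n,a}\subseteq \mathrm{Mat}_{n\times n}(\mathbb{C})$ is a finite set on which $\mathfrak{S}_n$ acts by conjugation. Let $\mathbb{C}[\mathbf{x}_{n\times n}]$ be the polynomial ring in the variables $x_{i,j}$, $1\le i,j\le n$, with the induced action $g\cdot x_{i,j}=x_{g(i),g(j)}$ of $\mathfrak{S}_n$. Let $\mathbf{I}(\mathcal{M}_{n,a})$ be the ideal of polynomials vanishing on $\mathcal{M}_{n,a}$. For an ideal $I$, let $\mathrm{gr}\, I$ be the ideal generated by the highest-degree homogeneous components of all nonzero $g\in I$. Put $R(\mathcal{M}_{n,a})=\mathbb{C}[\mathbf{x}_{n\times n}]/\mathrm{gr}\,\mathbf{I}(\mathcal{M}_{n,a})$, a graded $\mathfrak{S}_n$-module,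 with degree $d$ component $R(\mathcal{M}_{n,a})_d$. -}

module Defs where

open import Level using (Level; 0ℓ; _⊔_) renaming (suc to lsuc)
open import Data.Bool.Base using (Bool; true; false; if_then_else_)
open import Data.Fin.Base using (Fin)
import Data.Fin.Properties as Finₚ
open import Data.Fin.Permutation as Perm using (Permutation′; _⟨$⟩ʳ_; _⟨$⟩ˡ_; _∘ₚ_)
open import Data.List.Base using (List; []; _∷_; _++_; map; filter; cartesianProductWith)
open import Data.Nat.Base as ℕ using (ℕ)
import Data.Nat.Properties as ℕₚ
open import Data.Rational.Base as ℚ using (ℚ; 0ℚ; 1ℚ; ½)
import Data.Rational.Properties as ℚₚ
open import Data.Rational.Solver using (module +-*-Solver)
open import Data.Product.Base using (_×_; _,_; Σ; ∃-syntax; Σ-syntax; proj₁; proj₂)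
open import Algebra.Bundles using (CommutativeRing; Group)
import Algebra.Consequences.Setoid as Consequences
open import Algebra.Module.Bundles using (Module)
open import Algebra.Module.Morphism.Structures using (IsModuleIsomorphism)
open import Algebra.Module.Structures using (IsLeftModule)
open import Algebra.Module.Structures.Biased using (IsModuleFromLeft)
import Algebra.Properties.AbelianGroup as AbelianGroupProperties
import Algebra.Properties.CommutativeMonoid.Sum as Sum
import Algebra.Properties.CommutativeSemigroup as CommutativeSemigroupProperties
import Algebra.Properties.Ring as RingProperties
import Algebra.Properties.Semiring.Exp as Exp
open import Function.Bundles using (mk⇔)
open import Relation.Binary.PropositionalEquality.Core as ≡ using (_≡_; _≢_)
import Relation.Binary.Reasoning.Setoid as SetoidReasoning
open import Relation.Binary.Bundles using (Setoid)
open import Relation.Binary.Structures using (IsEquivalence)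
open import Relation.Nullary using (¬_; Dec; does)
open import Relation.Nullary.Decidable using (does-⇔)
open import Relation.Unary using (Pred)

module RealNumbers where

  -- Equality is that of the sequences' limits, so ℝ is the setoid of
  -- Cauchy sequences of rationals modulo null sequences.

  record ℝ : Set where
    constructor mkℝ
    field
      seq    : ℕ → ℚ
      cauchy : ∀ ε → 0ℚ ℚ.< ε →
               ∃[ N ] (∀ m n → N ℕ.≤ m → N ℕ.≤ n → ℚ.∣ seq m ℚ.- seq n ∣ ℚ.< ε)
  open ℝ public

  infix 4 _≃_
  record _≃_ (x y : ℝ) : Set where
    constructor mk≃
    field
      null : ∀ ε → 0ℚ ℚ.< ε →
             ∃[ N ] (∀ n → N ℕ.≤ n → ℚ.∣ seq x n ℚ.- seq y n ∣ ℚ.< ε)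
  open _≃_ public

  private
    ⊔⁴₁ : ∀ a b c d {n} → (a ℕ.⊔ b) ℕ.⊔ (c ℕ.⊔ d) ℕ.≤ n → a ℕ.≤ n
    ⊔⁴₁ a b c d ≤n = ℕₚ.m⊔n≤o⇒m≤o a b (ℕₚ.m⊔n≤o⇒m≤o _ (c ℕ.⊔ d) ≤n)

    ⊔⁴₂ : ∀ a b c d {n} → (a ℕ.⊔ b) ℕ.⊔ (c ℕ.⊔ d) ℕ.≤ n → b ℕ.≤ n
    ⊔⁴₂ a b c d ≤n = ℕₚ.m⊔n≤o⇒n≤o a b (ℕₚ.m⊔n≤o⇒m≤o _ (c ℕ.⊔ d) ≤n)

    ⊔⁴₃ : ∀ a b c d {n} → (a ℕ.⊔ b) ℕ.⊔ (c ℕ.⊔ d) ℕ.≤ n → c ℕ.≤ n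
    ⊔⁴₃ a b c d ≤n = ℕₚ.m⊔n≤o⇒m≤o c d (ℕₚ.m⊔n≤o⇒n≤o (a ℕ.⊔ b) _ ≤n)

    ⊔⁴₄ : ∀ a b c d {n} → (a ℕ.⊔ b) ℕ.⊔ (c ℕ.⊔ d) ℕ.≤ n → d ℕ.≤ n
    ⊔⁴₄ a b c d ≤n = ℕₚ.m⊔n≤o⇒n≤o c d (ℕₚ.m⊔n≤o⇒n≤o (a ℕ.⊔ b) _ ≤n)

    half+half : ∀ ε → ½ ℚ.* ε ℚ.+ ½ ℚ.* ε ≡ ε
    half+half ε = ≡.trans (≡.sym (ℚₚ.*-distribʳ-+ ε ½ ½)) (ℚₚ.*-identityˡ ε)

    half-pos : ∀ {ε} → 0ℚ ℚ.< ε → 0ℚ ℚ.< ½ ℚ.* ε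
    half-pos {ε} 0<ε = ≡.subst (ℚ._< ½ ℚ.* ε) (ℚₚ.*-zeroʳ ½) (ℚₚ.*-monoʳ-<-pos ½ 0<ε)

    ∣p-p∣<ε : ∀ p {ε} → 0ℚ ℚ.< ε → ℚ.∣ p ℚ.- p ∣ ℚ.< ε
    ∣p-p∣<ε p {ε} 0<ε = ≡.subst (λ q → ℚ.∣ q ∣ ℚ.< ε) (≡.sym (ℚₚ.+-inverseʳ p)) 0<ε

    +-small : ∀ {p q r ε} → p ≡ q ℚ.+ r →
              ℚ.∣ q ∣ ℚ.< ½ ℚ.* ε → ℚ.∣ r ∣ ℚ.< ½ ℚ.* ε → ℚ.∣ p ∣ ℚ.< ε
    +-small {p} {q} {r} {ε} ≡.refl q<ε r<ε =
      ℚₚ.≤-<-trans (ℚₚ.∣p+q∣≤∣p∣+∣q∣ q r)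
        (≡.subst (ℚ.∣ q ∣ ℚ.+ ℚ.∣ r ∣ ℚ.<_) (half+half ε) (ℚₚ.+-mono-< q<ε r<ε))

    flip-small : ∀ p q {ε} → ℚ.∣ p ℚ.- q ∣ ℚ.< ε → ℚ.∣ q ℚ.- p ∣ ℚ.< ε
    flip-small p q {ε} = ≡.subst (ℚ._< ε)
      (≡.trans (≡.sym (ℚₚ.∣-p∣≡∣p∣ (p ℚ.- q))) (≡.cong ℚ.∣_∣ eq))
      where
      open +-*-Solver
      eq : ℚ.- (p ℚ.- q) ≡ q ℚ.- p
      eq = solve 2 (λ a b → :- (a :- b) := b :- a) ≡.refl p q

    telescope : ∀ p q r → p ℚ.- r ≡ (p ℚ.- q) ℚ.+ (q ℚ.- r)
    telescope = solve 3 (λ a b c → a :- c := (a :- b) :+ (b :- c)) ≡.refl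
      where open +-*-Solver

    interchange : ∀ p q r s → (p ℚ.+ q) ℚ.- (r ℚ.+ s) ≡ (p ℚ.- r) ℚ.+ (q ℚ.- s)
    interchange = solve 4 (λ a b c d → (a :+ b) :- (c :+ d) := (a :- c) :+ (b :- d)) ≡.refl
      where open +-*-Solver

    product-rule : ∀ p q r s → p ℚ.* q ℚ.- r ℚ.* s ≡ p ℚ.* (q ℚ.- s) ℚ.+ (p ℚ.- r) ℚ.* s
    product-rule = solve 4 (λ a b c d → a :* b :- c :* d := a :* (b :- d) :+ (a :- c) :* d) ≡.refl
      where open +-*-Solver

    neg-sub : ∀ p q → (ℚ.- p) ℚ.- (ℚ.- q) ≡ q ℚ.- p
    neg-sub = solve 2 (λ a b → (:- a) :- (:- b) := b :- a) ≡.refl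
      where open +-*-Solver

    *-small : ∀ {B δ p q} .{{_ : ℚ.Positive B}} →
              ℚ.∣ p ∣ ℚ.≤ B → ℚ.∣ q ∣ ℚ.< δ → ℚ.∣ p ℚ.* q ∣ ℚ.< B ℚ.* δ
    *-small {B} {δ} {p} {q} p≤B q<δ =
      ≡.subst (ℚ._< B ℚ.* δ) (≡.sym (ℚₚ.∣p*q∣≡∣p∣*∣q∣ p q))
        (ℚₚ.≤-<-trans (ℚₚ.*-monoʳ-≤-nonNeg ℚ.∣ q ∣ {{ℚₚ.∣-∣-nonNeg q}} p≤B)
                      (ℚₚ.*-monoʳ-<-pos B q<δ))

    product-small : ∀ {B δ ε p q r s} .{{_ : ℚ.Positive B}} → B ℚ.* δ ≡ ½ ℚ.* ε →
                    ℚ.∣ p ∣ ℚ.≤ B → ℚ.∣ s ∣ ℚ.≤ B →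
                    ℚ.∣ p ℚ.- r ∣ ℚ.< δ → ℚ.∣ q ℚ.- s ∣ ℚ.< δ →
                    ℚ.∣ p ℚ.* q ℚ.- r ℚ.* s ∣ ℚ.< ε
    product-small {B} {δ} {ε} {p} {q} {r} {s} Bδ p≤B s≤B p-r q-s =
      +-small (product-rule p q r s)
        (≡.subst (ℚ.∣ p ℚ.* (q ℚ.- s) ∣ ℚ.<_) Bδ (*-small p≤B q-s))
        (≡.subst (ℚ._< ½ ℚ.* ε) (≡.cong ℚ.∣_∣ (ℚₚ.*-comm s (p ℚ.- r)))
          (≡.subst (ℚ.∣ s ℚ.* (p ℚ.- r) ∣ ℚ.<_) Bδ (*-small s≤B p-r)))

    modulus : ∀ B .{{_ : ℚ.Positive B}} ε → 0ℚ ℚ.< ε →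
              ∃[ δ ] (0ℚ ℚ.< δ × B ℚ.* δ ≡ ½ ℚ.* ε)
    modulus B ε 0<ε = δ , 0<δ , Bδ
      where
      instance
        B≢0 : ℚ.NonZero B
        B≢0 = ℚₚ.pos⇒nonZero B
        1/B>0 : ℚ.Positive (ℚ.1/ B)
        1/B>0 = ℚₚ.1/pos⇒pos B
      δ : ℚ
      δ = ℚ.1/ B ℚ.* (½ ℚ.* ε)
      0<δ : 0ℚ ℚ.< δ
      0<δ = ≡.subst (ℚ._< δ) (ℚₚ.*-zeroʳ (ℚ.1/ B)) (ℚₚ.*-monoʳ-<-pos (ℚ.1/ B) (half-pos 0<ε))
      Bδ : B ℚ.* δ ≡ ½ ℚ.* ε
      Bδ = ≡.trans (≡.sym (ℚₚ.*-assoc B (ℚ.1/ B) (½ ℚ.* ε)))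
          (≡.trans (≡.cong (ℚ._* (½ ℚ.* ε)) (ℚₚ.*-inverseʳ B)) (ℚₚ.*-identityˡ (½ ℚ.* ε)))

    <1⇒≤ : ∀ p q → ℚ.∣ p ℚ.- q ∣ ℚ.< 1ℚ → ℚ.∣ p ∣ ℚ.≤ 1ℚ ℚ.+ ℚ.∣ q ∣
    <1⇒≤ p q p-q<1 = ℚₚ.≤-trans
      (≡.subst (λ r → ℚ.∣ r ∣ ℚ.≤ ℚ.∣ p ℚ.- q ∣ ℚ.+ ℚ.∣ q ∣) (cancel p q)
        (ℚₚ.∣p+q∣≤∣p∣+∣q∣ (p ℚ.- q) q))
      (ℚₚ.+-mono-≤ (ℚₚ.<⇒≤ p-q<1) (ℚₚ.≤-refl {ℚ.∣ q ∣}))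
      where
      cancel : ∀ p q → (p ℚ.- q) ℚ.+ q ≡ p
      cancel = solve 2 (λ a b → (a :- b) :+ b := a) ≡.refl
        where open +-*-Solver

    ≤-+ˡ : ∀ {p} B B′ .{{_ : ℚ.Positive B′}} → p ℚ.≤ B → p ℚ.≤ B ℚ.+ B′
    ≤-+ˡ {p} B B′ p≤B = ≡.subst (ℚ._≤ B ℚ.+ B′) (ℚₚ.+-identityʳ p)
      (ℚₚ.+-mono-≤ p≤B (ℚₚ.<⇒≤ (ℚₚ.positive⁻¹ B′)))

    ≤-+ʳ : ∀ {p} B B′ .{{_ : ℚ.Positive B}} → p ℚ.≤ B′ → p ℚ.≤ B ℚ.+ B′
    ≤-+ʳ {p} B B′ p≤B′ = ≡.subst (ℚ._≤ B ℚ.+ B′) (ℚₚ.+-identityˡ p)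
      (ℚₚ.+-mono-≤ (ℚₚ.<⇒≤ (ℚₚ.positive⁻¹ B)) p≤B′)

    EventuallyBounded : (ℕ → ℚ) → ℚ → Set
    EventuallyBounded f B = ∃[ N ] (∀ n → N ℕ.≤ n → ℚ.∣ f n ∣ ℚ.≤ B)

    bound : ∀ x → ∃[ B ] (ℚ.Positive B × EventuallyBounded (seq x) B)
    bound x =
      let N , close = cauchy x 1ℚ (ℚₚ.positive⁻¹ 1ℚ) in
      1ℚ ℚ.+ ℚ.∣ seq x N ∣ ,
      ℚₚ.pos+nonNeg⇒pos 1ℚ ℚ.∣ seq x N ∣ {{ℚₚ.∣-∣-nonNeg (seq x N)}} ,
      N , λ n N≤n → <1⇒≤ (seq x n) (seq x N) (close n N N≤n ℕₚ.≤-refl)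

    bound₂ : ∀ x y → ∃[ B ] (ℚ.Positive B ×
             EventuallyBounded (seq x) B × EventuallyBounded (seq y) B)
    bound₂ x y =
      let B  , B>0  , N  , x≤B  = bound x
          B′ , B′>0 , N′ , y≤B′ = bound y in
      B ℚ.+ B′ ,
      ℚₚ.pos+pos⇒pos B {{B>0}} B′ {{B′>0}} ,
      (N  , λ n N≤n → ≤-+ˡ B B′ {{B′>0}} (x≤B n N≤n)) ,
      (N′ , λ n N≤n → ≤-+ʳ B B′ {{B>0}} (y≤B′ n N≤n))

  pointwise : ∀ {x y} → (∀ n → seq x n ≡ seq y n) → x ≃ y
  pointwise {x} {y} x≡y = mk≃ λ ε 0<ε →
    0 , λ n _ → ≡.subst (λ q → ℚ.∣ seq x n ℚ.- q ∣ ℚ.< ε) (x≡y n) (∣p-p∣<ε (seq x n) 0<ε)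

  ≃-isEquivalence : IsEquivalence _≃_
  ≃-isEquivalence = record
    { refl  = pointwise λ _ → ≡.refl
    ; sym   = λ {x} {y} x≃y → mk≃ λ ε 0<ε →
        let N , close = null x≃y ε 0<ε in
        N , λ n N≤n → flip-small (seq x n) (seq y n) (close n N≤n)
    ; trans = λ {x} {y} {z} x≃y y≃z → mk≃ λ ε 0<ε →
        let N  , close  = null x≃y (½ ℚ.* ε) (half-pos 0<ε)
            N′ , close′ = null y≃z (½ ℚ.* ε) (half-pos 0<ε) in
        N ℕ.⊔ N′ , λ n N≤n → +-small (telescope (seq x n) (seq y n) (seq z n))
          (close n (ℕₚ.m⊔n≤o⇒m≤o N N′ N≤n)) (close′ n (ℕₚ.m⊔n≤o⇒n≤o N N′ N≤n))
    }

  fromℚ : ℚ → ℝ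
  fromℚ q = mkℝ (λ _ → q) λ ε 0<ε → 0 , λ _ _ _ _ → ∣p-p∣<ε q 0<ε

  infixl 6 _+_
  infixl 7 _*_
  infix  8 -_

  _+_ : ℝ → ℝ → ℝ
  x + y = mkℝ (λ n → seq x n ℚ.+ seq y n) λ ε 0<ε →
    let N  , close  = cauchy x (½ ℚ.* ε) (half-pos 0<ε)
        N′ , close′ = cauchy y (½ ℚ.* ε) (half-pos 0<ε) in
    N ℕ.⊔ N′ , λ m n N≤m N≤n →
      +-small (interchange (seq x m) (seq y m) (seq x n) (seq y n))
        (close m n (ℕₚ.m⊔n≤o⇒m≤o N N′ N≤m) (ℕₚ.m⊔n≤o⇒m≤o N N′ N≤n))
        (close′ m n (ℕₚ.m⊔n≤o⇒n≤o N N′ N≤m) (ℕₚ.m⊔n≤o⇒n≤o N N′ N≤n))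

  -_ : ℝ → ℝ
  - x = mkℝ (λ n → ℚ.- seq x n) λ ε 0<ε →
    let N , close = cauchy x ε 0<ε in
    N , λ m n N≤m N≤n → ≡.subst (λ q → ℚ.∣ q ∣ ℚ.< ε) (≡.sym (neg-sub (seq x m) (seq x n)))
                           (close n m N≤n N≤m)

  _*_ : ℝ → ℝ → ℝ
  x * y = mkℝ (λ n → seq x n ℚ.* seq y n) λ ε 0<ε →
    let B , B>0 , (L , x≤B) , (L′ , y≤B) = bound₂ x y
        δ , 0<δ , Bδ = modulus B {{B>0}} ε 0<ε
        N  , close   = cauchy x δ 0<δ
        N′ , close′  = cauchy y δ 0<δ in
    (L ℕ.⊔ L′) ℕ.⊔ (N ℕ.⊔ N′) , λ m n M≤m M≤n →
      product-small {p = seq x m} {seq y m} {seq x n} {seq y n} {{B>0}} Bδ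
        (x≤B m (⊔⁴₁ L L′ N N′ M≤m)) (y≤B n (⊔⁴₂ L L′ N N′ M≤n))
        (close  m n (⊔⁴₃ L L′ N N′ M≤m) (⊔⁴₃ L L′ N N′ M≤n))
        (close′ m n (⊔⁴₄ L L′ N N′ M≤m) (⊔⁴₄ L L′ N N′ M≤n))

  +-cong : ∀ {x x′ y y′} → x ≃ x′ → y ≃ y′ → x + y ≃ x′ + y′
  +-cong {x} {x′} {y} {y′} x≃x′ y≃y′ = mk≃ λ ε 0<ε →
    let N  , close  = null x≃x′ (½ ℚ.* ε) (half-pos 0<ε)
        N′ , close′ = null y≃y′ (½ ℚ.* ε) (half-pos 0<ε) in
    N ℕ.⊔ N′ , λ n N≤n →
      +-small (interchange (seq x n) (seq y n) (seq x′ n) (seq y′ n))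
        (close n (ℕₚ.m⊔n≤o⇒m≤o N N′ N≤n)) (close′ n (ℕₚ.m⊔n≤o⇒n≤o N N′ N≤n))

  -‿cong : ∀ {x y} → x ≃ y → - x ≃ - y
  -‿cong {x} {y} x≃y = mk≃ λ ε 0<ε →
    let N , close = null (IsEquivalence.sym ≃-isEquivalence x≃y) ε 0<ε in
    N , λ n N≤n → ≡.subst (λ q → ℚ.∣ q ∣ ℚ.< ε) (≡.sym (neg-sub (seq x n) (seq y n))) (close n N≤n)

  *-cong : ∀ {x x′ y y′} → x ≃ x′ → y ≃ y′ → x * y ≃ x′ * y′
  *-cong {x} {x′} {y} {y′} x≃x′ y≃y′ = mk≃ λ ε 0<ε →
    let B , B>0 , (L , x≤B) , (L′ , y′≤B) = bound₂ x y′
        δ , 0<δ , Bδ = modulus B {{B>0}} ε 0<ε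
        N  , close   = null x≃x′ δ 0<δ
        N′ , close′  = null y≃y′ δ 0<δ in
    (L ℕ.⊔ L′) ℕ.⊔ (N ℕ.⊔ N′) , λ n M≤n →
      product-small {p = seq x n} {seq y n} {seq x′ n} {seq y′ n} {{B>0}} Bδ
        (x≤B n (⊔⁴₁ L L′ N N′ M≤n)) (y′≤B n (⊔⁴₂ L L′ N N′ M≤n))
        (close n (⊔⁴₃ L L′ N N′ M≤n)) (close′ n (⊔⁴₄ L L′ N N′ M≤n))

module ComplexNumbers where

  open RealNumbers

  record ℂ : Set where
    constructor _+i_
    field
      re im : ℝ
  open ℂ public

  infix 4 _≈_
  record _≈_ (z w : ℂ) : Set where
    constructor _,_
    field
      re≃ : re z ≃ re w
      im≃ : im z ≃ im w
  open _≈_ public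

  infixl 6 _⊕_
  infixl 7 _⊗_

  -- Opaque only so that unification does not unfold rational arithmetic.
  opaque
    _⊕_ _⊗_ : ℂ → ℂ → ℂ
    z ⊕ w = (re z + re w) +i (im z + im w)
    z ⊗ w = (re z * re w + - (im z * im w)) +i (re z * im w + im z * re w)

    ⊖_ : ℂ → ℂ
    ⊖ z = (- re z) +i (- im z)

    re-⊕ : ∀ z w → re (z ⊕ w) ≡ re z + re w
    re-⊕ z w = ≡.refl

    im-⊕ : ∀ z w → im (z ⊕ w) ≡ im z + im w
    im-⊕ z w = ≡.refl

    re-⊗ : ∀ z w → re (z ⊗ w) ≡ re z * re w + - (im z * im w)
    re-⊗ z w = ≡.refl

    im-⊗ : ∀ z w → im (z ⊗ w) ≡ re z * im w + im z * re w
    im-⊗ z w = ≡.refl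

    re-⊖ : ∀ z → re (⊖ z) ≡ - re z
    re-⊖ z = ≡.refl

    im-⊖ : ∀ z → im (⊖ z) ≡ - im z
    im-⊖ z = ≡.refl

  0ℂ 1ℂ : ℂ
  0ℂ = fromℚ 0ℚ +i fromℚ 0ℚ
  1ℂ = fromℚ 1ℚ +i fromℚ 0ℚ

  private
    module Laws where
      open +-*-Solver

      assoc-re : ∀ a b c d e f → (a ℚ.* c ℚ.+ ℚ.- (b ℚ.* d)) ℚ.* e ℚ.+ ℚ.- ((a ℚ.* d ℚ.+ b ℚ.* c) ℚ.* f)
        ≡ a ℚ.* (c ℚ.* e ℚ.+ ℚ.- (d ℚ.* f)) ℚ.+ ℚ.- (b ℚ.* (c ℚ.* f ℚ.+ d ℚ.* e))
      assoc-re = solve 6 (λ a b c d e f → (a :* c :+ :- (b :* d)) :* e :+ :- ((a :* d :+ b :* c) :* f)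
        := a :* (c :* e :+ :- (d :* f)) :+ :- (b :* (c :* f :+ d :* e))) ≡.refl

      assoc-im : ∀ a b c d e f → (a ℚ.* c ℚ.+ ℚ.- (b ℚ.* d)) ℚ.* f ℚ.+ (a ℚ.* d ℚ.+ b ℚ.* c) ℚ.* e
        ≡ a ℚ.* (c ℚ.* f ℚ.+ d ℚ.* e) ℚ.+ b ℚ.* (c ℚ.* e ℚ.+ ℚ.- (d ℚ.* f))
      assoc-im = solve 6 (λ a b c d e f → (a :* c :+ :- (b :* d)) :* f :+ (a :* d :+ b :* c) :* e
        := a :* (c :* f :+ d :* e) :+ b :* (c :* e :+ :- (d :* f))) ≡.refl

      idˡ-re : ∀ a b → 1ℚ ℚ.* a ℚ.+ ℚ.- (0ℚ ℚ.* b)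
        ≡ a
      idˡ-re = solve 2 (λ a b → con 1ℚ :* a :+ :- (con 0ℚ :* b)
        := a) ≡.refl

      idˡ-im : ∀ a b → 1ℚ ℚ.* b ℚ.+ 0ℚ ℚ.* a
        ≡ b
      idˡ-im = solve 2 (λ a b → con 1ℚ :* b :+ con 0ℚ :* a
        := b) ≡.refl

      distˡ-re : ∀ a b c d e f → a ℚ.* (c ℚ.+ e) ℚ.+ ℚ.- (b ℚ.* (d ℚ.+ f))
        ≡ (a ℚ.* c ℚ.+ ℚ.- (b ℚ.* d)) ℚ.+ (a ℚ.* e ℚ.+ ℚ.- (b ℚ.* f))
      distˡ-re = solve 6 (λ a b c d e f → a :* (c :+ e) :+ :- (b :* (d :+ f))
        := (a :* c :+ :- (b :* d)) :+ (a :* e :+ :- (b :* f))) ≡.refl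

      distˡ-im : ∀ a b c d e f → a ℚ.* (d ℚ.+ f) ℚ.+ b ℚ.* (c ℚ.+ e)
        ≡ (a ℚ.* d ℚ.+ b ℚ.* c) ℚ.+ (a ℚ.* f ℚ.+ b ℚ.* e)
      distˡ-im = solve 6 (λ a b c d e f → a :* (d :+ f) :+ b :* (c :+ e)
        := (a :* d :+ b :* c) :+ (a :* f :+ b :* e)) ≡.refl

      comm-re : ∀ a b c d → a ℚ.* c ℚ.+ ℚ.- (b ℚ.* d)
        ≡ c ℚ.* a ℚ.+ ℚ.- (d ℚ.* b)
      comm-re = solve 4 (λ a b c d → a :* c :+ :- (b :* d)
        := c :* a :+ :- (d :* b)) ≡.refl

      comm-im : ∀ a b c d → a ℚ.* d ℚ.+ b ℚ.* c
        ≡ c ℚ.* b ℚ.+ d ℚ.* a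
      comm-im = solve 4 (λ a b c d → a :* d :+ b :* c
        := c :* b :+ d :* a) ≡.refl

    module ≃ = IsEquivalence ≃-isEquivalence

  ≈-isEquivalence : IsEquivalence _≈_
  ≈-isEquivalence = record
    { refl  = ≃.refl , ≃.refl
    ; sym   = λ z≈w → ≃.sym (re≃ z≈w) , ≃.sym (im≃ z≈w)
    ; trans = λ z≈w w≈u → ≃.trans (re≃ z≈w) (re≃ w≈u) , ≃.trans (im≃ z≈w) (im≃ w≈u)
    }

  opaque
    unfolding _⊕_ _⊗_ ⊖_

    pointwise₂ : ∀ z w → (∀ n → seq (re z) n ≡ seq (re w) n) →
                 (∀ n → seq (im z) n ≡ seq (im w) n) → z ≈ w
    pointwise₂ z w p q = pointwise p , pointwise q

    ⊕-assoc : ∀ x y z → (x ⊕ y) ⊕ z ≈ x ⊕ (y ⊕ z)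
    ⊕-assoc x y z = pointwise₂ _ _
      (λ n → ℚₚ.+-assoc (seq (re x) n) (seq (re y) n) (seq (re z) n))
      (λ n → ℚₚ.+-assoc (seq (im x) n) (seq (im y) n) (seq (im z) n))

    ⊕-comm : ∀ x y → x ⊕ y ≈ y ⊕ x
    ⊕-comm x y = pointwise₂ _ _
      (λ n → ℚₚ.+-comm (seq (re x) n) (seq (re y) n))
      (λ n → ℚₚ.+-comm (seq (im x) n) (seq (im y) n))

    ⊕-identityˡ : ∀ x → 0ℂ ⊕ x ≈ x
    ⊕-identityˡ x = pointwise₂ _ _
      (λ n → ℚₚ.+-identityˡ (seq (re x) n)) (λ n → ℚₚ.+-identityˡ (seq (im x) n))

    ⊕-inverseˡ : ∀ x → ⊖ x ⊕ x ≈ 0ℂ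
    ⊕-inverseˡ x = pointwise₂ _ _
      (λ n → ℚₚ.+-inverseˡ (seq (re x) n)) (λ n → ℚₚ.+-inverseˡ (seq (im x) n))

    ⊗-assoc : ∀ x y z → (x ⊗ y) ⊗ z ≈ x ⊗ (y ⊗ z)
    ⊗-assoc x y z = pointwise₂ _ _
      (λ n → Laws.assoc-re (seq (re x) n) (seq (im x) n) (seq (re y) n) (seq (im y) n) (seq (re z) n) (seq (im z) n))
      (λ n → Laws.assoc-im (seq (re x) n) (seq (im x) n) (seq (re y) n) (seq (im y) n) (seq (re z) n) (seq (im z) n))

    ⊗-comm : ∀ x y → x ⊗ y ≈ y ⊗ x
    ⊗-comm x y = pointwise₂ _ _
      (λ n → Laws.comm-re (seq (re x) n) (seq (im x) n) (seq (re y) n) (seq (im y) n))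
      (λ n → Laws.comm-im (seq (re x) n) (seq (im x) n) (seq (re y) n) (seq (im y) n))

    ⊗-identityˡ : ∀ x → 1ℂ ⊗ x ≈ x
    ⊗-identityˡ x = pointwise₂ _ _
      (λ n → Laws.idˡ-re (seq (re x) n) (seq (im x) n))
      (λ n → Laws.idˡ-im (seq (re x) n) (seq (im x) n))

    ⊗-distribˡ-⊕ : ∀ x y z → x ⊗ (y ⊕ z) ≈ x ⊗ y ⊕ x ⊗ z
    ⊗-distribˡ-⊕ x y z = pointwise₂ _ _
      (λ n → Laws.distˡ-re (seq (re x) n) (seq (im x) n) (seq (re y) n) (seq (im y) n) (seq (re z) n) (seq (im z) n))
      (λ n → Laws.distˡ-im (seq (re x) n) (seq (im x) n) (seq (re y) n) (seq (im y) n) (seq (re z) n) (seq (im z) n))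

    ⊕-cong : ∀ {x x′ y y′} → x ≈ x′ → y ≈ y′ → x ⊕ y ≈ x′ ⊕ y′
    ⊕-cong {x} {x′} {y} {y′} p q =
      +-cong {re x} {re x′} {re y} {re y′} (re≃ p) (re≃ q) ,
      +-cong {im x} {im x′} {im y} {im y′} (im≃ p) (im≃ q)

    ⊖-cong : ∀ {x y} → x ≈ y → ⊖ x ≈ ⊖ y
    ⊖-cong {x} {y} p = -‿cong {re x} {re y} (re≃ p) , -‿cong {im x} {im y} (im≃ p)

    ⊗-cong : ∀ {x x′ y y′} → x ≈ x′ → y ≈ y′ → x ⊗ y ≈ x′ ⊗ y′
    ⊗-cong {x} {x′} {y} {y′} p q =
      +-cong {re x * re y} {re x′ * re y′} { - (im x * im y)} { - (im x′ * im y′)}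
        (*-cong {re x} {re x′} {re y} {re y′} (re≃ p) (re≃ q))
        (-‿cong {im x * im y} {im x′ * im y′}
          (*-cong {im x} {im x′} {im y} {im y′} (im≃ p) (im≃ q))) ,
      +-cong {re x * im y} {re x′ * im y′} {im x * re y} {im x′ * re y′}
        (*-cong {re x} {re x′} {im y} {im y′} (re≃ p) (im≃ q))
        (*-cong {im x} {im x′} {re y} {re y′} (im≃ p) (re≃ q))

  ≈-setoid : Setoid 0ℓ 0ℓ
  ≈-setoid = record { isEquivalence = ≈-isEquivalence }

  private
    module C = Consequences ≈-setoid

  ℂ-commutativeRing : CommutativeRing 0ℓ 0ℓ
  ℂ-commutativeRing = record
    { Carrier = ℂ
    ; _≈_ = _≈_
    ; _+_ = _⊕_
    ; _*_ = _⊗_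
    ; -_  = ⊖_
    ; 0#  = 0ℂ
    ; 1#  = 1ℂ
    ; isCommutativeRing = record
      { isRing = record
        { +-isAbelianGroup = record
          { isGroup = record
            { isMonoid = record
              { isSemigroup = record
                { isMagma = record
                  { isEquivalence = ≈-isEquivalence
                  ; ∙-cong = ⊕-cong
                  }
                ; assoc = ⊕-assoc
                }
              ; identity = C.comm∧idˡ⇒id ⊕-comm ⊕-identityˡ
              }
            ; inverse = C.comm∧invˡ⇒inv ⊕-comm ⊕-inverseˡ
            ; ⁻¹-cong = ⊖-cong
            }
          ; comm = ⊕-comm
          }
        ; *-cong = ⊗-cong
        ; *-assoc = ⊗-assoc
        ; *-identity = C.comm∧idˡ⇒id ⊗-comm ⊗-identityˡ
        ; distrib = C.comm∧distrˡ⇒distr ⊕-cong ⊗-comm ⊗-distribˡ-⊕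
        }
      ; *-comm = ⊗-comm
      }
    }

module _ {g ℓg c ℓ} (G : Group g ℓg) (K : CommutativeRing c ℓ) where

  private
    module G = Group G

  record GModule m ℓm : Set (g ⊔ ℓg ⊔ c ⊔ ℓ ⊔ lsuc (m ⊔ ℓm)) where
    field
      underlying : Module K m ℓm
    open Module underlying public

    infixr 7 _•_
    field
      _•_        : G.Carrier → Carrierᴹ → Carrierᴹ
      •-cong     : ∀ {x y u v} → x G.≈ y → u ≈ᴹ v → x • u ≈ᴹ y • v
      •-identity : ∀ v → G.ε • v ≈ᴹ v
      •-assoc    : ∀ x y v → (x G.∙ y) • v ≈ᴹ x • (y • v)
      •-+ᴹ       : ∀ x u v → x • (u +ᴹ v) ≈ᴹ x • u +ᴹ x • v
      •-*ₗ       : ∀ x k v → x • (k *ₗ v) ≈ᴹ k *ₗ (x • v)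

  record GModuleIsomorphism {m ℓm m′ ℓm′} (V : GModule m ℓm) (W : GModule m′ ℓm′)
         : Set (g ⊔ c ⊔ m ⊔ ℓm ⊔ m′ ⊔ ℓm′) where
    private
      module V = GModule V
      module W = GModule W
    field
      to                  : V.Carrierᴹ → W.Carrierᴹ
      isModuleIsomorphism : IsModuleIsomorphism
                              (Module.rawModule V.underlying) (Module.rawModule W.underlying) to
      equivariant         : ∀ x v → to (x V.• v) W.≈ᴹ x W.• to v

𝔖 : ℕ → Group 0ℓ 0ℓ
𝔖 n = record
  { Carrier = Permutation′ n
  ; _≈_ = Perm._≈_
  ; _∙_ = λ π ρ → ρ ∘ₚ π          -- (π ∙ ρ) i = π (ρ i)
  ; ε   = Perm.id
  ; _⁻¹ = Perm.flip
  ; isGroup = record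
    { isMonoid = record
      { isSemigroup = record
        { isMagma = record
          { isEquivalence = record
            { refl = λ _ → ≡.refl
            ; sym = λ p i → ≡.sym (p i)
            ; trans = λ p q i → ≡.trans (p i) (q i)
            }
          ; ∙-cong = λ {π} {π′} {ρ} {ρ′} p q i → ≡.trans (p (ρ ⟨$⟩ʳ i)) (≡.cong (π′ ⟨$⟩ʳ_) (q i))
          }
        ; assoc = λ _ _ _ _ → ≡.refl
        }
      ; identity = (λ _ _ → ≡.refl) , (λ _ _ → ≡.refl)
      }
    ; inverse = (λ π _ → Perm.inverseˡ π) , (λ π _ → Perm.inverseʳ π)
    ; ⁻¹-cong = λ {π} {ρ} p i → ≡.trans
        (≡.cong (π ⟨$⟩ˡ_) (≡.sym (≡.trans (p (ρ ⟨$⟩ˡ i)) (Perm.inverseʳ ρ))))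
        (Perm.inverseˡ π)
    }
  }

module OrbitHarmonics {c ℓ} (K : CommutativeRing c ℓ) (n : ℕ) where

  open CommutativeRing K renaming (Carrier to ∣K∣)
  open Exp semiring using (_^_)

  private
    module Add = Sum ℕₚ.+-0-commutativeMonoid
    module Mul = Sum *-commutativeMonoid
    module ≈-Reasoning = SetoidReasoning setoid
    module K = RingProperties ring

  Matrix : Set c
  Matrix = Fin n → Fin n → ∣K∣

  -- t represents ∏ x_{i,j} ^ (t i j).

  Monomial : Set
  Monomial = Fin n → Fin n → ℕ

  infix 4 _≗_ _≗?_
  _≗_ : Monomial → Monomial → Set
  t ≗ m = ∀ i j → t i j ≡ m i j

  _≗?_ : ∀ t m → Dec (t ≗ m)
  t ≗? m = Finₚ.all? λ i → Finₚ.all? λ j → t i j ℕₚ.≟ m i j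

  degree : Monomial → ℕ
  degree t = Add.∑[ i < n ] Add.∑[ j < n ] t i j

  -- Finite formal sums of terms; a monomial may be repeated, so polynomials
  -- are compared through their coefficients.

  Polynomial : Set c
  Polynomial = List (∣K∣ × Monomial)

  when : Bool → ∣K∣ → ∣K∣
  when b k = if b then k else 0#

  coeff : Polynomial → Monomial → ∣K∣
  coeff []            m = 0#
  coeff ((k , t) ∷ p) m = when (does (t ≗? m)) k + coeff p m

  infix 4 _≈ᴾ_
  record _≈ᴾ_ (p q : Polynomial) : Set ℓ where
    constructor mk≈ᴾ
    field
      coeff≈ : ∀ m → coeff p m ≈ coeff q m
  open _≈ᴾ_ public

  0ᴾ : Polynomial
  0ᴾ = []

  const : ∣K∣ → Polynomial
  const k = (k , λ _ _ → 0) ∷ []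

  infixl 6 _+ᴾ_ _⊝_
  infixl 7 _*ᴾ_
  infix  8 -ᴾ_

  _+ᴾ_ _*ᴾ_ _⊝_ : Polynomial → Polynomial → Polynomial
  p +ᴾ q = p ++ q
  p *ᴾ q = cartesianProductWith (λ (k , s) (l , t) → k * l , λ i j → s i j ℕ.+ t i j) p q

  -ᴾ_ : Polynomial → Polynomial
  -ᴾ p = map (λ (k , t) → - k , t) p

  p ⊝ q = p +ᴾ -ᴾ q

  -- Mul.∑ is iteration of _*_, i.e. a product.

  evalMonomial : Monomial → Matrix → ∣K∣
  evalMonomial t A = Mul.∑[ i < n ] Mul.∑[ j < n ] (A i j ^ t i j)

  eval : Polynomial → Matrix → ∣K∣
  eval []            A = 0#
  eval ((k , t) ∷ p) A = k * evalMonomial t A + eval p A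

  component : ℕ → Polynomial → Polynomial
  component d = filter (λ (_ , t) → degree t ℕₚ.≟ d)

  Homogeneous : ℕ → Polynomial → Set ℓ
  Homogeneous d p = ∀ m → degree m ≢ d → coeff p m ≈ 0#

  data ⟨_⟩ {s} (S : Pred Polynomial s) : Pred Polynomial (c ⊔ ℓ ⊔ s) where
    gen   : ∀ {p} → S p → ⟨ S ⟩ p
    0∈    : ⟨ S ⟩ 0ᴾ
    +-∈   : ∀ {p q} → ⟨ S ⟩ p → ⟨ S ⟩ q → ⟨ S ⟩ (p +ᴾ q)
    *-∈   : ∀ q {p} → ⟨ S ⟩ p → ⟨ S ⟩ (q *ᴾ p)
    ≈-∈   : ∀ {p q} → p ≈ᴾ q → ⟨ S ⟩ p → ⟨ S ⟩ q

  HasDegree : ℕ → Polynomial → Set ℓ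
  HasDegree d g = (∀ e → d ℕ.< e → component e g ≈ᴾ 0ᴾ) × ¬ (component d g ≈ᴾ 0ᴾ)

  -- The highest-degree components of the nonzero elements of I: classically
  -- g has a degree exactly when it is nonzero.

  TopComponent : ∀ {s} → Pred Polynomial s → Pred Polynomial (c ⊔ ℓ ⊔ s)
  TopComponent I h = Σ[ g ∈ Polynomial ] ∃[ d ] (I g × HasDegree d g × h ≡ component d g)

  gr : ∀ {s} → Pred Polynomial s → Pred Polynomial (c ⊔ ℓ ⊔ s)
  gr I = ⟨ TopComponent I ⟩

  𝐈 : ∀ {s} → Pred Matrix s → Pred Polynomial (c ⊔ ℓ ⊔ s)
  𝐈 Z p = ∀ A → Z A → eval p A ≈ 0#

  -- g · x_{i,j} = x_{g(i),g(j)}, so x_{i,j} has in g · t the exponent that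
  -- x_{g⁻¹(i),g⁻¹(j)} has in t.

  infixr 8 _·ᴹ_ _·_
  _·ᴹ_ : Permutation′ n → Monomial → Monomial
  (g ·ᴹ t) i j = t (g ⟨$⟩ˡ i) (g ⟨$⟩ˡ j)

  _·_ : Permutation′ n → Polynomial → Polynomial
  g · p = map (λ (k , t) → k , g ·ᴹ t) p

  conjugate : Permutation′ n → Matrix → Matrix
  conjugate g A i j = A (g ⟨$⟩ʳ i) (g ⟨$⟩ʳ j)

  ConjugationStable : ∀ {s} → Pred Matrix s → Set (c ⊔ s)
  ConjugationStable Z = ∀ g {A} → Z A → Z (conjugate g A)

  when-+ : ∀ b k l → when b (k + l) ≈ when b k + when b l
  when-+ true  k l = refl
  when-+ false k l = sym (+-identityˡ 0#)

  when-neg : ∀ b k → when b (- k) ≈ - when b k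
  when-neg true  k = refl
  when-neg false k = sym (K.-0#≈0#)

  when-* : ∀ b k l → when b (k * l) ≈ k * when b l
  when-* true  k l = refl
  when-* false k l = sym (zeroʳ k)

  when-cong : ∀ b {k l} → k ≈ l → when b k ≈ when b l
  when-cong true  k≈l = k≈l
  when-cong false k≈l = refl

  coeff-+ : ∀ p q m → coeff (p +ᴾ q) m ≈ coeff p m + coeff q m
  coeff-+ []            q m = sym (+-identityˡ _)
  coeff-+ ((k , t) ∷ p) q m = trans (+-congˡ (coeff-+ p q m)) (sym (+-assoc _ _ _))

  coeff-neg : ∀ p m → coeff (-ᴾ p) m ≈ - coeff p m
  coeff-neg []            m = sym (K.-0#≈0#)
  coeff-neg ((k , t) ∷ p) m = trans
    (+-cong (when-neg (does (t ≗? m)) k) (coeff-neg p m))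
    (K.-‿+-comm _ _)

  coeff-const : ∀ k p m → coeff (const k *ᴾ p) m ≈ k * coeff p m
  coeff-const k []            m = sym (zeroʳ k)
  coeff-const k ((l , t) ∷ p) m = trans
    (+-cong (when-* (does (t ≗? m)) k l) (coeff-const k p m))
    (sym (distribˡ k _ _))

  coeff-≗ : ∀ p {m m′} → m ≗ m′ → coeff p m ≈ coeff p m′
  coeff-≗ []            m≗m′ = refl
  coeff-≗ ((k , t) ∷ p) {m} {m′} m≗m′ = +-cong
    (reflexive (≡.cong (λ b → when b k) (does-⇔ (mk⇔
      (λ e i j → ≡.trans (e i j) (m≗m′ i j))
      (λ e i j → ≡.trans (e i j) (≡.sym (m≗m′ i j)))) (t ≗? m) (t ≗? m′))))
    (coeff-≗ p m≗m′)

  coeff-· : ∀ g p m → coeff (g · p) m ≈ coeff p (λ i j → m (g ⟨$⟩ʳ i) (g ⟨$⟩ʳ j))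
  coeff-· g []            m = refl
  coeff-· g ((k , t) ∷ p) m = +-cong
    (reflexive (≡.cong (λ b → when b k) (does-⇔ (mk⇔
      (λ e i j → ≡.trans (≡.cong₂ t (≡.sym (Perm.inverseˡ g)) (≡.sym (Perm.inverseˡ g)))
                         (e (g ⟨$⟩ʳ i) (g ⟨$⟩ʳ j)))
      (λ e i j → ≡.trans (e (g ⟨$⟩ˡ i) (g ⟨$⟩ˡ j))
                         (≡.cong₂ m (Perm.inverseʳ g) (Perm.inverseʳ g))))
      ((g ·ᴹ t) ≗? m) (t ≗? _))))
    (coeff-· g p m)

  ≈ᴾ-sym : ∀ {p q} → p ≈ᴾ q → q ≈ᴾ p
  ≈ᴾ-sym p≈q = mk≈ᴾ λ m → sym (coeff≈ p≈q m)

  ≈ᴾ-trans : ∀ {p q r} → p ≈ᴾ q → q ≈ᴾ r → p ≈ᴾ r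
  ≈ᴾ-trans p≈q q≈r = mk≈ᴾ λ m → trans (coeff≈ p≈q m) (coeff≈ q≈r m)

  ≈ᴾ-reflexive : ∀ {p q} → p ≡ q → p ≈ᴾ q
  ≈ᴾ-reflexive ≡.refl = mk≈ᴾ λ _ → refl

  coeff-sub : ∀ p q m → coeff (p ⊝ q) m ≈ coeff p m - coeff q m
  coeff-sub p q m = trans (coeff-+ p (-ᴾ q) m) (+-congˡ (coeff-neg q m))

  ·-cong : ∀ {g h p q} → g Perm.≈ h → p ≈ᴾ q → g · p ≈ᴾ h · q
  ·-cong {g} {h} {p} {q} g≈h p≈q = mk≈ᴾ λ m → begin
    coeff (g · p) m                                    ≈⟨ coeff-· g p m ⟩
    coeff p (λ i j → m (g ⟨$⟩ʳ i) (g ⟨$⟩ʳ j))          ≈⟨ coeff≈ p≈q _ ⟩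
    coeff q (λ i j → m (g ⟨$⟩ʳ i) (g ⟨$⟩ʳ j))
      ≈⟨ coeff-≗ q (λ i j → ≡.cong₂ m (g≈h i) (g≈h j)) ⟩
    coeff q (λ i j → m (h ⟨$⟩ʳ i) (h ⟨$⟩ʳ j))          ≈⟨ coeff-· h q m ⟨
    coeff (h · q) m                                    ∎
    where open ≈-Reasoning

  ·-+ : ∀ g p q → g · (p +ᴾ q) ≡ g · p +ᴾ g · q
  ·-+ g []      q = ≡.refl
  ·-+ g (_ ∷ p) q = ≡.cong (_ ∷_) (·-+ g p q)

  ·-neg : ∀ g p → g · (-ᴾ p) ≡ -ᴾ (g · p)
  ·-neg g []      = ≡.refl
  ·-neg g (_ ∷ p) = ≡.cong (_ ∷_) (·-neg g p)

  ·-* : ∀ g p q → g · (p *ᴾ q) ≡ g · p *ᴾ g · q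
  ·-* g []            q = ≡.refl
  ·-* g ((k , s) ∷ p) q = ≡.trans (·-+ g _ (p *ᴾ q)) (≡.cong₂ _++_ (term q) (·-* g p q))
    where
    term : ∀ q → g · map _ q ≡ map _ (g · q)
    term []      = ≡.refl
    term (_ ∷ q) = ≡.cong (_ ∷_) (term q)

  ·-sub : ∀ g p q → g · (p ⊝ q) ≡ g · p ⊝ g · q
  ·-sub g p q = ≡.trans (·-+ g p (-ᴾ q)) (≡.cong (g · p ++_) (·-neg g q))

  ·-∘ : ∀ g h p → (h ∘ₚ g) · p ≡ g · (h · p)
  ·-∘ g h []      = ≡.refl
  ·-∘ g h (_ ∷ p) = ≡.cong (_ ∷_) (·-∘ g h p)

  ·-id : ∀ p → Perm.id · p ≡ p
  ·-id []      = ≡.refl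
  ·-id (_ ∷ p) = ≡.cong (_ ∷_) (·-id p)

  ·-inverse : ∀ g p → Perm.flip g · (g · p) ≈ᴾ p
  ·-inverse g p = ≈ᴾ-trans (≈ᴾ-reflexive (≡.sym (·-∘ (Perm.flip g) g p)))
    (≈ᴾ-trans (·-cong {g ∘ₚ Perm.flip g} {Perm.id} {q = p} (λ _ → Perm.inverseˡ g) (≈ᴾ-reflexive ≡.refl))
              (≈ᴾ-reflexive (·-id p)))

  degree-≡ : ∀ {t m} → t ≗ m → degree t ≡ degree m
  degree-≡ t≗m = Add.sum-cong-≗ λ i → Add.sum-cong-≗ λ j → t≗m i j

  degree-reindex : ∀ g m → degree (λ i j → m (g ⟨$⟩ʳ i) (g ⟨$⟩ʳ j)) ≡ degree m
  degree-reindex g m = ≡.sym (≡.trans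
    (Add.sum-permute (λ i → Add.∑[ j < n ] m i j) g)
    (Add.sum-cong-≗ λ i → Add.sum-permute (m (g ⟨$⟩ʳ i)) g))

  component-· : ∀ d g p → component d (g · p) ≡ g · component d p
  component-· d g []            = ≡.refl
  component-· d g ((k , t) ∷ p)
    rewrite degree-reindex (Perm.flip g) t with degree t ℕ.≡ᵇ d
  ... | true  = ≡.cong (_ ∷_) (component-· d g p)
  ... | false = component-· d g p

  evalMonomial-· : ∀ g t A → evalMonomial (g ·ᴹ t) A ≈ evalMonomial t (conjugate g A)
  evalMonomial-· g t A = trans
    (Mul.sum-permute (λ i → Mul.∑[ j < n ] (A i j ^ (g ·ᴹ t) i j)) g)
    (Mul.sum-cong-≋ λ i → trans
      (Mul.sum-permute (λ j → A (g ⟨$⟩ʳ i) j ^ (g ·ᴹ t) (g ⟨$⟩ʳ i) j) g)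
      (Mul.sum-cong-≋ λ j → reflexive
        (≡.cong (A (g ⟨$⟩ʳ i) (g ⟨$⟩ʳ j) ^_) (≡.cong₂ t (Perm.inverseˡ g) (Perm.inverseˡ g)))))

  eval-· : ∀ g p A → eval (g · p) A ≈ eval p (conjugate g A)
  eval-· g []            A = refl
  eval-· g ((k , t) ∷ p) A = +-cong (*-congˡ (evalMonomial-· g t A)) (eval-· g p A)

  ·-⟨⟩ : ∀ {s} {S : Pred Polynomial s} g → (∀ {p} → S p → S (g · p)) →
         ∀ {p} → ⟨ S ⟩ p → ⟨ S ⟩ (g · p)
  ·-⟨⟩ g S· (gen Sp)                 = gen (S· Sp)
  ·-⟨⟩ g S· 0∈                       = 0∈
  ·-⟨⟩ {S = S} g S· (+-∈ {p} {q} Jp Jq) =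
    ≡.subst ⟨ S ⟩ (≡.sym (·-+ g p q)) (+-∈ (·-⟨⟩ g S· Jp) (·-⟨⟩ g S· Jq))
  ·-⟨⟩ {S = S} g S· (*-∈ q {p} Jp)   =
    ≡.subst ⟨ S ⟩ (≡.sym (·-* g q p)) (*-∈ (g · q) (·-⟨⟩ g S· Jp))
  ·-⟨⟩ g S· (≈-∈ p≈q Jp)          = ≈-∈ (·-cong {g} {g} (λ _ → ≡.refl) p≈q) (·-⟨⟩ g S· Jp)

  ·-TopComponent : ∀ {s} {I : Pred Polynomial s} g → (∀ {p} → I p → I (g · p)) →
                   ∀ {p} → TopComponent I p → TopComponent I (g · p)
  ·-TopComponent g I· (f , d , If , (above , ≉0) , ≡.refl) =
    g · f , d , I· If ,
    ( (λ e d<e → ≈ᴾ-trans (≈ᴾ-reflexive (component-· e g f))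
                          (·-cong {g} {g} (λ _ → ≡.refl) (above e d<e)))
    , λ ≈0 → ≉0 (≈ᴾ-trans (≈ᴾ-sym (·-inverse g (component d f)))
                  (·-cong {Perm.flip g} {Perm.flip g} (λ _ → ≡.refl)
                    (≈ᴾ-trans (≈ᴾ-reflexive (≡.sym (component-· d g f))) ≈0)))) ,
    ≡.sym (component-· d g f)

  ·-gr𝐈 : ∀ {s} {Z : Pred Matrix s} → ConjugationStable Z →
          ∀ g {p} → gr (𝐈 Z) p → gr (𝐈 Z) (g · p)
  ·-gr𝐈 Z-stable g = ·-⟨⟩ g (·-TopComponent g λ {p} Ip A ZA →
    trans (eval-· g p A) (Ip _ (Z-stable g ZA)))

  module _ {s} (Z : Pred Matrix s) (d : ℕ) where

    -- R(Z)_d: homogeneous polynomials of degree d, with the equality of the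
    -- quotient K[x_{n×n}] / gr I(Z).

    R-Carrier : Set (c ⊔ ℓ)
    R-Carrier = Σ Polynomial (Homogeneous d)

    infix 4 _∼_
    record _∼_ (p q : R-Carrier) : Set (c ⊔ ℓ ⊔ s) where
      constructor mk∼
      field
        difference : gr (𝐈 Z) (proj₁ p ⊝ proj₁ q)
    open _∼_ public

    J : Pred Polynomial (c ⊔ ℓ ⊔ s)
    J = gr (𝐈 Z)

    ≈⇒∼ : ∀ {p q : R-Carrier} → (∀ m → coeff (proj₁ p) m ≈ coeff (proj₁ q) m) → p ∼ q
    ≈⇒∼ {p , _} {q , _} p≈q = mk∼ (≈-∈ (mk≈ᴾ λ m → sym (begin
      coeff (p ⊝ q) m         ≈⟨ coeff-sub p q m ⟩
      coeff p m - coeff q m    ≈⟨ +-congʳ (p≈q m) ⟩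
      coeff q m - coeff q m    ≈⟨ -‿inverseʳ _ ⟩
      0#                       ∎)) 0∈)
      where open ≈-Reasoning

    scale : ∀ k {p} → J p → J (const k *ᴾ p)
    scale k = *-∈ (const k)

    ∼-sym : ∀ {p q} → p ∼ q → q ∼ p
    ∼-sym {p , _} {q , _} p∼q = mk∼ (≈-∈ (mk≈ᴾ λ m → begin
      coeff (const (- 1#) *ᴾ (p ⊝ q)) m     ≈⟨ coeff-const (- 1#) (p ⊝ q) m ⟩
      - 1# * coeff (p ⊝ q) m                ≈⟨ *-congˡ (coeff-sub p q m) ⟩
      - 1# * (coeff p m - coeff q m)         ≈⟨ lemma (coeff p m) (coeff q m) ⟩
      coeff q m - coeff p m                  ≈⟨ coeff-sub q p m ⟨
      coeff (q ⊝ p) m                       ∎) (scale (- 1#) (difference p∼q)))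
      where
      open ≈-Reasoning
      lemma : ∀ a b → - 1# * (a - b) ≈ b - a
      lemma a b = trans (K.-1*x≈-x (a - b)) (AbelianGroupProperties.⁻¹-anti-homo‿- +-abelianGroup a b)

    ∼-trans : ∀ {p q r} → p ∼ q → q ∼ r → p ∼ r
    ∼-trans {p , _} {q , _} {r , _} p∼q q∼r = mk∼ (≈-∈ (mk≈ᴾ λ m → begin
      coeff ((p ⊝ q) +ᴾ (q ⊝ r)) m                     ≈⟨ coeff-+ (p ⊝ q) (q ⊝ r) m ⟩
      coeff (p ⊝ q) m + coeff (q ⊝ r) m                ≈⟨ +-cong (coeff-sub p q m) (coeff-sub q r m) ⟩
      (coeff p m - coeff q m) + (coeff q m - coeff r m)  ≈⟨ lemma (coeff p m) (coeff q m) (coeff r m) ⟩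
      coeff p m - coeff r m                              ≈⟨ coeff-sub p r m ⟨
      coeff (p ⊝ r) m                                   ∎) (+-∈ (difference p∼q) (difference q∼r)))
      where
      open ≈-Reasoning
      lemma : ∀ a b c → (a - b) + (b - c) ≈ a - c
      lemma a b c = begin
        (a - b) + (b - c)       ≈⟨ +-assoc a (- b) (b - c) ⟩
        a + (- b + (b - c))     ≈⟨ +-congˡ (+-assoc (- b) b (- c)) ⟨
        a + ((- b + b) - c)     ≈⟨ +-congˡ (+-congʳ (-‿inverseˡ b)) ⟩
        a + (0# - c)            ≈⟨ +-congˡ (+-identityˡ (- c)) ⟩
        a - c                   ∎

    _+ᴿ_ : R-Carrier → R-Carrier → R-Carrier
    (p , p-hom) +ᴿ (q , q-hom) = p +ᴾ q , λ m ≢d →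
      trans (coeff-+ p q m) (trans (+-cong (p-hom m ≢d) (q-hom m ≢d)) (+-identityˡ 0#))

    -ᴿ_ : R-Carrier → R-Carrier
    -ᴿ (p , p-hom) = -ᴾ p , λ m ≢d →
      trans (coeff-neg p m) (trans (-‿cong (p-hom m ≢d)) (K.-0#≈0#))

    0ᴿ : R-Carrier
    0ᴿ = 0ᴾ , λ _ _ → refl

    _*ᴿ_ : ∣K∣ → R-Carrier → R-Carrier
    k *ᴿ (p , p-hom) = const k *ᴾ p , λ m ≢d →
      trans (coeff-const k p m) (trans (*-congˡ (p-hom m ≢d)) (zeroʳ k))

    _•ᴿ_ : Permutation′ n → R-Carrier → R-Carrier
    g •ᴿ (p , p-hom) = g · p , λ m ≢d → trans (coeff-· g p m)
      (p-hom _ λ ≡d → ≢d (≡.trans (≡.sym (degree-reindex g m)) ≡d))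

    +ᴿ-cong : ∀ {p p′ q q′} → p ∼ p′ → q ∼ q′ → (p +ᴿ q) ∼ (p′ +ᴿ q′)
    +ᴿ-cong {p , _} {p′ , _} {q , _} {q′ , _} p∼p′ q∼q′ = mk∼ (≈-∈ (mk≈ᴾ λ m → begin
      coeff ((p ⊝ p′) +ᴾ (q ⊝ q′)) m                      ≈⟨ coeff-+ (p ⊝ p′) (q ⊝ q′) m ⟩
      coeff (p ⊝ p′) m + coeff (q ⊝ q′) m                 ≈⟨ +-cong (coeff-sub p p′ m) (coeff-sub q q′ m) ⟩
      (coeff p m - coeff p′ m) + (coeff q m - coeff q′ m)   ≈⟨ lemma _ _ _ _ ⟩
      (coeff p m + coeff q m) - (coeff p′ m + coeff q′ m)
        ≈⟨ +-cong (coeff-+ p q m) (-‿cong (coeff-+ p′ q′ m)) ⟨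
      coeff (p +ᴾ q) m - coeff (p′ +ᴾ q′) m                 ≈⟨ coeff-sub (p +ᴾ q) (p′ +ᴾ q′) m ⟨
      coeff ((p +ᴾ q) ⊝ (p′ +ᴾ q′)) m                      ∎) (+-∈ (difference p∼p′) (difference q∼q′)))
      where
      open ≈-Reasoning
      lemma : ∀ a a′ b b′ → (a - a′) + (b - b′) ≈ (a + b) - (a′ + b′)
      lemma a a′ b b′ = trans
        (CommutativeSemigroupProperties.interchange +-commutativeSemigroup a (- a′) b (- b′))
        (+-congˡ (K.-‿+-comm a′ b′))

    -ᴿ-cong : ∀ {p q} → p ∼ q → (-ᴿ p) ∼ (-ᴿ q)
    -ᴿ-cong {p , _} {q , _} p∼q = mk∼ (≈-∈ (mk≈ᴾ λ m → begin
      coeff (const (- 1#) *ᴾ (p ⊝ q)) m     ≈⟨ coeff-const (- 1#) (p ⊝ q) m ⟩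
      - 1# * coeff (p ⊝ q) m                ≈⟨ *-congˡ (coeff-sub p q m) ⟩
      - 1# * (coeff p m - coeff q m)         ≈⟨ lemma (coeff p m) (coeff q m) ⟩
      - coeff p m - - coeff q m              ≈⟨ +-cong (coeff-neg p m) (-‿cong (coeff-neg q m)) ⟨
      coeff (-ᴾ p) m - coeff (-ᴾ q) m        ≈⟨ coeff-sub (-ᴾ p) (-ᴾ q) m ⟨
      coeff (-ᴾ p ⊝ -ᴾ q) m                 ∎) (scale (- 1#) (difference p∼q)))
      where
      open ≈-Reasoning
      lemma : ∀ a b → - 1# * (a - b) ≈ - a - - b
      lemma a b = trans (K.-1*x≈-x (a - b)) (sym (K.-‿+-comm a (- b)))

    *ᴿ-cong : ∀ {k l p q} → k ≈ l → p ∼ q → (k *ᴿ p) ∼ (l *ᴿ q)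
    *ᴿ-cong {k} {l} {p , _} {q , _} k≈l p∼q = mk∼ (≈-∈ (mk≈ᴾ λ m → begin
      coeff (const k *ᴾ (p ⊝ q)) m                      ≈⟨ coeff-const k (p ⊝ q) m ⟩
      k * coeff (p ⊝ q) m                               ≈⟨ *-congˡ (coeff-sub p q m) ⟩
      k * (coeff p m - coeff q m)                        ≈⟨ K.x[y-z]≈xy-xz k _ _ ⟩
      k * coeff p m - k * coeff q m                      ≈⟨ +-congˡ (-‿cong (*-congʳ k≈l)) ⟩
      k * coeff p m - l * coeff q m
        ≈⟨ +-cong (coeff-const k p m) (-‿cong (coeff-const l q m)) ⟨
      coeff (const k *ᴾ p) m - coeff (const l *ᴾ q) m    ≈⟨ coeff-sub (const k *ᴾ p) (const l *ᴾ q) m ⟨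
      coeff (const k *ᴾ p ⊝ const l *ᴾ q) m             ∎) (scale k (difference p∼q)))
      where
      open ≈-Reasoning

    coeff-const-+ : ∀ k p q m → coeff (const k *ᴾ (p +ᴾ q)) m ≈
                    coeff (const k *ᴾ p +ᴾ const k *ᴾ q) m
    coeff-const-+ k p q m = begin
      coeff (const k *ᴾ (p +ᴾ q)) m                     ≈⟨ coeff-const k (p +ᴾ q) m ⟩
      k * coeff (p +ᴾ q) m                              ≈⟨ *-congˡ (coeff-+ p q m) ⟩
      k * (coeff p m + coeff q m)                       ≈⟨ distribˡ k _ _ ⟩
      k * coeff p m + k * coeff q m                     ≈⟨ +-cong (coeff-const k p m) (coeff-const k q m) ⟨
      coeff (const k *ᴾ p) m + coeff (const k *ᴾ q) m   ≈⟨ coeff-+ (const k *ᴾ p) (const k *ᴾ q) m ⟨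
      coeff (const k *ᴾ p +ᴾ const k *ᴾ q) m            ∎
      where open ≈-Reasoning

    coeff-+-const : ∀ k l p m → coeff (const (k + l) *ᴾ p) m ≈
                    coeff (const k *ᴾ p +ᴾ const l *ᴾ p) m
    coeff-+-const k l p m = begin
      coeff (const (k + l) *ᴾ p) m                      ≈⟨ coeff-const (k + l) p m ⟩
      (k + l) * coeff p m                               ≈⟨ distribʳ _ k l ⟩
      k * coeff p m + l * coeff p m                     ≈⟨ +-cong (coeff-const k p m) (coeff-const l p m) ⟨
      coeff (const k *ᴾ p) m + coeff (const l *ᴾ p) m   ≈⟨ coeff-+ (const k *ᴾ p) (const l *ᴾ p) m ⟨
      coeff (const k *ᴾ p +ᴾ const l *ᴾ p) m            ∎
      where open ≈-Reasoning

    coeff-*-const : ∀ k l p m → coeff (const (k * l) *ᴾ p) m ≈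
                    coeff (const k *ᴾ (const l *ᴾ p)) m
    coeff-*-const k l p m = begin
      coeff (const (k * l) *ᴾ p) m             ≈⟨ coeff-const (k * l) p m ⟩
      (k * l) * coeff p m                      ≈⟨ *-assoc k l _ ⟩
      k * (l * coeff p m)                      ≈⟨ *-congˡ (coeff-const l p m) ⟨
      k * coeff (const l *ᴾ p) m               ≈⟨ coeff-const k (const l *ᴾ p) m ⟨
      coeff (const k *ᴾ (const l *ᴾ p)) m      ∎
      where open ≈-Reasoning

    coeff-+-comm : ∀ p q m → coeff (p +ᴾ q) m ≈ coeff (q +ᴾ p) m
    coeff-+-comm p q m =
      trans (coeff-+ p q m) (trans (+-comm _ _) (sym (coeff-+ q p m)))

    coeff-+-assoc : ∀ p q r m → coeff ((p +ᴾ q) +ᴾ r) m ≈ coeff (p +ᴾ (q +ᴾ r)) m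
    coeff-+-assoc p q r m = begin
      coeff ((p +ᴾ q) +ᴾ r) m                   ≈⟨ coeff-+ (p +ᴾ q) r m ⟩
      coeff (p +ᴾ q) m + coeff r m              ≈⟨ +-congʳ (coeff-+ p q m) ⟩
      (coeff p m + coeff q m) + coeff r m       ≈⟨ +-assoc _ _ _ ⟩
      coeff p m + (coeff q m + coeff r m)       ≈⟨ +-congˡ (coeff-+ q r m) ⟨
      coeff p m + coeff (q +ᴾ r) m              ≈⟨ coeff-+ p (q +ᴾ r) m ⟨
      coeff (p +ᴾ (q +ᴾ r)) m                   ∎
      where open ≈-Reasoning

    coeff-inverseʳ : ∀ p m → coeff (p ⊝ p) m ≈ 0#
    coeff-inverseʳ p m = trans (coeff-sub p p m) (-‿inverseʳ _)

    coeff-·-const : ∀ g k p m → coeff (g · (const k *ᴾ p)) m ≈ coeff (const k *ᴾ g · p) m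
    coeff-·-const g k p m = reflexive (≡.cong (λ q → coeff q m) (·-* g (const k) p))

    isLeftModule : IsLeftModule ring _∼_ _+ᴿ_ 0ᴿ -ᴿ_ _*ᴿ_
    isLeftModule = record
      { isLeftSemimodule = record
        { +ᴹ-isCommutativeMonoid = record
          { isMonoid = record
            { isSemigroup = record
              { isMagma = record
                { isEquivalence = record
                  { refl = ≈⇒∼ λ _ → refl
                  ; sym = ∼-sym
                  ; trans = ∼-trans
                  }
                ; ∙-cong = +ᴿ-cong
                }
              ; assoc = λ (p , _) (q , _) (r , _) → ≈⇒∼ (coeff-+-assoc p q r)
              }
            ; identity =
                (λ _ → ≈⇒∼ λ _ → refl) ,
                (λ (p , _) → ≈⇒∼ λ m → trans (coeff-+ p 0ᴾ m) (+-identityʳ _))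
            }
          ; comm = λ (p , _) (q , _) → ≈⇒∼ (coeff-+-comm p q)
          }
        ; isPreleftSemimodule = record
          { *ₗ-cong = *ᴿ-cong
          ; *ₗ-zeroˡ = λ (p , _) → ≈⇒∼ λ m → trans (coeff-const 0# p m) (zeroˡ _)
          ; *ₗ-distribʳ = λ (p , _) k l → ≈⇒∼ (coeff-+-const k l p)
          ; *ₗ-identityˡ = λ (p , _) → ≈⇒∼ λ m → trans (coeff-const 1# p m) (*-identityˡ _)
          ; *ₗ-assoc = λ k l (p , _) → ≈⇒∼ (coeff-*-const k l p)
          ; *ₗ-zeroʳ = λ k → ≈⇒∼ λ _ → refl
          ; *ₗ-distribˡ = λ k (p , _) (q , _) → ≈⇒∼ (coeff-const-+ k p q)
          }
        }
      ; -ᴹ‿cong = -ᴿ-cong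
      ; -ᴹ‿inverse =
          (λ (p , _) → ≈⇒∼ λ m → trans (coeff-+-comm (-ᴾ p) p m) (coeff-inverseʳ p m)) ,
          (λ (p , _) → ≈⇒∼ (coeff-inverseʳ p))
      }

    R-module : Module K (c ⊔ ℓ) (c ⊔ ℓ ⊔ s)
    R-module = record
      { _≈ᴹ_ = _∼_
      ; _+ᴹ_ = _+ᴿ_
      ; 0ᴹ   = 0ᴿ
      ; -ᴹ_  = -ᴿ_
      ; _*ₗ_ = _*ᴿ_
      ; isModule = IsModuleFromLeft.isModule {commutativeRing = K} (record { isLeftModule = isLeftModule })
      }

    R : ConjugationStable Z → GModule (𝔖 n) K (c ⊔ ℓ) (c ⊔ ℓ ⊔ s)
    R Z-stable = record
      { underlying = R-module
      ; _•_        = _•ᴿ_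
      ; •-cong     = λ {g} {h} {p} {q} g≈h p∼q → ∼-trans {g •ᴿ p} {g •ᴿ q} {h •ᴿ q}
          (mk∼ (≡.subst J (·-sub g (proj₁ p) (proj₁ q)) (·-gr𝐈 Z-stable g (difference {p} {q} p∼q))))
          (≈⇒∼ (coeff≈ (·-cong {g} {h} {proj₁ q} g≈h (≈ᴾ-reflexive ≡.refl))))
      ; •-identity = λ (p , _) → ≈⇒∼ (coeff≈ (≈ᴾ-reflexive (·-id p)))
      ; •-assoc    = λ g h (p , _) → ≈⇒∼ (coeff≈ (≈ᴾ-reflexive (·-∘ g h p)))
      ; •-+ᴹ       = λ g (p , _) (q , _) → ≈⇒∼ (coeff≈ (≈ᴾ-reflexive (·-+ g p q)))
      ; •-*ₗ       = λ g k (p , _) → ≈⇒∼ (coeff-·-const g k p)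
      }

  fixedPoints : Permutation′ n → ℕ
  fixedPoints w = Add.∑[ i < n ] (if does (w ⟨$⟩ʳ i Finₚ.≟ i) then 1 else 0)

  -- The row/column convention is immaterial: it is only used for involutions.

  permutationMatrix : Permutation′ n → Matrix
  permutationMatrix w i j = if does (w ⟨$⟩ʳ i Finₚ.≟ j) then 1# else 0#

  𝓜 : ℕ → Pred Matrix ℓ
  𝓜 a A = Σ[ w ∈ Permutation′ n ]
    ((w ∘ₚ w) Perm.≈ Perm.id × fixedPoints w ≡ a × (∀ i j → A i j ≈ permutationMatrix w i j))

  𝓜-stable : ∀ a → ConjugationStable (𝓜 a)
  𝓜-stable a g (w , w²≈id , fix , A≈w) =
    g ∘ₚ w ∘ₚ Perm.flip g ,
    (λ i → ≡.trans (≡.cong (λ k → g ⟨$⟩ˡ (w ⟨$⟩ʳ k)) (Perm.inverseʳ g))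
          (≡.trans (≡.cong (g ⟨$⟩ˡ_) (w²≈id (g ⟨$⟩ʳ i))) (Perm.inverseˡ g))) ,
    ≡.trans (Add.sum-cong-≗ λ i → ≡.cong (λ b → if b then 1 else 0) (conj i i))
      (≡.trans (≡.sym (Add.sum-permute (λ i → if does (w ⟨$⟩ʳ i Finₚ.≟ i) then 1 else 0) g)) fix) ,
    λ i j → trans (A≈w (g ⟨$⟩ʳ i) (g ⟨$⟩ʳ j))
      (reflexive (≡.cong (λ b → if b then 1# else 0#) (≡.sym (conj i j))))
    where
    conj : ∀ i j → does (g ⟨$⟩ˡ (w ⟨$⟩ʳ (g ⟨$⟩ʳ i)) Finₚ.≟ j) ≡
                   does (w ⟨$⟩ʳ (g ⟨$⟩ʳ i) Finₚ.≟ (g ⟨$⟩ʳ j))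
    conj i j = does-⇔ (mk⇔
      (λ e → ≡.trans (≡.sym (Perm.inverseʳ g)) (≡.cong (g ⟨$⟩ʳ_) e))
      (λ e → ≡.trans (≡.cong (g ⟨$⟩ˡ_) e) (Perm.inverseˡ g))) (_ Finₚ.≟ _) (_ Finₚ.≟ _)

R𝓜 : (n a d : ℕ) → GModule (𝔖 n) ComplexNumbers.ℂ-commutativeRing 0ℓ 0ℓ
R𝓜 n a d = R (𝓜 a) d (𝓜-stable a)
  where open OrbitHarmonics ComplexNumbers.ℂ-commutativeRing n

module Submission where

-- The identity map is the isomorphism: gr I(𝓜 a) and gr I(𝓜 a′) agree in degrees e ≤ d, because in
-- these degrees both consist of the relations that follow from x_{ij} x_{il} = 0, x_{ij} = x_{ji},
-- ∑_j x_{ij} = 0 and ∑_i x_{ii} = 0, which do not involve a.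
--
-- Write n = a + 2k, and let f vanish on 𝓜 a and have degree at most e. Modulo these relations in
-- degree e, and exactly as a function on 𝓜 a, f equals a combination F of monomials ∏_{ij ∈ S} x_{ij}
-- over matchings S with exactly e edges: lower-degree monomials are raised by averaging over the
-- ways of adding an edge. Then F is a function on matchings P that is homogeneous of degree e and vanishes when |P| = k, and
-- such an F is zero. Indeed, P ↦ F(uv ∪ P) − F(vw ∪ P) has degree e − 1 and vanishes on the matchings
-- with k − 1 edges that avoid u, v, w, so by induction F is unchanged when an edge is exchanged for
-- another one; Euler's identity ∑_{e′ ∈ P} (F(P) − F(P ∖ e′)) = e F(P) then carries the vanishing down
-- from k edges to k − 1, k − 2, …, and at S the function F takes the coefficient of S as its value.

open import Defs
open import Algebra.Bundles using (CommutativeMonoid; CommutativeRing)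
open import Algebra.Module.Bundles using (Module)
import Algebra.Module.Construct.TensorUnit as TensorUnit
import Algebra.Properties.AbelianGroup as AbelianGroupProperties
import Algebra.Properties.CommutativeMonoid.Sum as Sum
import Algebra.Properties.CommutativeSemigroup as CommutativeSemigroupProperties
import Algebra.Properties.Monoid.Mult as Mult
import Algebra.Properties.Ring as RingProperties
import Algebra.Properties.Semiring.Exp as Exp
import Algebra.Properties.Semiring.Sum as SemiringSum
import Algebra.Solver.Ring.NaturalCoefficients.Default as NatCoeff
open import Data.Bool.Base using (Bool; true; false; if_then_else_)
open import Data.Bool.Properties using (∨-identityʳ)
open import Data.Empty using (⊥-elim)
open import Data.Fin.Base as Fin using (Fin; zero; suc)
open import Data.Fin.Permutation using (Permutation′; _⟨$⟩ʳ_; permutation)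
import Data.Fin.Properties as Finₚ
open import Data.List.Base
  using (List; []; _∷_; _++_; length; lookup; map; filter; concat; tabulate; replicate)
open import Data.List.Membership.DecPropositional using (_∈?_)
open import Data.List.Membership.Propositional using (_∈_; _∉_; find)
open import Data.List.Membership.Propositional.Properties using (∈-∃++)
import Data.List.Properties as Listₚ
open import Data.List.Relation.Binary.Permutation.Propositional
  using (_↭_; prep; swap; ↭-sym; ↭-trans; ↭-refl; ↭⇒↭ₛ)
import Data.List.Relation.Binary.Permutation.Propositional.Properties as ↭ₚ
import Data.List.Relation.Binary.Permutation.Setoid.Properties as ↭ˢ
open import Data.List.Relation.Unary.All as All using (All; []; _∷_)
import Data.List.Relation.Unary.All.Properties as Allₚ
open import Data.List.Relation.Unary.Any as Any using (here; there; any?)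
import Data.List.Relation.Unary.Any.Properties as Anyₚ
open import Data.List.Relation.Unary.Unique.Propositional using (Unique; []; _∷_)
open import Data.Nat.Base as ℕ
  using (ℕ; zero; suc; s≤s; _<_; _≤_; _⊔_; _⊓_; _∸_; _/_; _%_)
import Data.Nat.DivMod as DivMod
import Data.Nat.Properties as ℕₚ
open import Data.Nat.Solver using (module +-*-Solver)
open import Data.Product.Base using (_×_; _,_; ∃-syntax; Σ-syntax; proj₁; proj₂)
import Data.Product.Properties as Productₚ
open import Data.Rational.Base as ℚ using (ℚ; 0ℚ; 1ℚ; ½)
import Data.Rational.Properties as ℚₚ
open import Data.Sum.Base using (_⊎_; inj₁; inj₂)
open import Function.Base using (_∘_; case_of_)
open import Function.Bundles using (mk⇔)
open import Level using (0ℓ)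
open import Relation.Binary.Definitions using (DecidableEquality; _Respects_; tri<; tri≈; tri>)
open import Relation.Binary.PropositionalEquality as ≡ using (_≡_; _≢_)
import Relation.Binary.Reasoning.Setoid as SetoidReasoning
open import Relation.Nullary using (yes; no; ¬_; Dec; does)
open import Relation.Nullary.Decidable
  using (¬?; _×-dec_; _⊎-dec_; dec-true; dec-false; does-⇔; toWitnessFalse)
open import Relation.Unary using (Decidable; Pred)

-- Matchings in the complete graph

-- The delicate point is that one reduction to matching monomials must be read twice with the same
-- coefficients: as an identity of functions on the locus of `a`, where lower-order terms and `a`
-- itself matter, and modulo the leading forms for `a′`. Vanishing on the first locus kills the
-- coefficients, and these same coefficients express the top component in the second quotient. This
-- is why every relation carries a scalar `h`.
--
-- The two bounds on the degree enter at different places. Adding an edge to an e-edge matching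
-- divides by n - a - 2e, which is positive exactly when e < k. The bound e ≤ a says e + 2k ≤ n, the
-- room that the exchange argument consumes: one exchange forbids three more vertices and lowers
-- both the degree and the number of edges by one, so the number of forbidden vertices plus d + 2k
-- stays constant. Exchanging disjoint edges directly would forbid four vertices and break this
-- balance; edges are therefore moved one endpoint at a time.

Unique-resp-↭ : ∀ {A : Set} → Unique {A = A} Respects _↭_
Unique-resp-↭ {A} p = ↭ˢ.Unique-resp-↭ (≡.setoid A) (↭⇒↭ₛ p)

module _ {n : ℕ} where

  vertices : List (Fin n × Fin n) → List (Fin n)
  vertices []            = []
  vertices ((u , v) ∷ P) = u ∷ v ∷ vertices P

  length-vertices : ∀ P → length (vertices P) ≡ length P ℕ.+ length P
  length-vertices []      = ≡.refl
  length-vertices (_ ∷ P) = ≡.cong suc (≡.trans (≡.cong suc (length-vertices P))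
                                                (≡.sym (ℕₚ.+-suc (length P) (length P))))

  vertices-↭ : ∀ {P Q} → P ↭ Q → vertices P ↭ vertices Q
  vertices-↭ _↭_.refl = ↭-refl
  vertices-↭ (prep (u , v) p) = prep u (prep v (vertices-↭ p))
  vertices-↭ (swap (u , v) (w , z) p) =
    ↭-trans (↭ₚ.shifts (u ∷ v ∷ []) (w ∷ z ∷ [])) (↭ₚ.++⁺ˡ (w ∷ z ∷ u ∷ v ∷ []) (vertices-↭ p))
  vertices-↭ (_↭_.trans p q) = ↭-trans (vertices-↭ p) (vertices-↭ q)

  fresh : ∀ (L : List (Fin n)) → length L < n → ∃[ v ] v ∉ L
  fresh L |L|<n with Finₚ.any? (λ v → ¬? (_∈?_ Finₚ._≟_ v L))
  ... | yes v∉L = v∉L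
  -- Otherwise every vertex has a position in the shorter list `L`; two vertices share a position,
  -- and the position determines the vertex.
  ... | no ∄ = ⊥-elim (i≢j (≡.trans (Anyₚ.lookup-index (mem i))
      (≡.trans (≡.cong (lookup L) same) (≡.sym (Anyₚ.lookup-index (mem j))))))
    where
    mem : ∀ v → v ∈ L
    mem v with _∈?_ Finₚ._≟_ v L
    ... | yes v∈L = v∈L
    ... | no v∉L = ⊥-elim (∄ (v , v∉L))
    collision = Finₚ.pigeonhole |L|<n (λ v → Any.index (mem v))
    i = proj₁ collision
    j = proj₁ (proj₂ collision)
    i≢j : i ≢ j
    i≢j = Finₚ.<⇒≢ (proj₁ (proj₂ (proj₂ collision)))
    same = proj₂ (proj₂ (proj₂ collision))

  -- A single repetition-free list says that `P` is a matching, that it avoids `X` and that `X` has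
  -- distinct entries, so moving the endpoints of an edge into `X` is a mere permutation.
  MatchingOff : List (Fin n) → List (Fin n × Fin n) → Set
  MatchingOff X P = Unique (X ++ vertices P)

  absorb : ∀ {X u v P} → MatchingOff X ((u , v) ∷ P) → MatchingOff (u ∷ v ∷ X) P
  absorb {X} {u} {v} {P} = Unique-resp-↭ (↭ₚ.shifts X (u ∷ v ∷ []))

  release : ∀ {X u v P} → MatchingOff (u ∷ v ∷ X) P → MatchingOff X ((u , v) ∷ P)
  release {X} {u} {v} {P} = Unique-resp-↭ (↭-sym (↭ₚ.shifts X (u ∷ v ∷ [])))

  MatchingOff-↭ : ∀ X {P Q} → P ↭ Q → MatchingOff X P → MatchingOff X Q
  MatchingOff-↭ X p = Unique-resp-↭ (↭ₚ.++⁺ˡ X (vertices-↭ p))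

  fresh-edge : ∀ X P → MatchingOff X P → suc (suc (length X ℕ.+ (length P ℕ.+ length P))) ≤ n →
               ∃[ e ] MatchingOff X (e ∷ P)
  fresh-edge X P uniq bound =
    let L = X ++ vertices P
        |L| : length L ≡ length X ℕ.+ (length P ℕ.+ length P)
        |L| = ≡.trans (Listₚ.length-++ X) (≡.cong (length X ℕ.+_) (length-vertices P))
        v , v∉L  = fresh L (ℕₚ.≤-trans (ℕₚ.≤-reflexive (≡.cong suc |L|)) (ℕₚ.<⇒≤ bound))
        u , u∉vL = fresh (v ∷ L) (ℕₚ.≤-trans (ℕₚ.≤-reflexive (≡.cong (λ m → suc (suc m)) |L|)) bound)
    in (u , v) , release {X} {u} {v} {P} (Allₚ.¬Any⇒All¬ _ u∉vL ∷ Allₚ.¬Any⇒All¬ _ v∉L ∷ uniq)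

  extend : ∀ X P i → MatchingOff X P →
           length X ℕ.+ ((length P ℕ.+ i) ℕ.+ (length P ℕ.+ i)) ≤ n →
           ∃[ K ] (length K ≡ length P ℕ.+ i × MatchingOff X K)
  extend X P zero uniq bound = P , ≡.sym (ℕₚ.+-identityʳ _) , uniq
  extend X P (suc i) uniq bound =
    let e , uniq′ = fresh-edge X P uniq (ℕₚ.≤-trans (size (length X) (length P)) bound)
        K , |K| , uniqK = extend X (e ∷ P) i uniq′
          (ℕₚ.≤-trans (ℕₚ.≤-reflexive (≡.cong (λ k → length X ℕ.+ (k ℕ.+ k))
            (≡.sym (ℕₚ.+-suc (length P) i)))) bound)
    in K , ≡.trans |K| (≡.sym (ℕₚ.+-suc (length P) i)) , uniqK
    where
    open +-*-Solver
    size : ∀ x p → suc (suc (x ℕ.+ (p ℕ.+ p))) ≤ x ℕ.+ ((p ℕ.+ suc i) ℕ.+ (p ℕ.+ suc i))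
    size x p = ℕₚ.≤-trans (ℕₚ.m≤m+n _ (i ℕ.+ i)) (ℕₚ.≤-reflexive
      (solve 3 (λ x p i → (con 2 :+ (x :+ (p :+ p))) :+ (i :+ i) :=
                          x :+ ((p :+ (con 1 :+ i)) :+ (p :+ (con 1 :+ i)))) ≡.refl x p i))

-- Homogeneous functions on matchings

module CharacteristicZero (K : CommutativeRing 0ℓ 0ℓ) where
  open CommutativeRing K
  open Mult +-monoid using () renaming (_×_ to _×ᴷ_)

  fromℕ : ℕ → Carrier
  fromℕ m = m ×ᴷ 1#

  Nontrivial : Set
  Nontrivial = ¬ 1# ≈ 0#

  -- Characteristic zero in the form in which it enters: the descent divides by a number of edges
  -- plus one, the averaging by a positive excess of vertices.
  InvertibleNumbers : Set
  InvertibleNumbers = ∀ m → ∃[ r ] r * fromℕ (suc m) ≈ 1#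

module Vanishing (K : CommutativeRing 0ℓ 0ℓ) (n : ℕ)
                 (inv : CharacteristicZero.InvertibleNumbers K) where
  open CommutativeRing K
  open CharacteristicZero K
  open SetoidReasoning setoid
  private
    module S = NatCoeff commutativeSemiring
    module AG = AbelianGroupProperties +-abelianGroup

  Edges : Set
  Edges = List (Fin n × Fin n)

  suc-cancel : ∀ m {x} → fromℕ (suc m) * x ≈ 0# → x ≈ 0#
  suc-cancel m {x} eq = let r , r⁻¹ = inv m in begin
    x                        ≈⟨ *-identityˡ x ⟨
    1# * x                   ≈⟨ *-congʳ r⁻¹ ⟨
    (r * fromℕ (suc m)) * x  ≈⟨ *-assoc r _ x ⟩
    r * (fromℕ (suc m) * x)  ≈⟨ *-congˡ eq ⟩
    r * 0#                   ≈⟨ zeroʳ r ⟩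
    0#                       ∎

  split-sub : ∀ x y → y ≈ x + (y - x)
  split-sub x y = sym (begin
    x + (y - x)  ≈⟨ +-comm x _ ⟩
    (y - x) + x  ≈⟨ +-assoc y (- x) x ⟩
    y + (- x + x) ≈⟨ +-congˡ (-‿inverseˡ x) ⟩
    y + 0#       ≈⟨ +-identityʳ y ⟩
    y            ∎)

  sub-cong : ∀ {x x′ y y′} → x ≈ x′ → y ≈ y′ → x - y ≈ x′ - y′
  sub-cong p q = +-cong p (-‿cong q)

  Δ : Fin n × Fin n → (Edges → Carrier) → Edges → Carrier
  Δ e F P = F (e ∷ P) - F P

  -- F is a homogeneous multilinear polynomial of degree d in the multiplicities of the edges.
  Homogeneous : ℕ → (Edges → Carrier) → Set
  Homogeneous zero    F = ∀ P → F P ≈ F []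
  Homogeneous (suc d) F = F [] ≈ 0# × (∀ e → Homogeneous d (Δ e F))

  Homogeneous-cong : ∀ d {F G} → (∀ P → F P ≈ G P) → Homogeneous d F → Homogeneous d G
  Homogeneous-cong zero    F≈G h P = trans (sym (F≈G P)) (trans (h P) (F≈G []))
  Homogeneous-cong (suc d) F≈G (h₀ , h) =
    trans (sym (F≈G [])) h₀ ,
    λ e → Homogeneous-cong d (λ P → sub-cong (F≈G (e ∷ P)) (F≈G P)) (h e)

  interchange-sub : ∀ a b c d → (a - b) + (c - d) ≈ (a + c) - (b + d)
  interchange-sub a b c d = trans
    (CommutativeSemigroupProperties.interchange +-commutativeSemigroup a (- b) c (- d))
    (+-congˡ (RingProperties.-‿+-comm ring b d))

  Homogeneous-+ : ∀ d {F G} → Homogeneous d F → Homogeneous d G → Homogeneous d (λ P → F P + G P)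
  Homogeneous-+ zero    f g P = +-cong (f P) (g P)
  Homogeneous-+ (suc d) (f₀ , f) (g₀ , g) =
    trans (+-cong f₀ g₀) (+-identityˡ 0#) ,
    λ e → Homogeneous-cong d (λ P → interchange-sub _ _ _ _) (Homogeneous-+ d (f e) (g e))

  Homogeneous-* : ∀ d c {F} → Homogeneous d F → Homogeneous d (λ P → c * F P)
  Homogeneous-* zero    c f P = *-congˡ (f P)
  Homogeneous-* (suc d) c (f₀ , f) =
    trans (*-congˡ f₀) (zeroʳ c) ,
    λ e → Homogeneous-cong d (λ P → RingProperties.x[y-z]≈xy-xz ring c _ _) (Homogeneous-* d c (f e))

  Homogeneous-0 : ∀ d → Homogeneous d (λ _ → 0#)
  Homogeneous-0 zero    P = refl
  Homogeneous-0 (suc d) = refl , λ e → Homogeneous-cong d (λ _ → sym (-‿inverseʳ 0#)) (Homogeneous-0 d)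

  Homogeneous-sub : ∀ d {F G} → Homogeneous d F → Homogeneous d G → Homogeneous d (λ P → F P - G P)
  Homogeneous-sub d {F} {G} f g = Homogeneous-cong d
    (λ P → +-congˡ (RingProperties.-1*x≈-x ring (G P)))
    (Homogeneous-+ d f (Homogeneous-* d (- 1#) g))

  -- The sum of `F (P ∖ e)` over the edges `e` of `P`; composing with `e ∷_` keeps the head while a
  -- later edge is deleted.
  deletions : (Edges → Carrier) → Edges → Carrier
  deletions F []      = 0#
  deletions F (e ∷ P) = F P + deletions (F ∘ (e ∷_)) P

  deletions-cong : ∀ {F G} → (∀ P → F P ≈ G P) → ∀ P → deletions F P ≈ deletions G P
  deletions-cong F≈G []      = refl
  deletions-cong F≈G (e ∷ P) = +-cong (F≈G P) (deletions-cong (F≈G ∘ (e ∷_)) P)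

  deletions-+ : ∀ F G P → deletions (λ Q → F Q + G Q) P ≈ deletions F P + deletions G P
  deletions-+ F G []      = sym (+-identityˡ 0#)
  deletions-+ F G (e ∷ P) = trans (+-congˡ (deletions-+ (F ∘ (e ∷_)) (G ∘ (e ∷_)) P))
    (CommutativeSemigroupProperties.interchange +-commutativeSemigroup _ _ _ _)

  deletions-const : ∀ F P y →
    (∀ L e R → P ≡ L ++ e ∷ R → F (L ++ R) ≈ y) → deletions F P ≈ fromℕ (length P) * y
  deletions-const F []      y h = sym (zeroˡ y)
  deletions-const F (e ∷ P) y h = begin
    F P + deletions (F ∘ (e ∷_)) P    ≈⟨ +-cong (h [] e P ≡.refl)
                                           (deletions-const (F ∘ (e ∷_)) P y
                                             λ L e′ R eq → h (e ∷ L) e′ R (≡.cong (e ∷_) eq)) ⟩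
    y + fromℕ (length P) * y          ≈⟨ +-congʳ (*-identityˡ y) ⟨
    1# * y + fromℕ (length P) * y     ≈⟨ distribʳ y 1# _ ⟨
    fromℕ (length (e ∷ P)) * y        ∎

  -- Euler's identity Σ_{e ∈ P} (F P − F (P ∖ e)) = d F P, with the subtractions moved across.
  euler : ∀ d F P → Homogeneous d F → fromℕ (length P) * F P ≈ deletions F P + fromℕ d * F P
  euler zero F P h = begin
    fromℕ (length P) * F P        ≈⟨ deletions-const F P (F P) (λ L e R _ → trans (h _) (sym (h P))) ⟨
    deletions F P                 ≈⟨ +-identityʳ _ ⟨
    deletions F P + 0#            ≈⟨ +-congˡ (zeroˡ (F P)) ⟨
    deletions F P + 0# * F P      ∎
  euler (suc d) F [] (h₀ , h) = trans (zeroˡ _) (sym (trans (+-identityˡ _)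
    (trans (*-congˡ h₀) (zeroʳ _))))
  euler (suc d) F (e ∷ P) (h₀ , h) = begin
    (1# + π) * y                  ≈⟨ *-congˡ y≈ ⟩
    (1# + π) * (x + z)            ≈⟨ S.solve 3 (λ π x z → (S.con 1 S.:+ π) S.:* (x S.:+ z) S.:=
                                      (π S.:* x S.:+ π S.:* z) S.:+ (x S.:+ z)) refl π x z ⟩
    -- `F` and its difference `Δ e F`, of degree one less, both satisfy the identity at the shorter
    -- `P`; the two add up to the identity for `F` at `e ∷ P`.
    (π * x + π * z) + (x + z)     ≈⟨ +-congʳ (+-cong (euler (suc d) F P (h₀ , h)) (euler d (Δ e F) P (h e))) ⟩
    ((a + (1# + δ) * x) + (b + δ * z)) + (x + z)
      ≈⟨ S.solve 5 (λ a b δ x z →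
           ((a S.:+ (S.con 1 S.:+ δ) S.:* x) S.:+ (b S.:+ δ S.:* z)) S.:+ (x S.:+ z) S.:=
           (x S.:+ (a S.:+ b)) S.:+ (S.con 1 S.:+ δ) S.:* (x S.:+ z)) refl a b δ x z ⟩
    (x + (a + b)) + (1# + δ) * (x + z)
      ≈⟨ +-cong (+-congˡ (trans (sym (deletions-+ F (Δ e F) P))
                                (deletions-cong (λ Q → sym (split-sub (F Q) (F (e ∷ Q)))) P)))
                (*-congˡ (sym y≈)) ⟩
    (x + deletions (F ∘ (e ∷_)) P) + (1# + δ) * y  ∎
    where
    π = fromℕ (length P)
    δ = fromℕ d
    x = F P
    y = F (e ∷ P)
    z = Δ e F P
    a = deletions F P
    b = deletions (Δ e F) P
    y≈ : y ≈ x + z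
    y≈ = split-sub x y

  Symmetric : (Edges → Carrier) → Set
  Symmetric F = ∀ {P Q} → P ↭ Q → F P ≈ F Q

  -- Only one endpoint moves. Writing the edges as `(u , v)` and `(v , w)` lets slides be chained
  -- without reversing an edge, under which `F` is not assumed invariant.
  slide : Fin n → Fin n → Fin n → (Edges → Carrier) → Edges → Carrier
  slide u v w F P = F ((u , v) ∷ P) - F ((v , w) ∷ P)

  -- The slide is the difference of the derivatives along its two edges, since `F P` cancels.
  slide-homogeneous : ∀ d u v w {F} → Homogeneous (suc d) F → Homogeneous d (slide u v w F)
  slide-homogeneous d u v w {F} (_ , h) = Homogeneous-cong d
    (λ P → lemma (F ((u , v) ∷ P)) (F ((v , w) ∷ P)) (F P))
    (Homogeneous-sub d (h (u , v)) (h (v , w)))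
    where
    lemma : ∀ a b c → (a - c) - (b - c) ≈ a - b
    lemma a b c = begin
      (a - c) - (b - c)   ≈⟨ +-congˡ (AG.⁻¹-anti-homo‿- b c) ⟩
      (a - c) + (c - b)   ≈⟨ +-assoc a (- c) (c - b) ⟩
      a + (- c + (c - b)) ≈⟨ +-congˡ (+-assoc (- c) c (- b)) ⟨
      a + ((- c + c) - b) ≈⟨ +-congˡ (+-congʳ (-‿inverseˡ c)) ⟩
      a + (0# - b)        ≈⟨ +-congˡ (+-identityˡ (- b)) ⟩
      a - b               ∎

  sub≈0⇒≈ : ∀ {x y} → x - y ≈ 0# → x ≈ y
  sub≈0⇒≈ {x} {y} eq = trans (split-sub y x) (trans (+-congˡ eq) (+-identityʳ y))

  VanishesOn : ℕ → List (Fin n) → (Edges → Carrier) → Set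
  VanishesOn k X F = ∀ K → length K ≡ k → MatchingOff X K → F K ≈ 0#

  -- Because `F` vanishes at `e ∷ P`, Euler's identity there says that the sum of the deletions is
  -- zero. Exchanging edges makes each of its |P| + 1 summands equal to `F P`.
  descend : ∀ d k X F → Symmetric F → Homogeneous d F →
    (∀ u v w R → length R < k → MatchingOff (u ∷ v ∷ w ∷ X) R → F ((u , v) ∷ R) ≈ F ((v , w) ∷ R)) →
    ∀ P → length P ≤ k → MatchingOff X P → ∀ e → MatchingOff X (e ∷ P) → F (e ∷ P) ≈ 0# → F P ≈ 0#
  descend d k X F symF h exchange P |P|≤k uniq (u , v) uniq′ FeP≈0 =
    suc-cancel (length P) (begin
      (1# + fromℕ (length P)) * F P                ≈⟨ distribʳ (F P) 1# _ ⟩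
      1# * F P + fromℕ (length P) * F P            ≈⟨ +-congʳ (*-identityˡ _) ⟩
      F P + fromℕ (length P) * F P
        ≈⟨ +-congˡ (deletions-const (F ∘ (e ∷_)) P (F P) moved) ⟨
      deletions F (e ∷ P)                          ≈⟨ +-identityʳ _ ⟨
      deletions F (e ∷ P) + 0#                     ≈⟨ +-congˡ (zeroʳ _) ⟨
      deletions F (e ∷ P) + fromℕ d * 0#           ≈⟨ +-congˡ (*-congˡ FeP≈0) ⟨
      deletions F (e ∷ P) + fromℕ d * F (e ∷ P)    ≈⟨ euler d F (e ∷ P) h ⟨
      fromℕ (length (e ∷ P)) * F (e ∷ P)           ≈⟨ *-congˡ FeP≈0 ⟩
      fromℕ (length (e ∷ P)) * 0#                  ≈⟨ zeroʳ _ ⟩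
      0#                                           ∎)
    where
    e = (u , v)
    moved : ∀ L e′ R → P ≡ L ++ e′ ∷ R → F (e ∷ (L ++ R)) ≈ F P
    moved L (w , z) R ≡.refl = begin
      -- The new edge `u v` is carried to the deleted edge `w z` by two slides, through `v w`.
      F ((u , v) ∷ L ++ R)    ≈⟨ exchange u v w (L ++ R) small (tailᵘ all) ⟩
      F ((v , w) ∷ L ++ R)    ≈⟨ exchange v w z (L ++ R) small
                                   (tailᵘ (Unique-resp-↭ (↭ₚ.shifts (z ∷ []) (u ∷ v ∷ w ∷ []) {T}) all)) ⟩
      F ((w , z) ∷ L ++ R)    ≈⟨ symF (↭ₚ.shift (w , z) L R) ⟨
      F (L ++ (w , z) ∷ R)    ∎
      where
      tailᵘ : ∀ {A : Set} {x : A} {xs} → Unique (x ∷ xs) → Unique xs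
      tailᵘ (_ ∷ u) = u
      T = X ++ vertices (L ++ R)
      small : length (L ++ R) < k
      small = ℕₚ.<-≤-trans (ℕₚ.≤-reflexive (≡.sym (↭ₚ.↭-length (↭ₚ.shift (w , z) L R)))) |P|≤k
      all : Unique (z ∷ u ∷ v ∷ w ∷ T)
      all = Unique-resp-↭ (↭-trans (↭ₚ.shifts (w ∷ []) (z ∷ []) {u ∷ v ∷ T})
                                   (↭ₚ.++⁺ˡ (z ∷ []) (↭ₚ.shifts (w ∷ []) (u ∷ v ∷ []) {T})))
        (absorb {X = u ∷ v ∷ X} {w} {z} {L ++ R} (MatchingOff-↭ (u ∷ v ∷ X)
          (↭ₚ.shift (w , z) L R) (absorb {X = X} {u} {v} {P} uniq′)))

  vanish : ∀ d k X F → Symmetric F → Homogeneous d F →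
    length X ℕ.+ (d ℕ.+ (k ℕ.+ k)) ≤ n → VanishesOn k X F →
    ∀ P → length P ≤ k → MatchingOff X P → F P ≈ 0#
  vanish zero k X F symF h bound van P |P|≤k uniq =
    -- In degree zero `F` is constant, so `P` may be traded for any matching with `k` edges off `X`;
    -- the bound leaves room to find one.
    let i , p+i≡k = ℕₚ.m≤n⇒∃[o]m+o≡n |P|≤k
        K , |K| , uniqK = extend X P i uniq
          (≡.subst (λ k → length X ℕ.+ (k ℕ.+ k) ≤ n) (≡.sym p+i≡k) bound)
    in trans (h P) (trans (sym (h K)) (van K (≡.trans |K| p+i≡k) uniqK))
  vanish (suc d) k X F symF h bound van P |P|≤k uniq =
    let i , p+i≡k = ℕₚ.m≤n⇒∃[o]m+o≡n |P|≤k in down i P p+i≡k uniq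
    where
    exchange : ∀ u v w R → length R < k → MatchingOff (u ∷ v ∷ w ∷ X) R →
               F ((u , v) ∷ R) ≈ F ((v , w) ∷ R)
    exchange u v w R (s≤s {n = k′} |R|≤k′) uniqR = sub≈0⇒≈
      (vanish d k′ (u ∷ v ∷ w ∷ X) (slide u v w F)
        (λ P↭Q → sub-cong (symF (prep _ P↭Q)) (symF (prep _ P↭Q)))
        (slide-homogeneous d u v w h)
        (ℕₚ.≤-trans (ℕₚ.≤-reflexive (size (length X) d k′)) bound)
        -- Either edge of the slide completes `K` to a matching with `k` edges off `X`, where `F`
        -- vanishes.
        (λ K |K| uniqK → trans
          (sub-cong (van ((u , v) ∷ K) (≡.cong suc |K|) (release {X = X} {u} {v} {K} (dropThird uniqK)))
                    (van ((v , w) ∷ K) (≡.cong suc |K|) (release {X = X} {v} {w} {K} (dropFirst uniqK))))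
          (-‿inverseʳ 0#))
        R |R|≤k′ uniqR)
      where
      dropFirst : ∀ {A : Set} {x y z : A} {xs} → Unique (x ∷ y ∷ z ∷ xs) → Unique (y ∷ z ∷ xs)
      dropFirst (_ ∷ p) = p
      dropThird : ∀ {A : Set} {x y z : A} {xs} → Unique (x ∷ y ∷ z ∷ xs) → Unique (x ∷ y ∷ xs)
      dropThird ((p ∷ _ ∷ q) ∷ (_ ∷ r) ∷ _ ∷ s) = (p ∷ q) ∷ r ∷ s
      open +-*-Solver
      size : ∀ x d k → suc (suc (suc x)) ℕ.+ (d ℕ.+ (k ℕ.+ k)) ≡ x ℕ.+ (suc d ℕ.+ (suc k ℕ.+ suc k))
      size = solve 3 (λ x d k → (con 3 :+ x) :+ (d :+ (k :+ k)) :=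
        x :+ ((con 1 :+ d) :+ ((con 1 :+ k) :+ (con 1 :+ k)))) ≡.refl
    down : ∀ i P → length P ℕ.+ i ≡ k → MatchingOff X P → F P ≈ 0#
    down zero P |P|≡k uniq = van P (≡.trans (≡.sym (ℕₚ.+-identityʳ _)) |P|≡k) uniq
    down (suc i) P p+i≡k uniq =
      let e , uniq′ = fresh-edge X P uniq (ℕₚ.≤-trans (room (length X) (length P) p+i≡k) bound)
      in descend (suc d) k X F symF h exchange P
           (≡.subst (length P ≤_) p+i≡k (ℕₚ.m≤m+n _ _)) uniq e uniq′
           (down i (e ∷ P) (≡.trans (≡.sym (ℕₚ.+-suc (length P) i)) p+i≡k) uniq′)
      where
      open +-*-Solver
      room : ∀ x p → p ℕ.+ suc i ≡ k → suc (suc (x ℕ.+ (p ℕ.+ p))) ≤ x ℕ.+ (suc d ℕ.+ (k ℕ.+ k))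
      room x p ≡.refl = ℕₚ.≤-trans (ℕₚ.m≤m+n _ (suc d ℕ.+ (i ℕ.+ i))) (ℕₚ.≤-reflexive
        (solve 4 (λ x p d i → (con 2 :+ (x :+ (p :+ p))) :+ ((con 1 :+ d) :+ (i :+ i)) :=
          x :+ ((con 1 :+ d) :+ ((p :+ (con 1 :+ i)) :+ (p :+ (con 1 :+ i))))) ≡.refl x p d i))

-- Matchings, involutions and monomials

Unique-∉ : ∀ {A : Set} {x : A} {xs} → Unique (x ∷ xs) → x ∉ xs
Unique-∉ (p ∷ _) = Allₚ.All¬⇒¬Any p

Unique-tail : ∀ {A : Set} {x : A} {xs} → Unique (x ∷ xs) → Unique xs
Unique-tail (_ ∷ p) = p

∈⇒↭ : ∀ {A : Set} {x : A} {xs} → x ∈ xs → ∃[ ys ] xs ↭ x ∷ ys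
∈⇒↭ x∈xs with L , R , ≡.refl ← ∈-∃++ x∈xs = L ++ R , ↭ₚ.shift _ L R

module _ {c ℓ} (M : CommutativeMonoid c ℓ) where
  open CommutativeMonoid M
  open Sum M using (sum; sum-syntax; sum-replicate-zero; sum-cong-≋)

  ∑-indicator : ∀ {n} (i : Fin n) (f : Fin n → Carrier) →
                ∑[ j < n ] (if does (i Finₚ.≟ j) then f j else ε) ≈ f i
  ∑-indicator {suc n} zero    f = trans (∙-congˡ (sum-replicate-zero n)) (identityʳ _)
  ∑-indicator {suc n} (suc i) f = trans (identityˡ _) (∑-indicator i (f ∘ suc))

module _ {n : ℕ} where

  private
    module Add = Sum ℕₚ.+-0-commutativeMonoid

  infix 4 _≟ᴱ_
  _≟ᴱ_ : DecidableEquality (Fin n × Fin n)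
  _≟ᴱ_ = Productₚ.≡-dec Finₚ._≟_ Finₚ._≟_

  Linked : Fin n × Fin n → Fin n × Fin n → Set
  Linked (i , j) (u , v) = (i ≡ u × j ≡ v) ⊎ (i ≡ v × j ≡ u)

  linked? : ∀ e e′ → Dec (Linked e e′)
  linked? (i , j) (u , v) =
    ((i Finₚ.≟ u) ×-dec (j Finₚ.≟ v)) ⊎-dec ((i Finₚ.≟ v) ×-dec (j Finₚ.≟ u))

  ∉⇒unlinked : ∀ {i j S} → i ∉ vertices S → j ∉ vertices S → ∀ {e} → Linked (i , j) e →
               All (λ s → ¬ Linked s e) S
  ∉⇒unlinked {S = []} i∉ j∉ l = []
  ∉⇒unlinked {i} {j} {(p , q) ∷ S} i∉ j∉ {u , v} l =
    head l ∷ ∉⇒unlinked (i∉ ∘ there ∘ there) (j∉ ∘ there ∘ there) l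
    where
    head : Linked (i , j) (u , v) → ¬ Linked (p , q) (u , v)
    head (inj₁ (≡.refl , ≡.refl)) (inj₁ (≡.refl , _)) = i∉ (here ≡.refl)
    head (inj₁ (≡.refl , ≡.refl)) (inj₂ (≡.refl , _)) = j∉ (here ≡.refl)
    head (inj₂ (≡.refl , ≡.refl)) (inj₁ (≡.refl , _)) = j∉ (here ≡.refl)
    head (inj₂ (≡.refl , ≡.refl)) (inj₂ (≡.refl , _)) = i∉ (here ≡.refl)

  unlinked : ∀ {s S e} → Unique (vertices (s ∷ S)) → Linked s e → All (λ t → ¬ Linked t e) S
  unlinked uniq = ∉⇒unlinked (Unique-∉ uniq ∘ there) (Unique-∉ (Unique-tail uniq))

  Linked-sym : ∀ {e e′} → Linked e e′ → Linked e′ e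
  Linked-sym (inj₁ (≡.refl , ≡.refl)) = inj₁ (≡.refl , ≡.refl)
  Linked-sym (inj₂ (≡.refl , ≡.refl)) = inj₂ (≡.refl , ≡.refl)

  Ordered : Fin n × Fin n → Set
  Ordered (i , j) = i Fin.< j

  -- `x_{ij}` and `x_{ji}` are different variables; ordering the endpoints selects one of them, so
  -- that a matching has one monomial and distinct matchings have distinct monomials.
  record OrderedMatching (e : ℕ) (S : List (Fin n × Fin n)) : Set where
    constructor orderedMatching
    field
      size    : length S ≡ e
      ordered : All Ordered S
      unique  : Unique (vertices S)

  endpoint∈ : ∀ {e : Fin n × Fin n} {S} → e ∈ S → proj₁ e ∈ vertices S
  endpoint∈ (here ≡.refl) = here ≡.refl
  endpoint∈ (there e∈S)   = there (there (endpoint∈ e∈S))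

  endpoint₂∈ : ∀ {e : Fin n × Fin n} {S} → e ∈ S → proj₂ e ∈ vertices S
  endpoint₂∈ (here ≡.refl) = there (here ≡.refl)
  endpoint₂∈ (there e∈S)   = there (there (endpoint₂∈ e∈S))

  -- Serves to tell matchings of equal size apart by an edge. Common edges are removed from `S` one
  -- by one; as `T` repeats no vertex, a later edge missing from the remainder differs from those
  -- removed and so is missing from `S`.
  ↭-or-missing : ∀ T S → length T ≡ length S → Unique (vertices T) →
                 T ↭ S ⊎ ∃[ x ] (x ∈ T × x ∉ S)
  ↭-or-missing []      []      _ _ = inj₁ ↭-refl
  ↭-or-missing (x ∷ T) S |T|≡|S| uniq with _∈?_ _≟ᴱ_ x S
  ... | no x∉S = inj₂ (x , here ≡.refl , x∉S)
  ... | yes x∈S with S′ , S↭ ← ∈⇒↭ x∈S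
                with ↭-or-missing T S′ (ℕₚ.suc-injective (≡.trans |T|≡|S| (↭ₚ.↭-length S↭)))
                                  (Unique-tail (Unique-tail uniq))
  ...   | inj₁ T↭S′ = inj₁ (↭-trans (prep x T↭S′) (↭-sym S↭))
  ...   | inj₂ (y , y∈T , y∉S′) = inj₂ (y , there y∈T , λ y∈S → case (↭ₚ.∈-resp-↭ S↭ y∈S))
    where
    case : ¬ y ∈ x ∷ S′
    case (here ≡.refl) = Unique-∉ uniq (there (endpoint∈ y∈T))
    case (there y∈S′)  = y∉S′ y∈S′

  single : Fin n → Fin n → Fin n → Fin n → ℕ
  single u v i j = if does (u Finₚ.≟ i) then (if does (v Finₚ.≟ j) then 1 else 0) else 0

  exponents : List (Fin n × Fin n) → Fin n → Fin n → ℕ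
  exponents []            i j = 0
  exponents ((u , v) ∷ w) i j = single u v i j ℕ.+ exponents w i j

  exponents-↭ : ∀ {S T} → S ↭ T → ∀ i j → exponents S i j ≡ exponents T i j
  exponents-↭ _↭_.refl i j = ≡.refl
  exponents-↭ (prep (u , v) p) i j = ≡.cong (single u v i j ℕ.+_) (exponents-↭ p i j)
  exponents-↭ (swap (u , v) (w , z) p) i j = ≡.trans
    (≡.cong (λ m → single u v i j ℕ.+ (single w z i j ℕ.+ m)) (exponents-↭ p i j))
    (CommutativeSemigroupProperties.x∙yz≈y∙xz ℕₚ.+-commutativeSemigroup (single u v i j) (single w z i j) _)
  exponents-↭ (_↭_.trans p q) i j = ≡.trans (exponents-↭ p i j) (exponents-↭ q i j)

  single-self : ∀ u v → single u v u v ≡ 1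
  single-self u v rewrite dec-true (u Finₚ.≟ u) ≡.refl | dec-true (v Finₚ.≟ v) ≡.refl = ≡.refl

  single-≢ : ∀ {u v i j} → (u , v) ≢ (i , j) → single u v i j ≡ 0
  single-≢ {u} {v} {i} {j} ≢ with u Finₚ.≟ i | v Finₚ.≟ j
  ... | yes ≡.refl | yes ≡.refl = ⊥-elim (≢ ≡.refl)
  ... | yes _      | no _       = ≡.refl
  ... | no _       | _          = ≡.refl

  exponents-∈ : ∀ {i j w} → (i , j) ∈ w → exponents w i j ≢ 0
  exponents-∈ {i} {j} (here ≡.refl) rewrite single-self i j = λ ()
  exponents-∈ {w = (u , v) ∷ w} (there e∈w) eq = exponents-∈ e∈w (ℕₚ.m+n≡0⇒n≡0 _ eq)

  exponents-∉ : ∀ {i j} w → (i , j) ∉ w → exponents w i j ≡ 0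
  exponents-∉ []            ∉ = ≡.refl
  exponents-∉ ((u , v) ∷ w) ∉ =
    ≡.cong₂ ℕ._+_ (single-≢ λ eq → ∉ (here (≡.sym eq))) (exponents-∉ w (∉ ∘ there))

  count : Fin n → List (Fin n) → ℕ
  count i []      = 0
  count i (v ∷ L) = (if does (v Finₚ.≟ i) then 1 else 0) ℕ.+ count i L

  ∑-count : ∀ L → Add.∑[ i < n ] count i L ≡ length L
  ∑-count []      = Add.sum-replicate-zero n
  ∑-count (v ∷ L) = ≡.trans
    (Add.∑-distrib-+ {n} (λ i → if does (v Finₚ.≟ i) then 1 else 0) (λ i → count i L))
    (≡.cong₂ ℕ._+_ (∑-indicator ℕₚ.+-0-commutativeMonoid v (λ _ → 1)) (∑-count L))

  count-∉ : ∀ {i} L → i ∉ L → count i L ≡ 0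
  count-∉ []      i∉L = ≡.refl
  count-∉ {i} (v ∷ L) i∉L rewrite dec-false (v Finₚ.≟ i) (λ eq → i∉L (here (≡.sym eq))) =
    count-∉ L (i∉L ∘ there)

  count-∈ : ∀ {i L} → Unique L → i ∈ L → count i L ≡ 1
  count-∈ {i} {_ ∷ L} uniq (here ≡.refl) rewrite dec-true (i Finₚ.≟ i) ≡.refl =
    ≡.cong suc (count-∉ L (Unique-∉ uniq))
  count-∈ {i} {v ∷ L} uniq (there i∈L)
    rewrite dec-false (v Finₚ.≟ i) (λ { ≡.refl → Unique-∉ uniq i∈L }) = count-∈ (Unique-tail uniq) i∈L

  swapAlong : List (Fin n × Fin n) → Fin n → Fin n
  swapAlong []            i = i
  swapAlong ((u , v) ∷ P) i =
    if does (i Finₚ.≟ u) then v else if does (i Finₚ.≟ v) then u else swapAlong P i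

  swapAlong-fixed : ∀ P {i} → i ∉ vertices P → swapAlong P i ≡ i
  swapAlong-fixed []            i∉ = ≡.refl
  swapAlong-fixed ((u , v) ∷ P) {i} i∉
    rewrite dec-false (i Finₚ.≟ u) (i∉ ∘ here) | dec-false (i Finₚ.≟ v) (i∉ ∘ there ∘ here) =
    swapAlong-fixed P (i∉ ∘ there ∘ there)

  -- A vertex off `P` is its own image, so an involution sends no other vertex there. This keeps the
  -- recursive call away from the endpoints of the edge in front.
  swapAlong-avoids : ∀ P i {x} → swapAlong P (swapAlong P i) ≡ i → x ∉ vertices P → i ≢ x →
                     swapAlong P i ≢ x
  swapAlong-avoids P i inv x∉ i≢x eq = i≢x (≡.trans (≡.sym inv)
    (≡.trans (≡.cong (swapAlong P) eq) (swapAlong-fixed P x∉)))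

  swapAlong-involutive : ∀ P → Unique (vertices P) → ∀ i → swapAlong P (swapAlong P i) ≡ i
  swapAlong-involutive []            uniq i = ≡.refl
  swapAlong-involutive ((u , v) ∷ P) uniq i with i Finₚ.≟ u | i Finₚ.≟ v
  ... | yes ≡.refl | _
    rewrite dec-false (v Finₚ.≟ u) (λ { ≡.refl → Unique-∉ uniq (here ≡.refl) })
          | dec-true (v Finₚ.≟ v) ≡.refl = ≡.refl
  ... | no _ | yes ≡.refl rewrite dec-true (u Finₚ.≟ u) ≡.refl = ≡.refl
  ... | no i≢u | no i≢v with ih ← swapAlong-involutive P (Unique-tail (Unique-tail uniq)) i
    rewrite dec-false (swapAlong P i Finₚ.≟ u) (swapAlong-avoids P i ih (Unique-∉ uniq ∘ there) i≢u)
          | dec-false (swapAlong P i Finₚ.≟ v) (swapAlong-avoids P i ih (Unique-∉ (Unique-tail uniq)) i≢v) = ih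

  matchingInvolution : ∀ P → Unique (vertices P) → Permutation′ n
  matchingInvolution P uniq = permutation (swapAlong P) (swapAlong P)
    (swapAlong-involutive P uniq) (swapAlong-involutive P uniq)

  fixed+count : ∀ P → Unique (vertices P) → ∀ i →
    (if does (swapAlong P i Finₚ.≟ i) then 1 else 0) ℕ.+ count i (vertices P) ≡ 1
  fixed+count [] uniq i rewrite dec-true (i Finₚ.≟ i) ≡.refl = ≡.refl
  fixed+count ((u , v) ∷ P) uniq i with i Finₚ.≟ u | i Finₚ.≟ v
  ... | yes ≡.refl | _
    rewrite dec-false (v Finₚ.≟ u) (λ { ≡.refl → Unique-∉ uniq (here ≡.refl) })
          | dec-true (u Finₚ.≟ u) ≡.refl = ≡.cong suc (count-∉ (vertices P) (Unique-∉ uniq ∘ there))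
  ... | no i≢u | yes ≡.refl
    rewrite dec-false (u Finₚ.≟ v) (i≢u ∘ ≡.sym) | dec-true (v Finₚ.≟ v) ≡.refl =
      ≡.cong suc (count-∉ (vertices P) (Unique-∉ (Unique-tail uniq)))
  ... | no i≢u | no i≢v
    rewrite dec-false (u Finₚ.≟ i) (i≢u ∘ ≡.sym) | dec-false (v Finₚ.≟ i) (i≢v ∘ ≡.sym) =
      fixed+count P (Unique-tail (Unique-tail uniq)) i

  fixed-sum : ∀ P → Unique (vertices P) →
    Add.∑[ i < n ] (if does (swapAlong P i Finₚ.≟ i) then 1 else 0) ℕ.+ (length P ℕ.+ length P) ≡ n
  fixed-sum P uniq = begin
    fix ℕ.+ (length P ℕ.+ length P)
      ≡⟨ ≡.cong (fix ℕ.+_) (≡.trans (∑-count (vertices P)) (length-vertices P)) ⟨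
    fix ℕ.+ Add.∑[ i < n ] count i (vertices P)  ≡⟨ Add.∑-distrib-+ {n} f (λ i → count i (vertices P)) ⟨
    Add.∑[ i < n ] (f i ℕ.+ count i (vertices P)) ≡⟨ Add.sum-cong-≗ {n} (fixed+count P uniq) ⟩
    Add.∑[ i < n ] 1                    ≡⟨ ones n ⟩
    n                                   ∎
    where
    open ≡.≡-Reasoning
    f : Fin n → ℕ
    f i = if does (swapAlong P i Finₚ.≟ i) then 1 else 0
    fix = Add.∑[ i < n ] f i
    ones : ∀ n → Add.∑[ i < n ] 1 ≡ n
    ones zero    = ≡.refl
    ones (suc n) = ≡.cong suc (ones n)

-- Matching monomials as functions of a matching

module MatchingPolynomials (K : CommutativeRing 0ℓ 0ℓ) (n : ℕ)
                           (inv : CharacteristicZero.InvertibleNumbers K) where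
  open CommutativeRing K
  open CharacteristicZero K
  open Vanishing K n inv
  open OrbitHarmonics K n using (permutationMatrix)
  open SetoidReasoning setoid

  ⟦_⟧ : Bool → Carrier
  ⟦ b ⟧ = if b then 1# else 0#

  occurrences : Fin n × Fin n → Edges → Carrier
  occurrences e []       = 0#
  occurrences e (e′ ∷ P) = ⟦ does (linked? e e′) ⟧ + occurrences e P

  occurrences-∷ : ∀ {e e′} → Linked e e′ → ∀ P → occurrences e (e′ ∷ P) ≈ 1# + occurrences e P
  occurrences-∷ {e} {e′} l P rewrite dec-true (linked? e e′) l = refl

  occurrences-∷-¬ : ∀ {e e′} → ¬ Linked e e′ → ∀ P → occurrences e (e′ ∷ P) ≈ occurrences e P
  occurrences-∷-¬ {e} {e′} ¬l P rewrite dec-false (linked? e e′) ¬l = +-identityˡ _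

  occurrences-↭ : ∀ e {P Q} → P ↭ Q → occurrences e P ≈ occurrences e Q
  occurrences-↭ e _↭_.refl        = refl
  occurrences-↭ e (prep x p)      = +-congˡ (occurrences-↭ e p)
  occurrences-↭ e (swap x y p)    = trans (+-congˡ (+-congˡ (occurrences-↭ e p)))
    (CommutativeSemigroupProperties.x∙yz≈y∙xz +-commutativeSemigroup _ _ _)
  occurrences-↭ e (_↭_.trans p q) = trans (occurrences-↭ e p) (occurrences-↭ e q)

  occurrences-none : ∀ e P → All (λ s → ¬ Linked e s) P → occurrences e P ≈ 0#
  occurrences-none e []      []       = refl
  occurrences-none e (s ∷ P) (¬l ∷ h) = trans (occurrences-∷-¬ ¬l P) (occurrences-none e P h)

  -- The monomial of `S` evaluated at the edge multiplicities of `P`. For ordered `S` and a matching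
  -- `P` this is its value at the permutation matrix of the involution of `P`.
  weight : Edges → Edges → Carrier
  weight []      P = 1#
  weight (e ∷ S) P = occurrences e P * weight S P

  weight-symmetric : ∀ S → Symmetric (weight S)
  weight-symmetric []      p = refl
  weight-symmetric (e ∷ S) p = *-cong (occurrences-↭ e p) (weight-symmetric S p)

  weight-↭ : ∀ {S T} → S ↭ T → ∀ P → weight S P ≈ weight T P
  weight-↭ _↭_.refl P        = refl
  weight-↭ (prep x p) P      = *-congˡ (weight-↭ p P)
  weight-↭ (swap x y p) P    = trans (*-congˡ (*-congˡ (weight-↭ p P)))
    (CommutativeSemigroupProperties.x∙yz≈y∙xz *-commutativeSemigroup _ _ _)
  weight-↭ (_↭_.trans p q) P = trans (weight-↭ p P) (weight-↭ q P)

  weight-unlinked : ∀ S e → All (λ s → ¬ Linked s e) S → ∀ P → weight S (e ∷ P) ≈ weight S P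
  weight-unlinked []      e []       P = refl
  weight-unlinked (s ∷ S) e (¬l ∷ h) P = *-cong (occurrences-∷-¬ ¬l P) (weight-unlinked S e h P)

  -- A given edge `e` is linked to at most one edge of the matching `S`, so the derivative along `e`
  -- is zero or the weight of `S` without that edge.
  weight-homogeneous : ∀ d S → length S ≡ d → Unique (vertices S) → Homogeneous d (weight S)
  weight-homogeneous zero    []      _ uniq P = refl
  weight-homogeneous (suc d) (s ∷ S) |S| uniq = zeroˡ _ , derivative
    where
    derivative : ∀ e → Homogeneous d (Δ e (weight (s ∷ S)))
    derivative e with any? (λ t → linked? t e) (s ∷ S)
    ... | no none = Homogeneous-cong d
      (λ P → sym (trans (+-congʳ (weight-unlinked (s ∷ S) e (Allₚ.¬Any⇒All¬ _ none) P)) (-‿inverseʳ _)))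
      (Homogeneous-0 d)
    ... | yes some with t , t∈S , l ← find some
                   with S′ , S↭ ← ∈⇒↭ t∈S = Homogeneous-cong d
      (λ P → sym (begin
        weight (s ∷ S) (e ∷ P) - weight (s ∷ S) P
          ≈⟨ sub-cong (weight-↭ S↭ (e ∷ P)) (weight-↭ S↭ P) ⟩
        occurrences t (e ∷ P) * weight S′ (e ∷ P) - occurrences t P * weight S′ P
          ≈⟨ +-congʳ (*-cong (occurrences-∷ l P) (weight-unlinked S′ e (unlinked uniq′ l) P)) ⟩
        (1# + occurrences t P) * weight S′ P - occurrences t P * weight S′ P
          ≈⟨ +-congʳ (trans (distribʳ _ _ _) (+-congʳ (*-identityˡ _))) ⟩
        (weight S′ P + occurrences t P * weight S′ P) - occurrences t P * weight S′ P
          ≈⟨ trans (+-assoc _ _ _) (trans (+-congˡ (-‿inverseʳ _)) (+-identityʳ _)) ⟩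
        weight S′ P  ∎))
      (weight-homogeneous d S′ (ℕₚ.suc-injective (≡.trans (≡.sym (↭ₚ.↭-length S↭)) |S|))
                          (Unique-tail (Unique-tail uniq′)))
      where uniq′ = Unique-resp-↭ (vertices-↭ S↭) uniq

  occurrences-∈ : ∀ {e S} → Unique (vertices S) → e ∈ S → occurrences e S ≈ 1#
  occurrences-∈ {e} {S} uniq e∈S with S′ , S↭ ← ∈⇒↭ e∈S = begin
    occurrences e S         ≈⟨ occurrences-↭ e S↭ ⟩
    occurrences e (e ∷ S′)  ≈⟨ occurrences-∷ self S′ ⟩
    1# + occurrences e S′   ≈⟨ +-congˡ (occurrences-none e S′ (All.map (λ ¬l l → ¬l (Linked-sym l))
                                 (unlinked (Unique-resp-↭ (vertices-↭ S↭) uniq) self))) ⟩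
    1# + 0#                 ≈⟨ +-identityʳ 1# ⟩
    1#                      ∎
    where
    self : Linked e e
    self = inj₁ (≡.refl , ≡.refl)

  weight-⊆ : ∀ T {S} → Unique (vertices S) → (∀ {e} → e ∈ T → e ∈ S) → weight T S ≈ 1#
  weight-⊆ []      uniq T⊆S = refl
  weight-⊆ (e ∷ T) uniq T⊆S = trans
    (*-cong (occurrences-∈ uniq (T⊆S (here ≡.refl))) (weight-⊆ T uniq (T⊆S ∘ there)))
    (*-identityˡ 1#)

  occurrences-∉ : ∀ {e} S → Ordered e → All Ordered S → e ∉ S → occurrences e S ≈ 0#
  occurrences-∉ {i , j} S i<j ordered e∉S = occurrences-none (i , j) S (go S ordered e∉S)
    where
    go : ∀ S → All Ordered S → (i , j) ∉ S → All (λ s → ¬ Linked (i , j) s) S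
    go []            []        ∉S = []
    go ((u , v) ∷ S) (u<v ∷ o) ∉S = (λ where
        (inj₁ (≡.refl , ≡.refl)) → ∉S (here ≡.refl)
        (inj₂ (≡.refl , ≡.refl)) → ℕₚ.<-asym i<j u<v)
      ∷ go S o (∉S ∘ there)

  weight-missing : ∀ {x T S} → x ∈ T → occurrences x S ≈ 0# → weight T S ≈ 0#
  weight-missing (here ≡.refl) zero! = trans (*-congʳ zero!) (zeroˡ _)
  weight-missing (there x∈T)   zero! = trans (*-congˡ (weight-missing x∈T zero!)) (zeroʳ _)

  -- The diagonal is excluded because it records the fixed points, which are no edges of `P`.
  permutationMatrix-occurrences : ∀ P (uniq : Unique (vertices P)) {i j} → i ≢ j →
    permutationMatrix (matchingInvolution P uniq) i j ≈ occurrences (i , j) P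
  permutationMatrix-occurrences P uniq i≢j = go P uniq i≢j
    where
    ≟-sym : ∀ (x y : Fin n) → does (x Finₚ.≟ y) ≡ does (y Finₚ.≟ x)
    ≟-sym x y = does-⇔ (mk⇔ ≡.sym ≡.sym) (x Finₚ.≟ y) (y Finₚ.≟ x)
    missing : ∀ {i j P} → i ∉ vertices P → occurrences (i , j) P ≈ 0#
    missing {i} {j} {P} i∉ = occurrences-none (i , j) P (All.tabulate λ where
      e∈P (inj₁ (≡.refl , _)) → i∉ (endpoint∈ e∈P)
      e∈P (inj₂ (≡.refl , _)) → i∉ (endpoint₂∈ e∈P))
    go : ∀ P → Unique (vertices P) → ∀ {i j} → i ≢ j →
         ⟦ does (swapAlong P i Finₚ.≟ j) ⟧ ≈ occurrences (i , j) P
    go [] uniq {i} {j} i≢j rewrite dec-false (i Finₚ.≟ j) i≢j = refl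
    go ((u , v) ∷ P) uniq {i} {j} i≢j with i Finₚ.≟ u | i Finₚ.≟ v
    ... | yes ≡.refl | yes ≡.refl = ⊥-elim (Unique-∉ uniq (here ≡.refl))
    ... | yes ≡.refl | no _ = trans (reflexive (≡.cong ⟦_⟧ (≟-sym v j)))
      (sym (trans (+-cong (reflexive (≡.cong ⟦_⟧ (∨-identityʳ (does (j Finₚ.≟ v)))))
                          (missing (Unique-∉ uniq ∘ there))) (+-identityʳ _)))
    ... | no _ | yes ≡.refl = trans (reflexive (≡.cong ⟦_⟧ (≟-sym u j)))
      (sym (trans (+-congˡ (missing (Unique-∉ (Unique-tail uniq)))) (+-identityʳ _)))
    ... | no i≢u | no i≢v = trans (go P (Unique-tail (Unique-tail uniq)) i≢j) (sym (+-identityˡ _))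

-- Reduction to matching monomials

module ModuleSums {K : CommutativeRing 0ℓ 0ℓ} (M : Module K 0ℓ 0ℓ) where
  open CommutativeRing K hiding (zero)
  open CharacteristicZero K
  open Module M
  open Sum +ᴹ-commutativeMonoid public using (sum; sum-cong-≋; ∑-distrib-+)
  open SetoidReasoning ≈ᴹ-setoid
  private
    module Add = Sum ℕₚ.+-0-commutativeMonoid

  fromℕ-+ : ∀ x y → fromℕ (x ℕ.+ y) ≈ fromℕ x + fromℕ y
  fromℕ-+ = Mult.×-homo-+ +-monoid 1#

  *ₗ-sum : ∀ {m} c (f : Fin m → Carrierᴹ) → c *ₗ sum f ≈ᴹ sum (λ i → c *ₗ f i)
  *ₗ-sum {zero}  c f = *ₗ-zeroʳ c
  *ₗ-sum {suc m} c f = ≈ᴹ-trans (*ₗ-distribˡ c _ _) (+ᴹ-congˡ (*ₗ-sum c (f ∘ suc)))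

  sum-fromℕ : ∀ {m} (f : Fin m → ℕ) v → sum (λ i → fromℕ (f i) *ₗ v) ≈ᴹ fromℕ (Add.sum f) *ₗ v
  sum-fromℕ {zero}  f v = ≈ᴹ-sym (*ₗ-zeroˡ v)
  sum-fromℕ {suc m} f v = ≈ᴹ-trans (+ᴹ-congˡ (sum-fromℕ (f ∘ suc) v))
    (≈ᴹ-trans (≈ᴹ-sym (*ₗ-distribʳ v _ _)) (*ₗ-congʳ (sym (fromℕ-+ (f zero) _))))

  sum-const : ∀ m v → sum {m} (λ _ → v) ≈ᴹ fromℕ m *ₗ v
  sum-const zero    v = ≈ᴹ-sym (*ₗ-zeroˡ v)
  sum-const (suc m) v = ≈ᴹ-trans (+ᴹ-cong (≈ᴹ-sym (*ₗ-identityˡ v)) (sum-const m v))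
    (≈ᴹ-sym (*ₗ-distribʳ v 1# (fromℕ m)))

  cancel : ∀ v → v +ᴹ (- 1#) *ₗ v ≈ᴹ 0ᴹ
  cancel v = begin
    v +ᴹ (- 1#) *ₗ v        ≈⟨ +ᴹ-congʳ (*ₗ-identityˡ v) ⟨
    1# *ₗ v +ᴹ (- 1#) *ₗ v  ≈⟨ *ₗ-distribʳ v 1# (- 1#) ⟨
    (1# + - 1#) *ₗ v        ≈⟨ *ₗ-congʳ (-‿inverseʳ 1#) ⟩
    0# *ₗ v                 ≈⟨ *ₗ-zeroˡ v ⟩
    0ᴹ                      ∎

  -- Subtraction is spelled as multiplication by `- 1#` to fit the closure of spans under sums and
  -- scalar multiples.
  move : ∀ {x y z} → x ≈ᴹ y +ᴹ z → x +ᴹ (- 1#) *ₗ y ≈ᴹ z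
  move {x} {y} {z} eq = begin
    x +ᴹ (- 1#) *ₗ y          ≈⟨ +ᴹ-congʳ (≈ᴹ-trans eq (+ᴹ-comm y z)) ⟩
    (z +ᴹ y) +ᴹ (- 1#) *ₗ y   ≈⟨ +ᴹ-assoc z y _ ⟩
    z +ᴹ (y +ᴹ (- 1#) *ₗ y)   ≈⟨ +ᴹ-congˡ (cancel y) ⟩
    z +ᴹ 0ᴹ                   ≈⟨ +ᴹ-identityʳ z ⟩
    z                         ∎

  sum-split : ∀ {m} (i : Fin m) (f : Fin m → Carrierᴹ) →
    sum f ≈ᴹ f i +ᴹ sum (λ j → if does (i Finₚ.≟ j) then 0ᴹ else f j)
  sum-split i f = begin
    sum f
      ≈⟨ sum-cong-≋ (λ j → pointwise (does (i Finₚ.≟ j)) (f j)) ⟩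
    sum (λ j → (if does (i Finₚ.≟ j) then f j else 0ᴹ) +ᴹ (if does (i Finₚ.≟ j) then 0ᴹ else f j))
      ≈⟨ ∑-distrib-+ (λ j → if does (i Finₚ.≟ j) then f j else 0ᴹ)
                     (λ j → if does (i Finₚ.≟ j) then 0ᴹ else f j) ⟩
    sum (λ j → if does (i Finₚ.≟ j) then f j else 0ᴹ) +ᴹ sum (λ j → if does (i Finₚ.≟ j) then 0ᴹ else f j)
      ≈⟨ +ᴹ-congʳ (∑-indicator +ᴹ-commutativeMonoid i f) ⟩
    f i +ᴹ sum (λ j → if does (i Finₚ.≟ j) then 0ᴹ else f j)  ∎
    where
    pointwise : ∀ b x → x ≈ᴹ (if b then x else 0ᴹ) +ᴹ (if b then 0ᴹ else x)
    pointwise true  x = ≈ᴹ-sym (+ᴹ-identityʳ x)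
    pointwise false x = ≈ᴹ-sym (+ᴹ-identityˡ x)

module Reduction (K : CommutativeRing 0ℓ 0ℓ) (n : ℕ) (inv : CharacteristicZero.InvertibleNumbers K)
                 (a k : ℕ) (n≡a+2k : n ≡ a ℕ.+ (k ℕ.+ k)) where
  open CommutativeRing K hiding (zero)
  open CharacteristicZero K
  open Vanishing K n inv using (Edges)

  -- The relations satisfied by the monomials x_{i₁,j₁} ⋯ x_{i_r,j_r} on the locus of involutions
  -- with a fixed points, homogenised by h: taking h = 1 gives values on the locus, and taking
  -- h = 0 gives the relations between top-degree parts.
  record Realisation : Set₁ where
    field M : Module K 0ℓ 0ℓ
    open Module M public
    open ModuleSums M public
    field
      h           : Carrier
      h-idem      : h * h ≈ h
      φ           : Edges → Carrierᴹ
      φ-↭         : ∀ {w w′} → w ↭ w′ → φ w ≈ᴹ φ w′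
      φ-conflict  : ∀ i {j l} w → j ≢ l → φ ((i , j) ∷ (i , l) ∷ w) ≈ᴹ 0ᴹ
      φ-square    : ∀ i j w → φ ((i , j) ∷ (i , j) ∷ w) ≈ᴹ h *ₗ φ ((i , j) ∷ w)
      φ-transpose : ∀ i j w → φ ((i , j) ∷ w) ≈ᴹ φ ((j , i) ∷ w)
      φ-row       : ∀ i w → sum (λ j → φ ((i , j) ∷ w)) ≈ᴹ h *ₗ φ w
      φ-trace     : ∀ w → sum (λ i → φ ((i , i) ∷ w)) ≈ᴹ fromℕ a *ₗ (h *ₗ φ w)

  -- Multiplication by a variable respects all relations. Hence an equation that holds in every
  -- realisation may be multiplied by a variable: it suffices to read it in the shifted realisation.
  shift : Fin n × Fin n → Realisation → Realisation
  shift x Φ = record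
    { M = M
    ; h = h
    ; h-idem = h-idem
    ; φ = λ w → φ (x ∷ w)
    ; φ-↭ = λ p → φ-↭ (prep x p)
    ; φ-conflict = λ i {j} {l} w j≢l →
        ≈ᴹ-trans (φ-↭ (↭ₚ.shifts (x ∷ []) ((i , j) ∷ (i , l) ∷ []))) (φ-conflict i (x ∷ w) j≢l)
    ; φ-square = λ i j w →
        ≈ᴹ-trans (φ-↭ (↭ₚ.shifts (x ∷ []) ((i , j) ∷ (i , j) ∷ [])))
          (≈ᴹ-trans (φ-square i j (x ∷ w)) (*ₗ-congˡ (φ-↭ (swap _ _ ↭-refl))))
    ; φ-transpose = λ i j w → ≈ᴹ-trans (φ-↭ (swap _ _ ↭-refl))
        (≈ᴹ-trans (φ-transpose i j (x ∷ w)) (φ-↭ (swap _ _ ↭-refl)))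
    ; φ-row = λ i w → ≈ᴹ-trans (sum-cong-≋ {n} λ j → φ-↭ (swap _ _ ↭-refl)) (φ-row i (x ∷ w))
    ; φ-trace = λ w → ≈ᴹ-trans (sum-cong-≋ {n} λ i → φ-↭ (swap _ _ ↭-refl)) (φ-trace (x ∷ w))
    }
    where open Realisation Φ

  Terms : Set
  Terms = List (Carrier × Edges)

  combination : ∀ Φ → Terms → Realisation.Carrierᴹ Φ
  combination Φ []            = 0ᴹ where open Realisation Φ
  combination Φ ((c , w) ∷ T) = c *ₗ φ w +ᴹ combination Φ T where open Realisation Φ

  -- An expression is encoded by its values in all realisations, so that one proof of `_≋_` is valid
  -- on the locus and in the graded quotient alike.
  Element : Set₁
  Element = ∀ Φ → Realisation.Carrierᴹ Φ

  infix 4 _≋_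
  _≋_ : Element → Element → Set₁
  τ ≋ υ = ∀ Φ → Realisation._≈ᴹ_ Φ (τ Φ) (υ Φ)

  infixl 6 _⊞_
  infixr 7 _⊡_
  _⊞_ : Element → Element → Element
  (τ ⊞ υ) Φ = Realisation._+ᴹ_ Φ (τ Φ) (υ Φ)

  _⊡_ : Carrier → Element → Element
  (c ⊡ τ) Φ = Realisation._*ₗ_ Φ c (τ Φ)

  homogenised : Element → Element
  homogenised τ Φ = Realisation._*ₗ_ Φ (Realisation.h Φ) (τ Φ)

  𝟘 : Element
  𝟘 Φ = Realisation.0ᴹ Φ

  [_] : Edges → Element
  [ w ] Φ = Realisation.φ Φ w

  ∑ᴱ : ∀ {m} → (Fin m → Element) → Element
  ∑ᴱ τ Φ = Realisation.sum Φ (λ i → τ i Φ)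

  -- The terms `T` are chosen before the realisation that `_≋_` quantifies over, which is what makes
  -- the coefficients common to both readings.
  InSpan : ℕ → Element → Set₁
  InSpan e τ = Σ[ T ∈ Terms ]
    (All (λ (_ , S) → OrderedMatching e S) T × (τ ≋ λ Φ → combination Φ T))

  span-≋ : ∀ {e τ υ} → τ ≋ υ → InSpan e υ → InSpan e τ
  span-≋ eq (T , good , υ≋) = T , good , λ Φ → Realisation.≈ᴹ-trans Φ (eq Φ) (υ≋ Φ)

  span-𝟘 : ∀ {e} → InSpan e 𝟘
  span-𝟘 = [] , [] , λ Φ → Realisation.≈ᴹ-refl Φ

  span-⊞ : ∀ {e τ υ} → InSpan e τ → InSpan e υ → InSpan e (τ ⊞ υ)
  span-⊞ {τ = τ} {υ} (T , good , τ≋) (U , good′ , υ≋) = T ++ U , Allₚ.++⁺ good good′ , λ Φ →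
    let open Realisation Φ in ≈ᴹ-trans (+ᴹ-cong (τ≋ Φ) (υ≋ Φ)) (≈ᴹ-sym (combination-++ Φ T))
    where
    combination-++ : ∀ Φ T → let open Realisation Φ in
      combination Φ (T ++ U) ≈ᴹ combination Φ T +ᴹ combination Φ U
    combination-++ Φ []      = ≈ᴹ-sym (+ᴹ-identityˡ _) where open Realisation Φ
    combination-++ Φ (_ ∷ T) = ≈ᴹ-trans (+ᴹ-congˡ (combination-++ Φ T)) (≈ᴹ-sym (+ᴹ-assoc _ _ _))
      where open Realisation Φ

  span-⊡ : ∀ {e τ} c → InSpan e τ → InSpan e (c ⊡ τ)
  span-⊡ {e} c (T , good , τ≋) = map (λ (k , S) → c * k , S) T , Allₚ.map⁺ good , λ Φ →
    let open Realisation Φ in ≈ᴹ-trans (*ₗ-congˡ (τ≋ Φ)) (scale Φ T)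
    where
    scale : ∀ Φ T → let open Realisation Φ in
      c *ₗ combination Φ T ≈ᴹ combination Φ (map (λ (k , S) → c * k , S) T)
    scale Φ []            = *ₗ-zeroʳ c where open Realisation Φ
    scale Φ ((k , S) ∷ T) = ≈ᴹ-trans (*ₗ-distribˡ c _ _)
      (+ᴹ-cong (≈ᴹ-sym (*ₗ-assoc c k _)) (scale Φ T)) where open Realisation Φ

  span-∑ : ∀ {e m} (τ : Fin m → Element) → (∀ i → InSpan e (τ i)) → InSpan e (∑ᴱ τ)
  span-∑ {m = zero}  τ s = span-𝟘
  span-∑ {m = suc m} τ s = span-⊞ (s zero) (span-∑ (τ ∘ suc) (s ∘ suc))

  span-matching : ∀ {e S} → OrderedMatching e S → InSpan e [ S ]
  span-matching {S = S} good = (1# , S) ∷ [] , good ∷ [] , λ Φ →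
    let open Realisation Φ in ≈ᴹ-sym (≈ᴹ-trans (+ᴹ-identityʳ _) (*ₗ-identityˡ _))

  combinationOf : (Edges → Element) → Terms → Element
  combinationOf f []            = 𝟘
  combinationOf f ((c , S) ∷ T) = c ⊡ f S ⊞ combinationOf f T

  span-combination : ∀ {e e′} f → (∀ {S} → OrderedMatching e S → InSpan e′ (f S)) →
    ∀ {T} → All (λ (_ , S) → OrderedMatching e S) T → InSpan e′ (combinationOf f T)
  span-combination f s []           = span-𝟘
  span-combination f s (good ∷ all) = span-⊞ (span-⊡ _ (s good)) (span-combination f s all)

  infix 4 _∈ⱽ_
  _∈ⱽ_ : ∀ i (S : Edges) → Dec (i ∈ vertices S)
  i ∈ⱽ S = _∈?_ Finₚ._≟_ i (vertices S)

  partner : ∀ {i} (S : Edges) → i ∈ vertices S →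
            ∃[ l ] ∃[ S′ ] (S ↭ (i , l) ∷ S′ ⊎ S ↭ (l , i) ∷ S′)
  partner ((u , v) ∷ S) (here ≡.refl)         = v , S , inj₁ ↭-refl
  partner ((u , v) ∷ S) (there (here ≡.refl)) = u , S , inj₂ ↭-refl
  partner (e ∷ S) (there (there i∈S)) with partner S i∈S
  ... | l , S′ , inj₁ p = l , e ∷ S′ , inj₁ (↭-trans (prep e p) (swap _ _ ↭-refl))
  ... | l , S′ , inj₂ p = l , e ∷ S′ , inj₂ (↭-trans (prep e p) (swap _ _ ↭-refl))

  -- The conclusion is an equation of elements and not a permutation of lists, because the edge at
  -- `i` may have to be transposed to start at `i`.
  incident : ∀ {i} {S : Edges} → i ∈ vertices S → ∃[ l ] ∃[ S′ ] (l ∈ vertices S × [ S ] ≋ [ (i , l) ∷ S′ ])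
  incident {i} {S} i∈S with partner S i∈S
  ... | l , S′ , inj₁ p = l , S′ , ↭ₚ.∈-resp-↭ (↭-sym (vertices-↭ p)) (there (here ≡.refl)) ,
    λ Φ → Realisation.φ-↭ Φ p
  ... | l , S′ , inj₂ p = l , S′ , ↭ₚ.∈-resp-↭ (↭-sym (vertices-↭ p)) (here ≡.refl) ,
    λ Φ → let open Realisation Φ in ≈ᴹ-trans (φ-↭ p) (φ-transpose l i S′)

  -- The partner `l` of `i` lies on `S` and so differs from `j`; then `x_{ij} x_{il} = 0` applies.
  φ-clash : ∀ {i j} {S : Edges} → i ∈ vertices S → j ∉ vertices S → [ (i , j) ∷ S ] ≋ 𝟘
  φ-clash {i} {j} {S} i∈S j∉S Φ with l , S′ , l∈S , eq ← incident {i} {S} i∈S =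
    ≈ᴹ-trans (eq (shift (i , j) Φ)) (φ-conflict i S′ λ { ≡.refl → j∉S l∈S })
    where open Realisation Φ

  φ-loop : ∀ {i} {S : Edges} → Unique (vertices S) → i ∈ vertices S → [ (i , i) ∷ S ] ≋ 𝟘
  φ-loop {i} {S} uniq i∈S Φ with partner S i∈S
  ... | l , S′ , inj₁ p = ≈ᴹ-trans (φ-↭ (prep (i , i) p))
      (φ-conflict i S′ λ { ≡.refl → Unique-∉ (Unique-resp-↭ (vertices-↭ p) uniq) (here ≡.refl) })
    where open Realisation Φ
  ... | l , S′ , inj₂ p = ≈ᴹ-trans (φ-↭ (prep (i , i) p)) (≈ᴹ-trans (φ-↭ (swap _ _ ↭-refl))
      (≈ᴹ-trans (φ-transpose l i _) (≈ᴹ-trans (φ-↭ (swap _ _ ↭-refl))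
      (φ-conflict i S′ λ { ≡.refl → Unique-∉ (Unique-resp-↭ (vertices-↭ p) uniq) (here ≡.refl) }))))
    where open Realisation Φ

  span-edge : ∀ {e} {S : Edges} → OrderedMatching e S → ∀ {i j} → i ≢ j → i ∉ vertices S → j ∉ vertices S →
              InSpan (suc e) [ (i , j) ∷ S ]
  span-edge {e} {S} (orderedMatching size ordered unique) {i} {j} i≢j i∉S j∉S with Finₚ.<-cmp i j
  ... | tri< i<j _ _ = span-matching (orderedMatching (≡.cong suc size) (i<j ∷ ordered)
          ((i≢j ∷ Allₚ.¬Any⇒All¬ _ i∉S) ∷ Allₚ.¬Any⇒All¬ _ j∉S ∷ unique))
  ... | tri≈ _ i≡j _ = ⊥-elim (i≢j i≡j)
  ... | tri> _ _ j<i = span-≋ (λ Φ → Realisation.φ-transpose Φ i j S)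
          (span-matching (orderedMatching (≡.cong suc size) (j<i ∷ ordered)
            ((i≢j ∘ ≡.sym ∷ Allₚ.¬Any⇒All¬ _ j∉S) ∷ Allₚ.¬Any⇒All¬ _ i∉S ∷ unique)))

  offDiagonal : Fin n → Edges → Element
  offDiagonal i S = ∑ᴱ λ j Φ → let open Realisation Φ in
    if does (i Finₚ.≟ j) then 0ᴹ else φ ((i , j) ∷ S)

  row-split : ∀ i S → homogenised [ S ] ⊞ (- 1#) ⊡ [ (i , i) ∷ S ] ≋ offDiagonal i S
  row-split i S Φ = move (≈ᴹ-trans (≈ᴹ-sym (φ-row i S)) (sum-split i (λ j → φ ((i , j) ∷ S))))
    where open Realisation Φ

  span-offDiagonal : ∀ {e S} i → (∀ j → i ≢ j → InSpan e [ (i , j) ∷ S ]) → InSpan e (offDiagonal i S)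
  span-offDiagonal {e} {S} i s = span-∑ _ entry
    where
    entry : ∀ j → InSpan e (λ Φ → let open Realisation Φ in
      if does (i Finₚ.≟ j) then 0ᴹ else φ ((i , j) ∷ S))
    entry j with i Finₚ.≟ j
    ... | yes _  = span-𝟘
    ... | no i≢j = s j i≢j

  -- On the locus, h S = h ∑_j x_{ij} S for each i ∉ S; summing over those i counts every way of
  -- adding an edge to S twice, and the i with x_{ii} = 1 account for the fixed points.
  lift : ∀ {e} {S : Edges} → OrderedMatching e S → e < k → InSpan (suc e) (homogenised [ S ])
  lift {e} {S} good@(orderedMatching size ordered unique) e<k =
    span-≋ total (span-⊡ r (span-∑ vertexPart vertexSpan))
    where
    v : Element
    v = homogenised [ S ]
    vertexPart : Fin n → Element
    -- For `i` on `S` the loop term is zero and the count is one, so nothing remains; for `i` off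
    -- `S` the row sum without its diagonal entry remains.
    vertexPart i = v ⊞ (- 1#) ⊡ ([ (i , i) ∷ S ] ⊞ fromℕ (count i (vertices S)) ⊡ v)
    vertexSpan : ∀ i → InSpan (suc e) (vertexPart i)
    vertexSpan i with i ∈ⱽ S
    ... | yes i∈S = span-≋ (λ Φ → let open Realisation Φ in
            move (≈ᴹ-sym (≈ᴹ-trans (+ᴹ-identityʳ _) (≈ᴹ-trans (+ᴹ-cong (φ-loop unique i∈S Φ)
              (≈ᴹ-trans (*ₗ-congʳ (trans (reflexive (≡.cong fromℕ (count-∈ unique i∈S))) (+-identityʳ 1#)))
                (*ₗ-identityˡ _)))
              (+ᴹ-identityˡ _)))))
            span-𝟘
    ... | no i∉S = span-≋ (λ Φ → let open Realisation Φ in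
            ≈ᴹ-trans (+ᴹ-congˡ (*ₗ-congˡ (≈ᴹ-trans
              (+ᴹ-congˡ (≈ᴹ-trans (*ₗ-congʳ (reflexive (≡.cong fromℕ (count-∉ (vertices S) i∉S))))
                                  (*ₗ-zeroˡ _)))
              (+ᴹ-identityʳ _))))
            (row-split i S Φ))
            (span-offDiagonal i entry)
      where
      entry : ∀ j → i ≢ j → InSpan (suc e) [ (i , j) ∷ S ]
      entry j i≢j with j ∈ⱽ S
      ... | yes j∈S = span-≋ (λ Φ → let open Realisation Φ in
              ≈ᴹ-trans (φ-transpose i j S) (φ-clash {S = S} j∈S i∉S Φ)) span-𝟘
      ... | no j∉S = span-edge good i≢j i∉S j∉S
    -- `suc m` is n - a - 2e = 2(k - e), twice the number of edges still missing from `k`, positive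
    -- by `e < k`.
    gap : ∃[ m ] n ≡ (a ℕ.+ (e ℕ.+ e)) ℕ.+ suc m
    gap with o , eq ← ℕₚ.m≤n⇒∃[o]m+o≡n e<k = suc (o ℕ.+ o) , ≡.trans n≡a+2k
      (≡.trans (≡.cong (λ k → a ℕ.+ (k ℕ.+ k)) (≡.sym eq)) (rearrange a e o))
      where
      open +-*-Solver
      rearrange : ∀ a e o → a ℕ.+ ((suc e ℕ.+ o) ℕ.+ (suc e ℕ.+ o)) ≡
                            (a ℕ.+ (e ℕ.+ e)) ℕ.+ suc (suc (o ℕ.+ o))
      rearrange = solve 3 (λ a e o → a :+ (((con 1 :+ e) :+ o) :+ ((con 1 :+ e) :+ o)) :=
        (a :+ (e :+ e)) :+ (con 2 :+ (o :+ o))) ≡.refl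
    m = proj₁ gap
    r = proj₁ (inv m)
    total : v ≋ r ⊡ ∑ᴱ vertexPart
    total Φ = ≈ᴹ-sym (begin
      r *ₗ sum (λ i → V +ᴹ (- 1#) *ₗ (D i +ᴹ C i))
        ≈⟨ *ₗ-congˡ (∑-distrib-+ (λ _ → V) (λ i → (- 1#) *ₗ (D i +ᴹ C i))) ⟩
      r *ₗ (sum {n} (λ _ → V) +ᴹ sum (λ i → (- 1#) *ₗ (D i +ᴹ C i)))
        ≈⟨ *ₗ-congˡ (+ᴹ-congˡ (≈ᴹ-trans (≈ᴹ-sym (*ₗ-sum (- 1#) (λ i → D i +ᴹ C i)))
             (*ₗ-congˡ (∑-distrib-+ D C)))) ⟩
      r *ₗ (sum {n} (λ _ → V) +ᴹ (- 1#) *ₗ (sum D +ᴹ sum C))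
        ≈⟨ *ₗ-congˡ (move split) ⟩
      r *ₗ (fromℕ (suc m) *ₗ V)
        ≈⟨ *ₗ-assoc r _ V ⟨
      (r * fromℕ (suc m)) *ₗ V
        ≈⟨ ≈ᴹ-trans (*ₗ-congʳ (proj₂ (inv m))) (*ₗ-identityˡ V) ⟩
      V  ∎)
      where
      open Realisation Φ
      open SetoidReasoning ≈ᴹ-setoid
      V = v Φ
      D C : Fin n → Carrierᴹ
      D i = φ ((i , i) ∷ S)
      C i = fromℕ (count i (vertices S)) *ₗ V
      split : sum {n} (λ _ → V) ≈ᴹ (sum D +ᴹ sum C) +ᴹ fromℕ (suc m) *ₗ V
      split = begin
        sum {n} (λ _ → V)                       ≈⟨ sum-const n V ⟩
        fromℕ n *ₗ V                            ≡⟨ ≡.cong (λ n → fromℕ n *ₗ V) (proj₂ gap) ⟩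
        fromℕ ((a ℕ.+ (e ℕ.+ e)) ℕ.+ suc m) *ₗ V
          ≈⟨ *ₗ-congʳ (trans (fromℕ-+ (a ℕ.+ (e ℕ.+ e)) (suc m)) (+-congʳ (fromℕ-+ a (e ℕ.+ e)))) ⟩
        ((fromℕ a + fromℕ (e ℕ.+ e)) + fromℕ (suc m)) *ₗ V
          ≈⟨ ≈ᴹ-trans (*ₗ-distribʳ V _ _) (+ᴹ-congʳ (*ₗ-distribʳ V _ _)) ⟩
        (fromℕ a *ₗ V +ᴹ fromℕ (e ℕ.+ e) *ₗ V) +ᴹ fromℕ (suc m) *ₗ V
          -- The loops contribute `a` copies of `V` by the trace relation, the counts one copy for
          -- each of the 2e endpoints.
          ≈⟨ +ᴹ-congʳ (+ᴹ-cong (φ-trace S) (≈ᴹ-trans (sum-fromℕ (λ i → count i (vertices S)) V)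
               (*ₗ-congʳ (reflexive (≡.cong fromℕ (≡.trans (∑-count (vertices S))
                 (≡.trans (length-vertices S) (≡.cong (λ m → m ℕ.+ m) size)))))))) ⟨
        (sum D +ᴹ sum C) +ᴹ fromℕ (suc m) *ₗ V  ∎

  -- If `j` is the partner of `i`, the square relation gives back `h` times `S`, one edge short of
  -- the required degree, and `lift` supplies that edge. Otherwise the product is a conflict.
  multiply-incident : ∀ {e} {S : Edges} → OrderedMatching e S → e < k → ∀ {i} → i ∈ vertices S → ∀ j →
                      InSpan (suc e) [ (i , j) ∷ S ]
  multiply-incident {S = S} good e<k {i} i∈S j with incident {i} {S} i∈S
  ... | l , S′ , _ , eq with j Finₚ.≟ l
  ...   | yes ≡.refl = span-≋ (λ Φ → let open Realisation Φ in
            ≈ᴹ-trans (eq (shift (i , j) Φ)) (≈ᴹ-trans (φ-square i j S′) (*ₗ-congˡ (≈ᴹ-sym (eq Φ)))))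
          (lift good e<k)
  ...   | no j≢l = span-≋ (λ Φ → let open Realisation Φ in
            ≈ᴹ-trans (eq (shift (i , j) Φ)) (φ-conflict i S′ j≢l))
          span-𝟘

  multiply-offDiagonal : ∀ {e} {S : Edges} → OrderedMatching e S → e < k → ∀ {i j} → i ≢ j →
                         i ∉ vertices S → InSpan (suc e) [ (i , j) ∷ S ]
  multiply-offDiagonal {S = S} good e<k {i} {j} i≢j i∉S with j ∈ⱽ S
  ... | yes j∈S = span-≋ (λ Φ → Realisation.φ-transpose Φ i j S) (multiply-incident good e<k j∈S i)
  ... | no j∉S  = span-edge good i≢j i∉S j∉S

  multiply : ∀ {e} {S : Edges} → OrderedMatching e S → e < k → ∀ i j → InSpan (suc e) [ (i , j) ∷ S ]
  multiply {e} {S} good e<k i j with i ∈ⱽ S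
  ... | yes i∈S = multiply-incident good e<k i∈S j
  ... | no i∉S with i Finₚ.≟ j
  ...   | no i≢j = multiply-offDiagonal good e<k i≢j i∉S
  -- A diagonal variable is eliminated by the row relation at `i`, whose other entries are
  -- off-diagonal.
  ...   | yes ≡.refl = span-≋ (λ Φ → let open Realisation Φ in ≈ᴹ-sym (move (≈ᴹ-sym (diagonal Φ))))
          (span-⊞ (lift good e<k)
            (span-⊡ (- 1#) (span-offDiagonal i λ j i≢j → multiply-offDiagonal good e<k i≢j i∉S)))
    where
    diagonal : ∀ Φ → let open Realisation Φ in
      offDiagonal i S Φ +ᴹ φ ((i , i) ∷ S) ≈ᴹ h *ₗ φ S
    diagonal Φ = ≈ᴹ-trans (+ᴹ-comm _ _)
      (≈ᴹ-trans (≈ᴹ-sym (sum-split i (λ j → φ ((i , j) ∷ S)))) (φ-row i S))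
      where open Realisation Φ

  -- A product that collapses loses an edge and is lifted back at once, so every term keeps as many
  -- edges as the word has letters; lifting is possible only up to `k` edges.
  span-word : ∀ w → length w ≤ k → InSpan (length w) [ w ]
  span-word []            _   = span-matching (orderedMatching ≡.refl [] [])
  span-word ((i , j) ∷ w) w<k with T , good , w≋ ← span-word w (ℕₚ.<⇒≤ w<k) =
    span-≋ (λ Φ → Realisation.≈ᴹ-trans Φ (w≋ (shift (i , j) Φ)) (shifted Φ T))
      (span-combination (λ S → [ (i , j) ∷ S ]) (λ m → multiply m w<k i j) good)
    where
    shifted : ∀ Φ T → let open Realisation Φ in
      combination (shift (i , j) Φ) T ≈ᴹ combinationOf (λ S → [ (i , j) ∷ S ]) T Φ
    shifted Φ []      = Realisation.≈ᴹ-refl Φ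
    shifted Φ (_ ∷ T) = Realisation.+ᴹ-congˡ Φ (shifted Φ T)

  span-homogenised : ∀ {e τ} → InSpan e τ → e < k → InSpan (suc e) (homogenised τ)
  span-homogenised (T , good , τ≋) e<k =
    span-≋ (λ Φ → let open Realisation Φ in ≈ᴹ-trans (*ₗ-congˡ (τ≋ Φ)) (distribute Φ T))
      (span-combination (λ S → homogenised [ S ]) (λ m → lift m e<k) good)
    where
    distribute : ∀ Φ T → let open Realisation Φ in
      h *ₗ combination Φ T ≈ᴹ combinationOf (λ S → homogenised [ S ]) T Φ
    distribute Φ []            = *ₗ-zeroʳ h where open Realisation Φ
    distribute Φ ((c , S) ∷ T) = ≈ᴹ-trans (*ₗ-distribˡ h _ _) (+ᴹ-cong
      (≈ᴹ-trans (≈ᴹ-sym (*ₗ-assoc h c _)) (≈ᴹ-trans (*ₗ-congʳ (*-comm h c)) (*ₗ-assoc c h _)))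
      (distribute Φ T))
      where open Realisation Φ

  -- Each lifting consumes a factor `h`; by idempotence the single factor present supplies all
  -- `suc i` of them.
  span-lower : ∀ i w → suc i ℕ.+ length w ≤ k → InSpan (suc i ℕ.+ length w) (homogenised [ w ])
  span-lower zero    w bound = span-homogenised (span-word w (ℕₚ.<⇒≤ bound)) bound
  span-lower (suc i) w bound = span-≋
    (λ Φ → let open Realisation Φ in
      ≈ᴹ-trans (*ₗ-congʳ (sym h-idem)) (*ₗ-assoc h h _))
    (span-homogenised (span-lower i w (ℕₚ.<⇒≤ bound)) bound)

-- Coefficients and values of polynomials

module Monomials (K : CommutativeRing 0ℓ 0ℓ) (n : ℕ) where
  open CommutativeRing K hiding (zero)
  open OrbitHarmonics K n
  open Exp semiring using (_^_; ^-homo-*)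
  open SetoidReasoning setoid
  private
    module Add = Sum ℕₚ.+-0-commutativeMonoid
    module Mul = Sum *-commutativeMonoid

  degree-single : ∀ u v → degree (single u v) ≡ 1
  degree-single u v = ≡.trans
    (Add.sum-cong-≗ {n} λ i → inner (does (u Finₚ.≟ i)))
    (∑-indicator ℕₚ.+-0-commutativeMonoid u (λ _ → 1))
    where
    inner : ∀ b → Add.∑[ j < n ] (if b then (if does (v Finₚ.≟ j) then 1 else 0) else 0) ≡ (if b then 1 else 0)
    inner true  = ∑-indicator ℕₚ.+-0-commutativeMonoid v (λ _ → 1)
    inner false = Add.sum-replicate-zero n

  degree-+ : ∀ s t → degree (λ i j → s i j ℕ.+ t i j) ≡ degree s ℕ.+ degree t
  degree-+ s t = ≡.trans (Add.sum-cong-≗ {n} λ i → Add.∑-distrib-+ (s i) (t i))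
    (Add.∑-distrib-+ (λ i → Add.∑[ j < n ] s i j) (λ i → Add.∑[ j < n ] t i j))

  degree-exponents : ∀ w → degree (exponents w) ≡ length w
  degree-exponents []            = ≡.trans
    (Add.sum-cong-≗ {n} λ i → Add.sum-replicate-zero n) (Add.sum-replicate-zero n)
  degree-exponents ((u , v) ∷ w) = ≡.trans (degree-+ (single u v) (exponents w))
    (≡.cong₂ ℕ._+_ (degree-single u v) (degree-exponents w))

  evalMonomial-≗ : ∀ {s t} → s ≗ t → ∀ A → evalMonomial s A ≈ evalMonomial t A
  evalMonomial-≗ s≗t A = Mul.sum-cong-≋ {n} λ i → Mul.sum-cong-≋ {n} λ j →
    reflexive (≡.cong (A i j ^_) (s≗t i j))

  word : Matrix → List (Fin n × Fin n) → Carrier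
  word A []            = 1#
  word A ((i , j) ∷ w) = A i j * word A w

  evalMonomial-single : ∀ u v A → evalMonomial (single u v) A ≈ A u v
  evalMonomial-single u v A = trans
    (Mul.sum-cong-≋ {n} λ i → inner i (does (u Finₚ.≟ i)))
    (∑-indicator *-commutativeMonoid u (λ i → A i v))
    where
    power : ∀ b x → x ^ (if b then 1 else 0) ≈ (if b then x else 1#)
    power true  x = *-identityʳ x
    power false x = refl
    inner : ∀ i b → Mul.∑[ j < n ] (A i j ^ (if b then (if does (v Finₚ.≟ j) then 1 else 0) else 0)) ≈
                    (if b then A i v else 1#)
    inner i true  = trans (Mul.sum-cong-≋ {n} λ j → power (does (v Finₚ.≟ j)) (A i j))
                          (∑-indicator *-commutativeMonoid v (A i))
    inner i false = Mul.sum-replicate-zero n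

  evalMonomial-exponents : ∀ w A → evalMonomial (exponents w) A ≈ word A w
  evalMonomial-exponents [] A =
    trans (Mul.sum-cong-≋ {n} λ i → Mul.sum-replicate-zero n) (Mul.sum-replicate-zero n)
  evalMonomial-exponents ((u , v) ∷ w) A = begin
    evalMonomial (exponents ((u , v) ∷ w)) A
      ≈⟨ (Mul.sum-cong-≋ {n} λ i → trans
           (Mul.sum-cong-≋ {n} λ j → ^-homo-* (A i j) (single u v i j) (exponents w i j))
           (Mul.∑-distrib-+ (λ j → A i j ^ single u v i j) (λ j → A i j ^ exponents w i j))) ⟩
    Mul.∑[ i < n ] (Mul.∑[ j < n ] (A i j ^ single u v i j) * Mul.∑[ j < n ] (A i j ^ exponents w i j))
      ≈⟨ Mul.∑-distrib-+ (λ i → Mul.∑[ j < n ] (A i j ^ single u v i j))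
                         (λ i → Mul.∑[ j < n ] (A i j ^ exponents w i j)) ⟩
    evalMonomial (single u v) A * evalMonomial (exponents w) A
      ≈⟨ *-cong (evalMonomial-single u v A) (evalMonomial-exponents w A) ⟩
    A u v * word A w  ∎

  exponents-++ : ∀ w w′ (i j : Fin n) → exponents (w ++ w′) i j ≡ exponents w i j ℕ.+ exponents w′ i j
  exponents-++ []            w′ i j = ≡.refl
  exponents-++ ((u , v) ∷ w) w′ i j = ≡.trans (≡.cong (single u v i j ℕ.+_) (exponents-++ w w′ i j))
    (≡.sym (ℕₚ.+-assoc (single u v i j) _ _))

  exponents-concat : ∀ {m} (f : Fin m → List (Fin n × Fin n)) i j →
    exponents (concat (tabulate f)) i j ≡ Add.∑[ u < m ] exponents (f u) i j
  exponents-concat {zero}  f i j = ≡.refl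
  exponents-concat {suc m} f i j = ≡.trans (exponents-++ (f zero) _ i j)
    (≡.cong (exponents (f zero) i j ℕ.+_) (exponents-concat (f ∘ suc) i j))

  spell : Monomial → List (Fin n × Fin n)
  spell t = concat (tabulate λ i → concat (tabulate λ j → replicate (t i j) (i , j)))

  exponents-replicate : ∀ c (u v i j : Fin n) → exponents (replicate c (u , v)) i j ≡
    (if does (u Finₚ.≟ i) then (if does (v Finₚ.≟ j) then c else 0) else 0)
  exponents-replicate zero u v i j with does (u Finₚ.≟ i) | does (v Finₚ.≟ j)
  ... | true  | true  = ≡.refl
  ... | true  | false = ≡.refl
  ... | false | _     = ≡.refl
  exponents-replicate (suc c) u v i j = ≡.trans
    (≡.cong (single u v i j ℕ.+_) (exponents-replicate c u v i j))
    (combine (does (u Finₚ.≟ i)) (does (v Finₚ.≟ j)))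
    where
    combine : ∀ b b′ → (if b then (if b′ then 1 else 0) else 0) ℕ.+ (if b then (if b′ then c else 0) else 0)
                       ≡ (if b then (if b′ then suc c else 0) else 0)
    combine true  true  = ≡.refl
    combine true  false = ≡.refl
    combine false _     = ≡.refl

  ∑-indicatorʳ : ∀ {m} (i : Fin m) (f : Fin m → ℕ) →
                 Add.∑[ u < m ] (if does (u Finₚ.≟ i) then f u else 0) ≡ f i
  ∑-indicatorʳ {m} i f = ≡.trans
    (Add.sum-cong-≗ {m} λ u → ≡.cong (λ b → if b then f u else 0)
      (does-⇔ (mk⇔ ≡.sym ≡.sym) (u Finₚ.≟ i) (i Finₚ.≟ u)))
    (∑-indicator ℕₚ.+-0-commutativeMonoid i f)

  exponents-spell : ∀ t → exponents (spell t) ≗ t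
  exponents-spell t i j = ≡.trans
    (exponents-concat (λ u → concat (tabulate λ v → replicate (t u v) (u , v))) i j) (≡.trans
    (Add.sum-cong-≗ {n} λ u → ≡.trans (exponents-concat (λ v → replicate (t u v) (u , v)) i j)
      (≡.trans (Add.sum-cong-≗ {n} λ v → exponents-replicate (t u v) u v i j)
               (inner u (does (u Finₚ.≟ i)))))
    (∑-indicatorʳ i (λ u → t u j)))
    where
    inner : ∀ u b → Add.∑[ v < n ] (if b then (if does (v Finₚ.≟ j) then t u v else 0) else 0) ≡
                    (if b then t u j else 0)
    inner u true  = ∑-indicatorʳ j (t u)
    inner u false = Add.sum-replicate-zero n

  length-spell : ∀ t → length (spell t) ≡ degree t
  length-spell t = ≡.trans (≡.sym (degree-exponents (spell t))) (degree-≡ (exponents-spell t))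

  evalMonomial-spell : ∀ t A → evalMonomial t A ≈ word A (spell t)
  evalMonomial-spell t A = trans
    (sym (evalMonomial-≗ (exponents-spell t) A)) (evalMonomial-exponents (spell t) A)

  coeff-∷-≗ : ∀ {k t m} p → t ≗ m → coeff ((k , t) ∷ p) m ≈ k + coeff p m
  coeff-∷-≗ {k} {t} {m} p t≗m rewrite dec-true (t ≗? m) t≗m = refl

  coeff-∷-¬≗ : ∀ {k t m} p → ¬ t ≗ m → coeff ((k , t) ∷ p) m ≈ coeff p m
  coeff-∷-¬≗ {k} {t} {m} p t≉m rewrite dec-false (t ≗? m) t≉m = +-identityˡ _

  eval-++ : ∀ p q A → eval (p ++ q) A ≈ eval p A + eval q A
  eval-++ []            q A = sym (+-identityˡ _)
  eval-++ ((k , t) ∷ p) q A = trans (+-congˡ (eval-++ p q A)) (sym (+-assoc _ _ _))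

  private
    remove : Monomial → Polynomial → Polynomial
    remove t = filter (λ (_ , s) → ¬? (s ≗? t))

    remove-drop : ∀ {t k s} p → s ≗ t → remove t ((k , s) ∷ p) ≡ remove t p
    remove-drop {t} p s≗t = Listₚ.filter-reject (λ (_ , s) → ¬? (s ≗? t)) λ s≉t → s≉t s≗t

    remove-keep : ∀ {t k s} p → ¬ s ≗ t → remove t ((k , s) ∷ p) ≡ (k , s) ∷ remove t p
    remove-keep {t} p = Listₚ.filter-accept (λ (_ , s) → ¬? (s ≗? t))

    coeff-remove-≗ : ∀ t p {m} → m ≗ t → coeff (remove t p) m ≈ 0#
    coeff-remove-≗ t []            m≗t = refl
    coeff-remove-≗ t ((k , s) ∷ p) {m} m≗t = case s ≗? t of λ where
      (yes s≗t) → trans (reflexive (≡.cong (λ q → coeff q m) (remove-drop p s≗t))) (coeff-remove-≗ t p m≗t)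
      (no s≉t) → trans (reflexive (≡.cong (λ q → coeff q m) (remove-keep p s≉t)))
        (trans (coeff-∷-¬≗ (remove t p) λ s≗m → s≉t λ i j → ≡.trans (s≗m i j) (m≗t i j))
               (coeff-remove-≗ t p m≗t))

    coeff-remove-¬≗ : ∀ t p {m} → ¬ m ≗ t → coeff (remove t p) m ≈ coeff p m
    coeff-remove-¬≗ t []            m≉t = refl
    coeff-remove-¬≗ t ((k , s) ∷ p) {m} m≉t = case s ≗? t of λ where
      (yes s≗t) → trans (reflexive (≡.cong (λ q → coeff q m) (remove-drop p s≗t)))
        (trans (coeff-remove-¬≗ t p m≉t) (sym (coeff-∷-¬≗ p
          λ s≗m → m≉t λ i j → ≡.trans (≡.sym (s≗m i j)) (s≗t i j))))
      (no s≉t) → trans (reflexive (≡.cong (λ q → coeff q m) (remove-keep p s≉t)))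
        (+-congˡ (coeff-remove-¬≗ t p m≉t))

    eval-remove : ∀ t p A → eval p A ≈ coeff p t * evalMonomial t A + eval (remove t p) A
    eval-remove t []            A = sym (trans (+-identityʳ _) (zeroˡ _))
    eval-remove t ((k , s) ∷ p) A = case s ≗? t of λ where
      (yes s≗t) → begin
        k * evalMonomial s A + eval p A
          ≈⟨ +-cong (*-congˡ (evalMonomial-≗ s≗t A)) (eval-remove t p A) ⟩
        k * evalMonomial t A + (coeff p t * evalMonomial t A + eval (remove t p) A)
          ≈⟨ trans (sym (+-assoc _ _ _)) (+-congʳ (sym (distribʳ _ _ _))) ⟩
        (k + coeff p t) * evalMonomial t A + eval (remove t p) A
          ≈⟨ +-cong (*-congʳ (coeff-∷-≗ p s≗t))
                    (reflexive (≡.cong (λ q → eval q A) (remove-drop p s≗t))) ⟨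
        coeff ((k , s) ∷ p) t * evalMonomial t A + eval (remove t ((k , s) ∷ p)) A  ∎
      (no s≉t) → begin
        k * evalMonomial s A + eval p A
          ≈⟨ +-congˡ (eval-remove t p A) ⟩
        k * evalMonomial s A + (coeff p t * evalMonomial t A + eval (remove t p) A)
          ≈⟨ CommutativeSemigroupProperties.x∙yz≈y∙xz +-commutativeSemigroup _ _ _ ⟩
        coeff p t * evalMonomial t A + (k * evalMonomial s A + eval (remove t p) A)
          ≈⟨ +-cong (*-congʳ (coeff-∷-¬≗ p s≉t))
                    (reflexive (≡.cong (λ q → eval q A) (remove-keep p s≉t))) ⟨
        coeff ((k , s) ∷ p) t * evalMonomial t A + eval (remove t ((k , s) ∷ p)) A  ∎

    -- A list whose coefficients are all zero may still contain terms that cancel, and equality in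
    -- `K` is not assumed decidable. Removing every term with the monomial of the head shortens the
    -- list, and the coefficients remain zero.
    eval-≈0-bounded : ∀ m p → length p ≤ m → p ≈ᴾ 0ᴾ → ∀ A → eval p A ≈ 0#
    eval-≈0-bounded m       []                _         p≈0 A = refl
    eval-≈0-bounded (suc m) p@((k , t) ∷ p′) (s≤s |p′|) p≈0 A = begin
      eval p A                                          ≈⟨ eval-remove t p A ⟩
      coeff p t * evalMonomial t A + eval (remove t p) A
        ≈⟨ +-cong (trans (*-congʳ (coeff≈ p≈0 t)) (zeroˡ _))
             (eval-≈0-bounded m (remove t p) shorter (mk≈ᴾ removed) A) ⟩
      0# + 0#                                           ≈⟨ +-identityˡ 0# ⟩
      0#                                                ∎
      where
      shorter : length (remove t p) ≤ m
      shorter = ≡.subst (λ q → length q ≤ m) (≡.sym (remove-drop p′ λ _ _ → ≡.refl)) (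
        ℕₚ.≤-trans (Listₚ.length-filter (λ (_ , s) → ¬? (s ≗? t)) p′) |p′|)
      removed : ∀ m → coeff (remove t p) m ≈ 0#
      removed m = case m ≗? t of λ where
        (yes m≗t) → coeff-remove-≗ t p m≗t
        (no m≉t)  → trans (coeff-remove-¬≗ t p m≉t) (coeff≈ p≈0 m)

  eval-≈0 : ∀ {p} → p ≈ᴾ 0ᴾ → ∀ A → eval p A ≈ 0#
  eval-≈0 {p} = eval-≈0-bounded (length p) p ℕₚ.≤-refl

  module _ {q} {Q : Pred ℕ q} (Q? : Decidable Q) where

    filterDegree : Polynomial → Polynomial
    filterDegree = filter (λ (_ , t) → Q? (degree t))

    coeff-filterDegree : ∀ p m → coeff (filterDegree p) m ≈ when (does (Q? (degree m))) (coeff p m)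
    coeff-filterDegree []            m with does (Q? (degree m))
    ... | true  = refl
    ... | false = refl
    coeff-filterDegree ((k , t) ∷ p) m = case Q? (degree t) of λ where
        (yes q) → trans
          (reflexive (≡.cong (λ q → coeff q m) (Listₚ.filter-accept (λ (_ , t) → Q? (degree t)) q)))
          (trans (+-cong (sym (kept q)) (coeff-filterDegree p m)) (sym (when-+ b k₀ (coeff p m))))
        (no ¬q) → trans
          (reflexive (≡.cong (λ q → coeff q m) (Listₚ.filter-reject (λ (_ , t) → Q? (degree t)) ¬q)))
          (trans (coeff-filterDegree p m) (trans (sym (+-identityˡ _))
            (trans (+-congʳ (sym (dropped ¬q))) (sym (when-+ b k₀ (coeff p m))))))
      where
      b = does (Q? (degree m))
      k₀ = when (does (t ≗? m)) k
      when-0 : ∀ b → when b 0# ≈ 0#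
      when-0 true  = refl
      when-0 false = refl
      vanishing : ¬ t ≗ m → k₀ ≈ 0#
      vanishing t≉m = reflexive (≡.cong (λ b → when b k) (dec-false (t ≗? m) t≉m))
      kept : Q (degree t) → when b k₀ ≈ k₀
      kept q = case t ≗? m of λ where
        (yes t≗m) → reflexive (≡.cong (λ b → when b k₀)
          (dec-true (Q? (degree m)) (≡.subst Q (degree-≡ t≗m) q)))
        (no t≉m) → trans (when-cong b (vanishing t≉m)) (trans (when-0 b) (sym (vanishing t≉m)))
      dropped : ¬ Q (degree t) → when b k₀ ≈ 0#
      dropped ¬q = case t ≗? m of λ where
        (yes t≗m) → reflexive (≡.cong (λ b → when b k₀)
          (dec-false (Q? (degree m)) (¬q ∘ ≡.subst Q (≡.sym (degree-≡ t≗m)))))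
        (no t≉m) → trans (when-cong b (vanishing t≉m)) (when-0 b)

    filterDegree-cong : ∀ {p q} → p ≈ᴾ q → filterDegree p ≈ᴾ filterDegree q
    filterDegree-cong {p} {q} p≈q = mk≈ᴾ λ m → trans (coeff-filterDegree p m)
      (trans (when-cong _ (coeff≈ p≈q m)) (sym (coeff-filterDegree q m)))

    eval-filterDegree : ∀ p A → eval p A ≈
      eval (filterDegree p) A + eval (filter (λ (_ , t) → ¬? (Q? (degree t))) p) A
    eval-filterDegree []            A = sym (+-identityˡ 0#)
    eval-filterDegree ((k , t) ∷ p) A with Q? (degree t)
    ... | yes _ = trans (+-congˡ (eval-filterDegree p A)) (sym (+-assoc _ _ _))
    ... | no _  = trans (+-congˡ (eval-filterDegree p A))
                        (CommutativeSemigroupProperties.x∙yz≈y∙xz +-commutativeSemigroup _ _ _)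

  component-homogeneous : ∀ d p → Homogeneous d (component d p)
  component-homogeneous d p m m≢d = trans (coeff-filterDegree (ℕₚ._≟ d) p m)
    (reflexive (≡.cong (λ b → when b (coeff p m)) (dec-false (degree m ℕₚ.≟ d) m≢d)))

  component-of-homogeneous : ∀ d p → Homogeneous d p → component d p ≈ᴾ p
  component-of-homogeneous d p hom = mk≈ᴾ λ m → trans (coeff-filterDegree (ℕₚ._≟ d) p m) (go m)
    where
    go : ∀ m → when (does (degree m ℕₚ.≟ d)) (coeff p m) ≈ coeff p m
    go m = case degree m ℕₚ.≟ d of λ where
      (yes m≡d) → reflexive (≡.cong (λ b → when b (coeff p m)) (dec-true (degree m ℕₚ.≟ d) m≡d))
      (no m≢d)  → trans (reflexive (≡.cong (λ b → when b (coeff p m)) (dec-false (degree m ℕₚ.≟ d) m≢d)))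
                        (sym (hom m m≢d))

  component-all : ∀ d p → All (λ (_ , t) → degree t ≡ d) p → component d p ≡ p
  component-all d p = Listₚ.filter-all (λ (_ , t) → degree t ℕₚ.≟ d)

  component-none : ∀ d p → All (λ (_ , t) → degree t ≢ d) p → component d p ≡ []
  component-none d p = Listₚ.filter-none (λ (_ , t) → degree t ℕₚ.≟ d)

  component-++ : ∀ d p q → component d (p ++ q) ≡ component d p ++ component d q
  component-++ d = Listₚ.filter-++ (λ (_ , t) → degree t ℕₚ.≟ d)

  monomial : List (Fin n × Fin n) → Polynomial
  monomial w = (1# , exponents w) ∷ []

  sumᴾ : ∀ {m} → (Fin m → Polynomial) → Polynomial
  sumᴾ f = concat (tabulate f)

  coeff-sumᴾ : ∀ {m} (f : Fin m → Polynomial) t →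
    coeff (sumᴾ f) t ≈ Sum.sum +-commutativeMonoid (λ i → coeff (f i) t)
  coeff-sumᴾ {zero}  f t = refl
  coeff-sumᴾ {suc m} f t = trans (coeff-+ (f zero) (sumᴾ (f ∘ suc)) t) (+-congˡ (coeff-sumᴾ (f ∘ suc) t))

  eval-sumᴾ : ∀ {m} (f : Fin m → Polynomial) A →
    eval (sumᴾ f) A ≈ Sum.sum +-commutativeMonoid (λ i → eval (f i) A)
  eval-sumᴾ {zero}  f A = refl
  eval-sumᴾ {suc m} f A = trans (eval-++ (f zero) (sumᴾ (f ∘ suc)) A) (+-congˡ (eval-sumᴾ (f ∘ suc) A))

  All-sumᴾ : ∀ {m p} {P : Carrier × Monomial → Set p} (f : Fin m → Polynomial) →
             (∀ i → All P (f i)) → All P (sumᴾ f)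
  All-sumᴾ {zero}  f h = []
  All-sumᴾ {suc m} f h = Allₚ.++⁺ (h zero) (All-sumᴾ (f ∘ suc) (h ∘ suc))

  eval-monomial : ∀ w A → eval (monomial w) A ≈ word A w
  eval-monomial w A = trans (+-identityʳ _) (trans (*-identityˡ _) (evalMonomial-exponents w A))

  -- Multiplication by a monomial without the factor `1#` that `_*ᴾ_` would leave in each
  -- coefficient.
  timesWord : List (Fin n × Fin n) → Polynomial → Polynomial
  timesWord w = map (λ (k , t) → k , λ i j → exponents w i j ℕ.+ t i j)

  monomial-*ᴾ : ∀ w p → monomial w *ᴾ p ≈ᴾ timesWord w p
  monomial-*ᴾ w p = mk≈ᴾ (go p)
    where
    go : ∀ p m → coeff (monomial w *ᴾ p) m ≈ coeff (timesWord w p) m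
    go []            m = refl
    go ((k , t) ∷ p) m = +-cong (when-cong _ (*-identityˡ k)) (go p m)

  timesWord-monomial : ∀ w v → timesWord w (monomial v) ≈ᴾ monomial (v ++ w)
  timesWord-monomial w v = mk≈ᴾ λ m → +-congʳ (reflexive (≡.cong (λ b → when b 1#)
    (does-⇔ (mk⇔ (λ e i j → ≡.trans (≡.sym (eq i j)) (e i j)) (λ e i j → ≡.trans (eq i j) (e i j)))
      ((λ i j → exponents w i j ℕ.+ exponents v i j) ≗? m) (exponents (v ++ w) ≗? m))))
    where
    eq : ∀ i j → exponents w i j ℕ.+ exponents v i j ≡ exponents (v ++ w) i j
    eq i j = ≡.trans (ℕₚ.+-comm (exponents w i j) _) (≡.sym (exponents-++ v w i j))

  timesWord-++ : ∀ w p q → timesWord w (p ++ q) ≡ timesWord w p ++ timesWord w q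
  timesWord-++ w = Listₚ.map-++ _

  timesWord-sumᴾ : ∀ {m} w (f : Fin m → Polynomial) → timesWord w (sumᴾ f) ≡ sumᴾ (timesWord w ∘ f)
  timesWord-sumᴾ {zero}  w f = ≡.refl
  timesWord-sumᴾ {suc m} w f = ≡.trans (timesWord-++ w (f zero) _)
    (≡.cong (timesWord w (f zero) ++_) (timesWord-sumᴾ w (f ∘ suc)))

  ++-cong : ∀ {p p′ q q′} → p ≈ᴾ p′ → q ≈ᴾ q′ → p +ᴾ q ≈ᴾ p′ +ᴾ q′
  ++-cong {p} {p′} {q} {q′} p≈ q≈ = mk≈ᴾ λ m → trans (coeff-+ p q m)
    (trans (+-cong (coeff≈ p≈ m) (coeff≈ q≈ m)) (sym (coeff-+ p′ q′ m)))

  sumᴾ-cong : ∀ {m} {f g : Fin m → Polynomial} → (∀ i → f i ≈ᴾ g i) → sumᴾ f ≈ᴾ sumᴾ g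
  sumᴾ-cong {zero}  f≈g = ≈ᴾ-reflexive ≡.refl
  sumᴾ-cong {suc m} {f} {g} f≈g = 
    ++-cong {f zero} {g zero} {sumᴾ (f ∘ suc)} {sumᴾ (g ∘ suc)} (f≈g zero) (sumᴾ-cong (f≈g ∘ suc))

-- The two realisations

module Evaluation (K : CommutativeRing 0ℓ 0ℓ) (n : ℕ) (inv : CharacteristicZero.InvertibleNumbers K)
                  (a k : ℕ) (n≡a+2k : n ≡ a ℕ.+ (k ℕ.+ k)) where
  open CommutativeRing K hiding (zero)
  open CharacteristicZero K
  open OrbitHarmonics K n
  open Monomials K n
  open Reduction K n inv a k n≡a+2k
  open SetoidReasoning setoid
  private
    module Σ⁺ = SemiringSum semiring
    module Add = Sum ℕₚ.+-0-commutativeMonoid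

  word-↭ : ∀ A {w w′} → w ↭ w′ → word A w ≈ word A w′
  word-↭ A _↭_.refl        = refl
  word-↭ A (prep x p)      = *-congˡ (word-↭ A p)
  word-↭ A (swap x y p)    = trans (*-congˡ (*-congˡ (word-↭ A p)))
    (CommutativeSemigroupProperties.x∙yz≈y∙xz *-commutativeSemigroup _ _ _)
  word-↭ A (_↭_.trans p q) = trans (word-↭ A p) (word-↭ A q)

  sum-indicators : ∀ {m} (b : Fin m → Bool) →
    Σ⁺.sum (λ i → if b i then 1# else 0#) ≈ fromℕ (Add.sum (λ i → if b i then 1 else 0))
  sum-indicators {zero}  b = refl
  sum-indicators {suc m} b with b zero
  ... | true  = +-congˡ (sum-indicators (b ∘ suc))
  ... | false = trans (+-identityˡ _) (sum-indicators (b ∘ suc))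

  module _ {A : Matrix} (A∈ : 𝓜 a A) where
    private
      w = proj₁ A∈
      w² = proj₁ (proj₂ A∈)
      fixed = proj₁ (proj₂ (proj₂ A∈))
      A≈ = proj₂ (proj₂ (proj₂ A∈))

    entry-hit : ∀ {i j} → w ⟨$⟩ʳ i ≡ j → A i j ≈ 1#
    entry-hit {i} {j} eq = trans (A≈ i j)
      (reflexive (≡.cong (λ b → if b then 1# else 0#) (dec-true (w ⟨$⟩ʳ i Finₚ.≟ j) eq)))

    entry-miss : ∀ {i j} → w ⟨$⟩ʳ i ≢ j → A i j ≈ 0#
    entry-miss {i} {j} neq = trans (A≈ i j)
      (reflexive (≡.cong (λ b → if b then 1# else 0#) (dec-false (w ⟨$⟩ʳ i Finₚ.≟ j) neq)))

    entry-conflict : ∀ i {j l} → j ≢ l → ∀ x → A i j * (A i l * x) ≈ 0#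
    entry-conflict i {j} {l} j≢l x = case w ⟨$⟩ʳ i Finₚ.≟ j of λ where
      (yes eq) → trans
        (*-congˡ (trans (*-congʳ (entry-miss (j≢l ∘ ≡.trans (≡.sym eq)))) (zeroˡ x))) (zeroʳ _)
      (no neq) → trans (*-congʳ (entry-miss neq)) (zeroˡ _)

    entry-square : ∀ i j x → A i j * (A i j * x) ≈ A i j * x
    entry-square i j x = case w ⟨$⟩ʳ i Finₚ.≟ j of λ where
      (yes eq) → trans (*-congʳ (entry-hit eq)) (*-identityˡ _)
      (no neq) → trans (trans (*-congʳ (entry-miss neq)) (zeroˡ _))
                       (sym (trans (*-congʳ (entry-miss neq)) (zeroˡ _)))

    entry-transpose : ∀ i j → A i j ≈ A j i
    entry-transpose i j = trans (A≈ i j) (trans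
      (reflexive (≡.cong (λ b → if b then 1# else 0#)
        (does-⇔ (mk⇔ (flip i j) (flip j i)) (_ Finₚ.≟ _) (_ Finₚ.≟ _))))
      (sym (A≈ j i)))
      where
      flip : ∀ i j → w ⟨$⟩ʳ i ≡ j → w ⟨$⟩ʳ j ≡ i
      flip i j ≡.refl = w² i

    entry-row : ∀ i → Σ⁺.sum (λ j → A i j) ≈ 1#
    entry-row i = trans (Σ⁺.sum-cong-≋ {n} (A≈ i)) (∑-indicator +-commutativeMonoid (w ⟨$⟩ʳ i) (λ _ → 1#))

    entry-trace : Σ⁺.sum (λ i → A i i) ≈ fromℕ a
    entry-trace = trans (Σ⁺.sum-cong-≋ {n} λ i → A≈ i i)
      (trans (sum-indicators (λ i → does (w ⟨$⟩ʳ i Finₚ.≟ i))) (reflexive (≡.cong fromℕ fixed)))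

    evaluation : Realisation
    evaluation = record
      { M = TensorUnit.⟨module⟩ {R = K}
      ; h = 1#
      ; h-idem = *-identityˡ 1#
      ; φ = word A
      ; φ-↭ = word-↭ A
      ; φ-conflict = λ i v j≢l → entry-conflict i j≢l (word A v)
      ; φ-square = λ i j v → trans (entry-square i j (word A v)) (sym (*-identityˡ _))
      ; φ-transpose = λ i j v → *-congʳ (entry-transpose i j)
      ; φ-row = λ i v → trans (sym (Σ⁺.*-distribʳ-sum (word A v) (A i))) (*-congʳ (entry-row i))
      ; φ-trace = λ v → trans (sym (Σ⁺.*-distribʳ-sum (word A v) (λ i → A i i)))
          (trans (*-congʳ entry-trace) (*-congˡ (sym (*-identityˡ _))))
      }

module TopDegree (K : CommutativeRing 0ℓ 0ℓ) (n : ℕ) (inv : CharacteristicZero.InvertibleNumbers K)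
                 (nontrivial : CharacteristicZero.Nontrivial K) (i₀ : Fin n)
                 (a k : ℕ) (n≡a+2k : n ≡ a ℕ.+ (k ℕ.+ k)) where
  open CommutativeRing K hiding (zero)
  open CharacteristicZero K
  open OrbitHarmonics K n
  open Monomials K n
  open Evaluation K n inv a k n≡a+2k
  open SetoidReasoning setoid
  private
    module Σ⁺ = SemiringSum semiring

  N : Polynomial → Set
  N = gr (𝐈 (𝓜 a))

  -- The generators of `gr` are components at the exact degree of a polynomial, so a leading form
  -- must be shown nonzero before it counts. The nonvanishing statements that follow rest on
  -- `nontrivial`.
  top∈N : ∀ d top low → All (λ (_ , t) → degree t ≡ d) top → All (λ (_ , t) → degree t < d) low →
          𝐈 (𝓜 a) (top +ᴾ low) → ¬ top ≈ᴾ 0ᴾ → N top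
  top∈N d top low top≡d low<d vanishing nonzero = gen
    ( top +ᴾ low , d , vanishing
    , ( (λ e d<e → ≈ᴾ-reflexive (component-none e _ (Allₚ.++⁺
          (All.map (λ ≡d ≡e → ℕₚ.<-irrefl (≡.trans (≡.sym ≡d) ≡e) d<e) top≡d)
          (All.map (λ <d ≡e → ℕₚ.<-asym d<e (≡.subst (ℕ._< d) ≡e <d)) low<d))))
      , λ ≈0 → nonzero (≈ᴾ-trans (≈ᴾ-reflexive (≡.sym top≡)) ≈0) )
    , ≡.sym top≡ )
    where
    top≡ : component d (top +ᴾ low) ≡ top
    top≡ = ≡.trans (component-++ d top low) (≡.trans
      (≡.cong₂ _++_ (component-all d top top≡d) (component-none d low (All.map ℕₚ.<⇒≢ low<d)))
      (Listₚ.++-identityʳ top))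

  term : Carrier → List (Fin n × Fin n) → Polynomial
  term c w = (c , exponents w) ∷ []

  eval-term : ∀ c w A → eval (term c w) A ≈ c * word A w
  eval-term c w A = trans (+-identityʳ _) (*-congˡ (evalMonomial-exponents w A))

  monomial≉0 : ∀ w → ¬ monomial w ≈ᴾ 0ᴾ
  monomial≉0 w eq = nontrivial (trans
    (sym (trans (coeff-∷-≗ {t = exponents w} [] λ _ _ → ≡.refl) (+-identityʳ 1#)))
    (coeff≈ eq (exponents w)))

  exponents-injective : ∀ {e e′ : Fin n × Fin n} → exponents (e ∷ []) ≗ exponents (e′ ∷ []) → e ≡ e′
  exponents-injective {e} {e′} eq = case e ≟ᴱ e′ of λ where
    (yes e≡e′) → e≡e′
    (no e≢e′) → ⊥-elim (exponents-∈ {w = e ∷ []} (here ≡.refl)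
      (≡.trans (eq _ _) (exponents-∉ (e′ ∷ []) λ { (here e≡) → e≢e′ e≡ })))

  -- No other summand has the monomial of index `i`, so its coefficient is one.
  sumᴾ≉0 : (f : Fin n → Fin n × Fin n) (i : Fin n) → (∀ j → f i ≡ f j → i ≡ j) →
           ¬ sumᴾ (λ j → monomial (f j ∷ [])) ≈ᴾ 0ᴾ
  sumᴾ≉0 f i inj eq = nontrivial (begin
    1#
      ≈⟨ ∑-indicator +-commutativeMonoid i (λ _ → 1#) ⟨
    Σ⁺.sum (λ j → if does (i Finₚ.≟ j) then 1# else 0#)
      ≈⟨ Σ⁺.sum-cong-≋ {n} entry ⟨
    Σ⁺.sum (λ j → coeff (monomial (f j ∷ [])) (exponents (f i ∷ [])))
      ≈⟨ coeff-sumᴾ (λ j → monomial (f j ∷ [])) (exponents (f i ∷ [])) ⟨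
    coeff (sumᴾ (λ j → monomial (f j ∷ []))) (exponents (f i ∷ []))
      ≈⟨ coeff≈ eq _ ⟩
    0#  ∎)
    where
    entry : ∀ j → coeff (monomial (f j ∷ [])) (exponents (f i ∷ [])) ≈
                  (if does (i Finₚ.≟ j) then 1# else 0#)
    entry j with i Finₚ.≟ j
    ... | yes ≡.refl = trans (coeff-∷-≗ {t = exponents (f i ∷ [])} [] λ _ _ → ≡.refl) (+-identityʳ 1#)
    ... | no i≢j = coeff-∷-¬≗ {k = 1#} {t = exponents (f j ∷ [])} []
      λ eq → i≢j (inj j (≡.sym (exponents-injective eq)))

  cancel-values : ∀ x y → x ≈ y → x + - 1# * y ≈ 0#
  cancel-values x y x≈y = trans (+-cong x≈y (RingProperties.-1*x≈-x ring y)) (-‿inverseʳ y)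

  conflict∈N : ∀ i {j l} → j ≢ l → N (monomial ((i , j) ∷ (i , l) ∷ []))
  conflict∈N i {j} {l} j≢l = top∈N 2 _ [] (degree-exponents w ∷ []) []
    (λ A A∈ → trans (eval-monomial w A) (entry-conflict A∈ i j≢l 1#)) (monomial≉0 w)
    where w = (i , j) ∷ (i , l) ∷ []

  square∈N : ∀ i j → N (monomial ((i , j) ∷ (i , j) ∷ []))
  square∈N i j = top∈N 2 _ (term (- 1#) v) (degree-exponents w ∷ [])
    (s≤s (ℕₚ.≤-reflexive (degree-exponents v)) ∷ [])
    (λ A A∈ → trans (eval-++ (monomial w) (term (- 1#) v) A)
      (trans (+-cong (eval-monomial w A) (eval-term (- 1#) v A))
             (cancel-values _ _ (entry-square A∈ i j 1#))))
    (monomial≉0 w)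
    where
    v w : List (Fin n × Fin n)
    v = (i , j) ∷ []
    w = (i , j) ∷ (i , j) ∷ []

  transpose∈N : ∀ {i j} → i ≢ j → N (monomial ((i , j) ∷ []) ⊝ monomial ((j , i) ∷ []))
  transpose∈N {i} {j} i≢j = top∈N 1 _ [] (degree-exponents v ∷ degree-exponents w ∷ []) []
    (λ A A∈ → trans (reflexive (≡.cong (λ p → eval p A) (Listₚ.++-identityʳ (monomial v ⊝ monomial w))))
      (trans (eval-++ (monomial v) (term (- 1#) w) A)
      (trans (+-cong (eval-monomial v A) (eval-term (- 1#) w A))
             (cancel-values _ _ (*-congʳ (entry-transpose A∈ i j))))))
    (λ eq → nontrivial (trans (sym (trans
      (coeff-∷-≗ {t = exponents v} (term (- 1#) w) λ _ _ → ≡.refl)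
      (trans (+-congˡ (coeff-∷-¬≗ {k = - 1#} {t = exponents w} []
               λ eq → i≢j (≡.sym (≡.cong proj₁ (exponents-injective {j , i} {i , j} eq)))))
             (+-identityʳ 1#))))
      (coeff≈ eq (exponents v))))
    where
    v w : List (Fin n × Fin n)
    v = (i , j) ∷ []
    w = (j , i) ∷ []

  -- The value `c` only enters through a constant term of lower degree. For the trace, this is how
  -- the number of fixed points drops out.
  linear-form∈N : (f : Fin n → Fin n × Fin n) (i : Fin n) → (∀ j → f i ≡ f j → i ≡ j) → ∀ c →
    (∀ {A} → 𝓜 a A → Σ⁺.sum (λ j → word A (f j ∷ [])) ≈ c) → N (sumᴾ (λ j → monomial (f j ∷ [])))
  linear-form∈N f i inj c value = top∈N 1 _ (term (- c) [])
    (All-sumᴾ (λ j → monomial (f j ∷ [])) λ j → degree-exponents (f j ∷ []) ∷ [])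
    (s≤s (ℕₚ.≤-reflexive (degree-exponents [])) ∷ [])
    (λ A A∈ → begin
      eval (sumᴾ (λ j → monomial (f j ∷ [])) +ᴾ term (- c) []) A
        ≈⟨ eval-++ (sumᴾ (λ j → monomial (f j ∷ []))) (term (- c) []) A ⟩
      eval (sumᴾ (λ j → monomial (f j ∷ []))) A + eval (term (- c) []) A
        ≈⟨ +-cong (trans (eval-sumᴾ (λ j → monomial (f j ∷ [])) A)
             (trans (Σ⁺.sum-cong-≋ {n} λ j → eval-monomial (f j ∷ []) A) (value A∈)))
             (trans (eval-term (- c) [] A) (*-identityʳ _)) ⟩
      c - c  ≈⟨ -‿inverseʳ c ⟩
      0#     ∎)
    (sumᴾ≉0 f i inj)

  row∈N : ∀ i → N (sumᴾ (λ j → monomial ((i , j) ∷ [])))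
  row∈N i = linear-form∈N (λ j → i , j) i (λ j eq → ≡.cong proj₂ eq) 1#
    (λ A∈ → trans (Σ⁺.sum-cong-≋ {n} λ j → *-identityʳ _) (entry-row A∈ i))

  trace∈N : N (sumᴾ (λ i → monomial ((i , i) ∷ [])))
  -- The vertex `i₀` provides a diagonal variable, hence a nonzero form.
  trace∈N = linear-form∈N (λ i → i , i) i₀ (λ j eq → ≡.cong proj₁ eq) (fromℕ a)
    (λ A∈ → trans (Σ⁺.sum-cong-≋ {n} λ i → *-identityʳ _) (entry-trace A∈))

  timesWord∈N : ∀ w {p} → N p → N (timesWord w p)
  timesWord∈N w {p} Np = ≈-∈ (monomial-*ᴾ w p) (*-∈ (monomial w) Np)

  component∈N : ∀ e d p → All (λ (_ , t) → degree t ≡ d) p → N p → N (component e p)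
  component∈N e d p p≡d Np = case d ℕₚ.≟ e of λ where
    (yes ≡.refl) → ≡.subst N (≡.sym (component-all e p p≡d)) Np
    (no d≢e) → ≡.subst N (≡.sym (component-none e p
      (All.map (λ ≡d ≡e → d≢e (≡.trans (≡.sym ≡d) ≡e)) p≡d))) 0∈

  sumᴾ-shift : ∀ w (f : Fin n → Fin n × Fin n) →
    timesWord w (sumᴾ (λ j → monomial (f j ∷ []))) ≈ᴾ sumᴾ (λ j → monomial (f j ∷ w))
  sumᴾ-shift w f = ≈ᴾ-trans (≈ᴾ-reflexive (timesWord-sumᴾ w (λ j → monomial (f j ∷ []))))
    (sumᴾ-cong {n} λ j → timesWord-monomial w (f j ∷ []))

  module Quotient (e : ℕ) where
    R-e = R-module (𝓜 a) e
    open Module R-e using (≈ᴹ-trans; ≈ᴹ-sym; ≈ᴹ-refl; 0ᴹ; *ₗ-zeroˡ; *ₗ-zeroʳ; *ₗ-congˡ; _*ₗ_; _≈ᴹ_; Carrierᴹ)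
    open ModuleSums R-e using (sum)

    -- Projecting to degree `e` sends words of any other length to zero; a realisation must be
    -- defined on words of every length.
    class : List (Fin n × Fin n) → Carrierᴹ
    class w = component e (monomial w) , component-homogeneous e (monomial w)

    N⇒∼0 : ∀ p → N (proj₁ p) → p ≈ᴹ 0ᴹ
    N⇒∼0 (p , _) Np = mk∼ (≈-∈ (≈ᴾ-reflexive (≡.sym (Listₚ.++-identityʳ p))) Np)

    ∼0⇒N : ∀ p → p ≈ᴹ 0ᴹ → N (proj₁ p)
    ∼0⇒N (p , _) p∼0 = ≈-∈ (≈ᴾ-reflexive (Listₚ.++-identityʳ p)) (difference p∼0)

    class∼0 : ∀ w → N (monomial w) → class w ≈ᴹ 0ᴹ
    class∼0 w Nw = N⇒∼0 (class w) (component∈N e (length w) (monomial w) (degree-exponents w ∷ []) Nw)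

    monomial-multiple∈N : ∀ v w → N (monomial v) → N (monomial (v ++ w))
    monomial-multiple∈N v w Nv = ≈-∈ (timesWord-monomial w v) (timesWord∈N w Nv)

    proj₁-sum : ∀ {m} (f : Fin m → Carrierᴹ) → proj₁ (sum f) ≡ sumᴾ (λ j → proj₁ (f j))
    proj₁-sum {zero}  f = ≡.refl
    proj₁-sum {suc m} f = ≡.cong (proj₁ (f zero) ++_) (proj₁-sum (f ∘ suc))

    component-sumᴾ : ∀ {m} (f : Fin m → Polynomial) → sumᴾ (λ j → component e (f j)) ≡ component e (sumᴾ f)
    component-sumᴾ {zero}  f = ≡.refl
    component-sumᴾ {suc m} f = ≡.trans (≡.cong (component e (f zero) ++_) (component-sumᴾ (f ∘ suc)))
      (≡.sym (component-++ e (f zero) (sumᴾ (f ∘ suc))))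

    class-sum∼0 : ∀ w (f : Fin n → Fin n × Fin n) → N (sumᴾ (λ j → monomial (f j ∷ []))) →
                  sum (λ j → class (f j ∷ w)) ≈ᴹ 0ᴹ
    class-sum∼0 w f Nf = N⇒∼0 (sum (λ j → class (f j ∷ w)))
      (≡.subst N (≡.sym (≡.trans (proj₁-sum (λ j → class (f j ∷ w)))
                                 (component-sumᴾ (λ j → monomial (f j ∷ w)))))
        (component∈N e (suc (length w)) _
          (All-sumᴾ (λ j → monomial (f j ∷ w)) λ j → degree-exponents (f j ∷ w) ∷ [])
          (≈-∈ (sumᴾ-shift w f) (timesWord∈N w Nf))))

    class-transpose : ∀ i j w → class ((i , j) ∷ w) ≈ᴹ class ((j , i) ∷ w)
    class-transpose i j w = case i Finₚ.≟ j of λ where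
        -- Here the form `x_{ij} - x_{ji}` is zero and so yields no generator, but the two sides
        -- coincide.
        (yes ≡.refl) → ≈ᴹ-refl
        (no i≢j) → mk∼ (case suc (length w) ℕₚ.≟ e of λ where
          (yes ≡.refl) → ≡.subst N (≡.sym (≡.cong₂ _⊝_
              (component-all e (monomial v) (degree-exponents v ∷ []))
              (component-all e (monomial v′) (degree-exponents v′ ∷ []))))
            (≈-∈ multiple (timesWord∈N w (transpose∈N i≢j)))
          (no ≢e) → ≡.subst N (≡.sym (≡.cong₂ _⊝_
              (component-none e (monomial v) ((λ ≡e → ≢e (≡.trans (≡.sym (degree-exponents v)) ≡e)) ∷ []))
              (component-none e (monomial v′) ((λ ≡e → ≢e (≡.trans (≡.sym (degree-exponents v′)) ≡e)) ∷ []))))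
            0∈)
      where
      v v′ : List (Fin n × Fin n)
      v = (i , j) ∷ w
      v′ = (j , i) ∷ w
      multiple : timesWord w (monomial ((i , j) ∷ []) ⊝ monomial ((j , i) ∷ [])) ≈ᴾ
                 monomial v ⊝ monomial v′
      multiple = ++-cong {timesWord w (monomial ((i , j) ∷ []))} {monomial v}
        (timesWord-monomial w ((i , j) ∷ []))
        (mk≈ᴾ λ m → begin
          coeff (-ᴾ timesWord w (monomial ((j , i) ∷ []))) m
            ≈⟨ coeff-neg (timesWord w (monomial ((j , i) ∷ []))) m ⟩
          - coeff (timesWord w (monomial ((j , i) ∷ []))) m
            ≈⟨ -‿cong (coeff≈ (timesWord-monomial w ((j , i) ∷ [])) m) ⟩
          - coeff (monomial v′) m ≈⟨ coeff-neg (monomial v′) m ⟨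
          coeff (-ᴾ monomial v′) m ∎)

    class-↭ : ∀ {w w′} → w ↭ w′ → class w ≈ᴹ class w′
    class-↭ {w} {w′} p = ≈⇒∼ (𝓜 a) e
      (coeff≈ (filterDegree-cong (ℕₚ._≟ e) {monomial w} {monomial w′} (mk≈ᴾ λ m →
      +-congʳ (reflexive (≡.cong (λ b → when b 1#) (does-⇔
        (mk⇔ (λ eq i j → ≡.trans (≡.sym (exponents-↭ p i j)) (eq i j))
             (λ eq i j → ≡.trans (exponents-↭ p i j) (eq i j)))
        (exponents w ≗? m) (exponents w′ ≗? m)))))))

    -- With h = 0 the relations no longer involve the number of fixed points, so b need not be a.
    quotient : ∀ b l (n≡b+2l : n ≡ b ℕ.+ (l ℕ.+ l)) → Reduction.Realisation K n inv b l n≡b+2l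
    quotient b l _ = record
      { M = R-e
      ; h = 0#
      ; h-idem = zeroˡ 0#
      ; φ = class
      ; φ-↭ = class-↭
      ; φ-conflict = λ i {j} {l} w j≢l → class∼0 ((i , j) ∷ (i , l) ∷ w)
          (monomial-multiple∈N ((i , j) ∷ (i , l) ∷ []) w (conflict∈N i j≢l))
      ; φ-square = λ i j w → ≈ᴹ-trans (class∼0 ((i , j) ∷ (i , j) ∷ w)
          (monomial-multiple∈N ((i , j) ∷ (i , j) ∷ []) w (square∈N i j))) (≈ᴹ-sym (*ₗ-zeroˡ _))
      ; φ-transpose = class-transpose
      ; φ-row = λ i w → ≈ᴹ-trans (class-sum∼0 w (λ j → i , j) (row∈N i)) (≈ᴹ-sym (*ₗ-zeroˡ (class w)))
      ; φ-trace = λ w → ≈ᴹ-trans (class-sum∼0 w (λ i → i , i) trace∈N)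
          (≈ᴹ-sym (≈ᴹ-trans (*ₗ-congˡ (*ₗ-zeroˡ (class w))) (*ₗ-zeroʳ (fromℕ b))))
      }

-- Comparison of the graded ideals

module Inclusion (K : CommutativeRing 0ℓ 0ℓ) (n : ℕ) (inv : CharacteristicZero.InvertibleNumbers K)
                 (nontrivial : CharacteristicZero.Nontrivial K) (i₀ : Fin n)
                 (a k : ℕ) (n≡a+2k : n ≡ a ℕ.+ (k ℕ.+ k))
                 (a′ k′ : ℕ) (n≡a′+2k′ : n ≡ a′ ℕ.+ (k′ ℕ.+ k′)) where
  open CommutativeRing K hiding (zero)
  open CharacteristicZero K
  open OrbitHarmonics K n
  open Monomials K n
  open Vanishing K n inv using (Edges; Symmetric; Homogeneous-+; Homogeneous-*; Homogeneous-0; vanish)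
  open MatchingPolynomials K n inv
  open Reduction K n inv a k n≡a+2k
  open Evaluation K n inv a k n≡a+2k
  open TopDegree K n inv nontrivial i₀ a′ k′ n≡a′+2k′
  open SetoidReasoning setoid

  -- Elements carry a homogeneity proof, but their equality only looks at the polynomials.
  retarget : ∀ {e} {p q r : R-Carrier (𝓜 a′) e} → proj₁ p ≡ proj₁ q →
             _∼_ (𝓜 a′) e q r → _∼_ (𝓜 a′) e p r
  retarget {r = r} eq q∼r = mk∼ (≡.subst (λ p → N (p ⊝ proj₁ r)) (≡.sym eq) (difference q∼r))

  -- `value` is read on the locus of `a` and `top` in the quotient for `a′`. Sharing one `element`
  -- between them is what turns vanishing on the first locus into membership in the second graded
  -- ideal.
  record Reduct (e : ℕ) (f : Polynomial) : Set₁ where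
    open Quotient e
    field
      element : Element
      spanned : InSpan e element
      top     : _∼_ (𝓜 a′) e (component e f , component-homogeneous e f) (element (quotient a k n≡a+2k))
      value   : ∀ {A} (A∈ : 𝓜 a A) → eval (filterDegree (ℕₚ._≤? e) f) A ≈ element (evaluation A∈)

  reduct : ∀ e → e ≤ k → ∀ f → Reduct e f
  reduct e e≤k [] = record
    { element = 𝟘
    ; spanned = span-𝟘
    ; top     = ≈⇒∼ (𝓜 a′) e λ _ → refl
    ; value   = λ _ → refl
    }
  reduct e e≤k ((c , t) ∷ f) = case ℕₚ.<-cmp (degree t) e of λ where
      -- A term of lower degree is raised with a factor `h`: its value on the locus is kept, and it
      -- is zero in the quotient, just as it is missing from the component of degree `e`.
      (tri< t<e t≢e _) → record
        { element = c ⊡ homogenised [ w ] ⊞ element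
        ; spanned = span-⊞ (span-⊡ c (lower t<e)) spanned
        ; top     = retarget (Listₚ.filter-reject (λ (_ , t) → degree t ℕₚ.≟ e) t≢e)
            (≈ᴹ-trans top (≈ᴹ-sym (≈ᴹ-trans
              (+ᴹ-congʳ (≈ᴹ-trans (*ₗ-congˡ (*ₗ-zeroˡ (class w))) (*ₗ-zeroʳ c))) (+ᴹ-identityˡ _))))
        ; value   = λ A∈ → trans (kept (ℕₚ.<⇒≤ t<e) _) (+-cong
            (*-congˡ (trans (evalMonomial-spell t _) (sym (*-identityˡ _)))) (value A∈))
        }
      (tri≈ _ t≡e _) → record
        { element = c ⊡ [ w ] ⊞ element
        ; spanned = span-⊞ (span-⊡ c (≡.subst (λ e → InSpan e [ w ]) (≡.trans (length-spell t) t≡e)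
            (span-word w (ℕₚ.≤-trans (ℕₚ.≤-reflexive (≡.trans (length-spell t) t≡e)) e≤k)))) spanned
        ; top     = retarget {q = leading t≡e +ᴹ (component e f , component-homogeneous e f)}
            (Listₚ.filter-accept (λ (_ , t) → degree t ℕₚ.≟ e) t≡e)
            (+ᴹ-cong (leading∼ t≡e) top)
        ; value   = λ A∈ → trans (kept (ℕₚ.≤-reflexive t≡e) _) (+-cong
            (*-congˡ (evalMonomial-spell t _)) (value A∈))
        }
      (tri> t≮e t≢e e<t) → record
        { element = element
        ; spanned = spanned
        ; top     = retarget (Listₚ.filter-reject (λ (_ , t) → degree t ℕₚ.≟ e) t≢e) top
        ; value   = λ A∈ → trans (reflexive (≡.cong (λ p → eval p _)
            (Listₚ.filter-reject (λ (_ , t) → degree t ℕₚ.≤? e) (ℕₚ.<⇒≱ e<t)))) (value A∈)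
        }
    where
    open Quotient e
    open Reduct (reduct e e≤k f)
    open Module R-e using
      ( Carrierᴹ; _≈ᴹ_; _+ᴹ_; _*ₗ_; ≈ᴹ-trans; ≈ᴹ-sym; +ᴹ-cong; +ᴹ-congʳ; +ᴹ-identityˡ
      ; *ₗ-congˡ; *ₗ-zeroˡ; *ₗ-zeroʳ )
    w = spell t
    kept : degree t ≤ e → ∀ A → eval (filterDegree (ℕₚ._≤? e) ((c , t) ∷ f)) A ≈
           c * evalMonomial t A + eval (filterDegree (ℕₚ._≤? e) f) A
    kept t≤e A = reflexive (≡.cong (λ p → eval p A)
      (Listₚ.filter-accept (λ (_ , t) → degree t ℕₚ.≤? e) t≤e))
    lower : degree t < e → InSpan e (homogenised [ w ])
    lower t<e with o , t+o≡e ← ℕₚ.m≤n⇒∃[o]m+o≡n t<e =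
      ≡.subst (λ e → InSpan e (homogenised [ w ])) size
        (span-lower o w (ℕₚ.≤-trans (ℕₚ.≤-reflexive size) e≤k))
      where
      size : suc o ℕ.+ length w ≡ e
      size = ≡.trans (≡.cong (suc o ℕ.+_) (length-spell t))
        (≡.trans (≡.cong suc (ℕₚ.+-comm o (degree t))) t+o≡e)
    leading : degree t ≡ e → Carrierᴹ
    leading t≡e = (c , t) ∷ [] , λ m m≢e →
      coeff-∷-¬≗ {k = c} {t = t} [] λ t≗m → m≢e (≡.trans (≡.sym (degree-≡ t≗m)) t≡e)
    leading∼ : ∀ t≡e → leading t≡e ≈ᴹ c *ₗ class w
    leading∼ t≡e = ≈⇒∼ (𝓜 a′) e λ m → begin
      when (does (t ≗? m)) c + 0#
        ≈⟨ trans (+-identityʳ _) (reflexive (≡.cong (λ b → when b c) (does-⇔ (mk⇔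
             (λ eq i j → ≡.trans (exponents-spell t i j) (eq i j))
             (λ eq i j → ≡.trans (≡.sym (exponents-spell t i j)) (eq i j)))
             (t ≗? m) (exponents w ≗? m)))) ⟩
      when (does (exponents w ≗? m)) c
        ≈⟨ trans (when-cong _ (sym (*-identityʳ c))) (when-* _ c 1#) ⟩
      c * when (does (exponents w ≗? m)) 1#
        ≈⟨ *-congˡ (+-identityʳ _) ⟨
      c * coeff (monomial w) m
        ≈⟨ *-congˡ (reflexive (≡.cong (λ p → coeff p m)
             (component-all e (monomial w) (≡.trans (≡.trans (degree-exponents w) (length-spell t)) t≡e ∷ [])))) ⟨
      c * coeff (component e (monomial w)) m
        ≈⟨ coeff-const c (component e (monomial w)) m ⟨
      coeff (const c *ᴾ component e (monomial w)) m  ∎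

  GoodTerms : ℕ → Terms → Set
  GoodTerms e = All (λ (_ , S) → OrderedMatching e S)

  values : Terms → Edges → Carrier
  values []            P = 0#
  values ((c , S) ∷ T) P = c * weight S P + values T P

  values-symmetric : ∀ T → Symmetric (values T)
  values-symmetric []            p = refl
  values-symmetric ((c , S) ∷ T) p = +-cong (*-congˡ (weight-symmetric S p)) (values-symmetric T p)

  values-homogeneous : ∀ {e T} → GoodTerms e T → Vanishing.Homogeneous K n inv e (values T)
  values-homogeneous {e} []                = Homogeneous-0 e
  values-homogeneous {e} {(c , S) ∷ T} (good ∷ all) = Homogeneous-+ e
    (Homogeneous-* e c (weight-homogeneous e S (OrderedMatching.size good) (OrderedMatching.unique good)))
    (values-homogeneous all)

  involution∈𝓜 : ∀ P → length P ≡ k → (uniq : Unique (vertices P)) →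
    𝓜 a (permutationMatrix (matchingInvolution P uniq))
  involution∈𝓜 P |P|≡k uniq = matchingInvolution P uniq , swapAlong-involutive P uniq ,
    ℕₚ.+-cancelʳ-≡ (k ℕ.+ k) _ _ (≡.trans
      (≡.subst (λ m → fixedPoints (matchingInvolution P uniq) ℕ.+ (m ℕ.+ m) ≡ n) |P|≡k
        (fixed-sum P uniq)) n≡a+2k) ,
    λ _ _ → refl

  word-weight : ∀ P (uniq : Unique (vertices P)) S → All Ordered S →
                word (permutationMatrix (matchingInvolution P uniq)) S ≈ weight S P
  word-weight P uniq []      []        = refl
  word-weight P uniq (_ ∷ S) (i<j ∷ o) =
    *-cong (permutationMatrix-occurrences P uniq (Finₚ.<⇒≢ i<j)) (word-weight P uniq S o)

  values-combination : ∀ P (|P|≡k : length P ≡ k) (uniq : Unique (vertices P)) {e T} → GoodTerms e T →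
                       values T P ≈ combination (evaluation (involution∈𝓜 P |P|≡k uniq)) T
  values-combination P |P|≡k uniq []           = refl
  values-combination P |P|≡k uniq (good ∷ all) =
    +-cong (*-congˡ (sym (word-weight P uniq _ (OrderedMatching.ordered good))))
      (values-combination P |P|≡k uniq all)

  toPolynomial : Terms → Polynomial
  toPolynomial = map (λ (c , S) → c , exponents S)

  -- A matching with as many edges as `S` either is `S` up to order and has weight one at `S`, or
  -- has an edge outside `S` and has weight zero there.
  coeff-matching : ∀ {e S} → OrderedMatching e S → ∀ {T} → GoodTerms e T →
                   coeff (toPolynomial T) (exponents S) ≈ values T S
  coeff-matching good []                                = refl
  coeff-matching {S = S} good {(c , S′) ∷ T} (good′ ∷ all) = +-cong
    (case ↭-or-missing S′ S (≡.trans (OrderedMatching.size good′) (≡.sym (OrderedMatching.size good)))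
                       (OrderedMatching.unique good′) of λ where
      (inj₁ S′↭S) → trans
        (reflexive (≡.cong (λ b → when b c) (dec-true (exponents S′ ≗? exponents S) (exponents-↭ S′↭S))))
        (sym (trans (*-congˡ (weight-⊆ S′ (OrderedMatching.unique good) (↭ₚ.∈-resp-↭ S′↭S))) (*-identityʳ c)))
      (inj₂ (x , x∈S′ , x∉S)) → trans
        (reflexive (≡.cong (λ b → when b c) (dec-false (exponents S′ ≗? exponents S)
          λ eq → exponents-∈ x∈S′ (≡.trans (eq _ _) (exponents-∉ S x∉S)))))
        (sym (trans (*-congˡ (weight-missing x∈S′ (occurrences-∉ S
          (All.lookup (OrderedMatching.ordered good′) x∈S′) (OrderedMatching.ordered good) x∉S))) (zeroʳ c))))
    (coeff-matching good all)

  toPolynomial-≈0 : ∀ T → (∀ {c S} → (c , S) ∈ T → coeff (toPolynomial T) (exponents S) ≈ 0#) →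
                    toPolynomial T ≈ᴾ 0ᴾ
  toPolynomial-≈0 T zeros = mk≈ᴾ λ m → case any? (λ (_ , S) → exponents S ≗? m) T of λ where
      (yes some) → let _ , ∈T , eq = find some in
        trans (sym (coeff-≗ (toPolynomial T) eq)) (zeros ∈T)
      (no none) → absent T (Allₚ.¬Any⇒All¬ T none)
    where
    absent : ∀ T {m} → All (λ (_ , S) → ¬ exponents S ≗ m) T → coeff (toPolynomial T) m ≈ 0#
    absent []            []       = refl
    absent ((c , S) ∷ T) (¬≗ ∷ h) = trans
      (coeff-∷-¬≗ {k = c} {t = exponents S} (toPolynomial T) ¬≗) (absent T h)

  module _ (e : ℕ) where
    open Quotient e

    combination-quotient : ∀ {T} → GoodTerms e T →
      proj₁ (combination (quotient a k n≡a+2k) T) ≈ᴾ toPolynomial T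
    combination-quotient [] = ≈ᴾ-reflexive ≡.refl
    combination-quotient {(c , S) ∷ T} (good ∷ all) =
      ++-cong {q = proj₁ (combination (quotient a k n≡a+2k) T)} {toPolynomial T} (mk≈ᴾ λ m → begin
        coeff (const c *ᴾ component e (monomial S)) m   ≈⟨ coeff-const c (component e (monomial S)) m ⟩
        c * coeff (component e (monomial S)) m
          ≈⟨ *-congˡ (reflexive (≡.cong (λ p → coeff p m)
               (component-all e (monomial S) (≡.trans (degree-exponents S) (OrderedMatching.size good) ∷ [])))) ⟩
        c * (when (does (exponents S ≗? m)) 1# + 0#)
          ≈⟨ trans (*-congˡ (+-identityʳ _)) (trans (sym (when-* _ c 1#)) (when-cong _ (*-identityʳ c))) ⟩
        when (does (exponents S ≗? m)) c                ≈⟨ +-identityʳ _ ⟨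
        coeff ((c , exponents S) ∷ []) m                ∎)
      (combination-quotient all)

    top-component∈N : e ≤ k → e ≤ a → ∀ f → 𝐈 (𝓜 a) f → (∀ d → e < d → component d f ≈ᴾ 0ᴾ) →
                      N (component e f)
    top-component∈N e≤k e≤a f If above = ∼0⇒N _ (≈ᴹ-trans top (≈ᴹ-trans (T≋ (quotient a k n≡a+2k))
        (N⇒∼0 (combination (quotient a k n≡a+2k) T)
          (≈-∈ (≈ᴾ-sym (≈ᴾ-trans (combination-quotient good) polynomial≈0)) 0∈))))
      where
      open Module R-e using (≈ᴹ-trans)
      open Reduct (reduct e e≤k f)
      T = proj₁ spanned
      good = proj₁ (proj₂ spanned)
      T≋ = proj₂ (proj₂ spanned)
      -- The components above `e` are zero only up to `_≈ᴾ_`, so `f` may contain cancelling terms of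
      -- high degree, whose total value has to be shown zero.
      high≈0 : filterDegree (λ m → ¬? (m ℕₚ.≤? e)) f ≈ᴾ 0ᴾ
      high≈0 = mk≈ᴾ λ m → trans (coeff-filterDegree (λ m → ¬? (m ℕₚ.≤? e)) f m)
        (case degree m ℕₚ.≤? e of λ where
        (yes m≤e) → reflexive (≡.cong (λ b → when b (coeff f m))
          (dec-false (¬? (degree m ℕₚ.≤? e)) λ m≰e → m≰e m≤e))
        (no m≰e) → trans (reflexive (≡.cong (λ b → when b (coeff f m)) (dec-true (¬? (degree m ℕₚ.≤? e)) m≰e)))
          (trans (sym (trans (coeff-filterDegree (ℕₚ._≟ degree m) f m)
            (reflexive (≡.cong (λ b → when b (coeff f m)) (dec-true (degree m ℕₚ.≟ degree m) ≡.refl)))))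
            (coeff≈ (above (degree m) (ℕₚ.≰⇒> m≰e)) m)))
      low-vanishes : ∀ A → 𝓜 a A → eval (filterDegree (ℕₚ._≤? e) f) A ≈ 0#
      low-vanishes A A∈ = begin
        eval (filterDegree (ℕₚ._≤? e) f) A  ≈⟨ +-identityʳ _ ⟨
        eval (filterDegree (ℕₚ._≤? e) f) A + 0#  ≈⟨ +-congˡ (eval-≈0 high≈0 A) ⟨
        eval (filterDegree (ℕₚ._≤? e) f) A + eval (filterDegree (λ m → ¬? (m ℕₚ.≤? e)) f) A
          ≈⟨ eval-filterDegree (ℕₚ._≤? e) f A ⟨
        eval f A  ≈⟨ If A A∈ ⟩
        0#  ∎
      vanishes : ∀ P → length P ≤ k → Unique (vertices P) → values T P ≈ 0#
      vanishes = vanish e k [] (values T) (values-symmetric T) (values-homogeneous good)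
        -- With no forbidden vertices the bound required is e + 2k ≤ n = a + 2k.
        (ℕₚ.≤-trans (ℕₚ.+-monoˡ-≤ (k ℕ.+ k) e≤a) (ℕₚ.≤-reflexive (≡.sym n≡a+2k)))
        λ P |P|≡k uniq → let A∈ = involution∈𝓜 P |P|≡k uniq in
          trans (values-combination P |P|≡k uniq good)
            (trans (sym (T≋ (evaluation A∈))) (trans (sym (value A∈)) (low-vanishes _ A∈)))
      polynomial≈0 : toPolynomial T ≈ᴾ 0ᴾ
      polynomial≈0 = toPolynomial-≈0 T λ {c} {S} ∈T → let goodS = All.lookup good ∈T in
        trans (coeff-matching goodS good)
          (vanishes S (ℕₚ.≤-trans (ℕₚ.≤-reflexive (OrderedMatching.size goodS)) e≤k) (OrderedMatching.unique goodS))

  timesTerm : Carrier → Monomial → Polynomial → Polynomial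
  timesTerm c s = map (λ (l , t) → c * l , λ i j → s i j ℕ.+ t i j)

  component-timesTerm : ∀ c s d p →
    component (degree s ℕ.+ d) (timesTerm c s p) ≡ timesTerm c s (component d p)
  component-timesTerm c s d []            = ≡.refl
  component-timesTerm c s d ((l , t) ∷ p) = case degree t ℕₚ.≟ d of λ where
    (yes t≡d) → ≡.trans
      (Listₚ.filter-accept (λ (_ , t) → degree t ℕₚ.≟ degree s ℕ.+ d)
        (≡.trans (degree-+ s t) (≡.cong (degree s ℕ.+_) t≡d)))
      (≡.trans (≡.cong (_ ∷_) (component-timesTerm c s d p))
        (≡.cong (map _) (≡.sym (Listₚ.filter-accept (λ (_ , t) → degree t ℕₚ.≟ d) t≡d))))
    (no t≢d) → ≡.trans
      (Listₚ.filter-reject (λ (_ , t) → degree t ℕₚ.≟ degree s ℕ.+ d)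
        (λ eq → t≢d (ℕₚ.+-cancelˡ-≡ (degree s) _ _ (≡.trans (≡.sym (degree-+ s t)) eq))))
      (≡.trans (component-timesTerm c s d p)
        (≡.cong (map _) (≡.sym (Listₚ.filter-reject (λ (_ , t) → degree t ℕₚ.≟ d) t≢d))))

  -- All degrees within the bounds are treated together: in a product with a monomial of degree s,
  -- the component of degree e comes from the component of degree e - s of the other factor.
  gr-⊆ : ∀ {q} → gr (𝐈 (𝓜 a)) q → ∀ e → e ≤ k → e ≤ a → N (component e q)
  gr-⊆ (gen (f , d , If , (above , _) , ≡.refl)) e e≤k e≤a = case d ℕₚ.≟ e of λ where
    (yes ≡.refl) → ≈-∈ (≈ᴾ-sym (component-of-homogeneous e (component e f) (component-homogeneous e f)))
      (top-component∈N e e≤k e≤a f If above)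
    (no d≢e) → ≡.subst N (≡.sym (component-none e (component d f)
      (All.map (λ ≡d ≡e → d≢e (≡.trans (≡.sym ≡d) ≡e)) (Allₚ.all-filter (λ (_ , t) → degree t ℕₚ.≟ d) f)))) 0∈
  gr-⊆ 0∈ e _ _ = 0∈
  gr-⊆ (+-∈ {p} {q} Jp Jq) e e≤k e≤a =
    ≡.subst N (≡.sym (component-++ e p q)) (+-∈ (gr-⊆ Jp e e≤k e≤a) (gr-⊆ Jq e e≤k e≤a))
  gr-⊆ (*-∈ r {p} Jp) e e≤k e≤a = multiple r
    where
    scaled : ∀ c s → N (component e (timesTerm c s p))
    scaled c s = case degree s ℕₚ.≤? e of λ where
      (yes s≤e) → let d , s+d≡e = ℕₚ.m≤n⇒∃[o]m+o≡n s≤e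
                      d≤e = ≡.subst (d ≤_) s+d≡e (ℕₚ.m≤n+m d (degree s)) in
        ≡.subst (λ e → N (component e (timesTerm c s p))) s+d≡e
          (≡.subst N (≡.trans (Listₚ.++-identityʳ _) (≡.sym (component-timesTerm c s d p)))
            (*-∈ ((c , s) ∷ []) (gr-⊆ Jp d (ℕₚ.≤-trans d≤e e≤k) (ℕₚ.≤-trans d≤e e≤a))))
      (no s≰e) → ≡.subst N (≡.sym (component-none e (timesTerm c s p)
        (Allₚ.map⁺ (All.universal (λ (l , t) eq → s≰e (≡.subst (degree s ≤_) (≡.trans (≡.sym (degree-+ s t)) eq)
          (ℕₚ.m≤m+n (degree s) (degree t)))) p)))) 0∈
    multiple : ∀ r → N (component e (r *ᴾ p))
    multiple []            = 0∈
    multiple ((c , s) ∷ r) = ≡.subst N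
      (≡.sym (component-++ e (timesTerm c s p) (r *ᴾ p))) (+-∈ (scaled c s) (multiple r))
  gr-⊆ (≈-∈ p≈q Jp) e e≤k e≤a = ≈-∈ (filterDegree-cong (ℕₚ._≟ e) p≈q) (gr-⊆ Jp e e≤k e≤a)

  homogeneous-gr-⊆ : ∀ {d q} → Homogeneous d q → d ≤ k → d ≤ a → gr (𝐈 (𝓜 a)) q → gr (𝐈 (𝓜 a′)) q
  homogeneous-gr-⊆ {d} {q} hom d≤k d≤a Jq = ≈-∈ (component-of-homogeneous d q hom) (gr-⊆ Jq d d≤k d≤a)

-- The complex numbers

module ComplexScalars where
  open RealNumbers using (fromℚ; pointwise; null)
  open ComplexNumbers hiding (_≈_)
  open CommutativeRing ℂ-commutativeRing using (_≈_; _*_; _+_; 1#; 0#; +-congˡ; *-congˡ; trans; refl)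
  open CharacteristicZero ℂ-commutativeRing

  rational : ℚ → ℂ
  rational q = fromℚ q +i fromℚ 0ℚ

  opaque
    unfolding _⊕_ _⊗_

    rational-+ : ∀ p q → rational p + rational q ≈ rational (p ℚ.+ q)
    rational-+ p q = pointwise (λ _ → ≡.refl) , pointwise (λ _ → ≡.refl)

    rational-* : ∀ p q → rational p * rational q ≈ rational (p ℚ.* q)
    rational-* p q =
      pointwise (λ _ → ≡.trans (≡.cong (λ z → p ℚ.* q ℚ.+ ℚ.- z) (ℚₚ.*-zeroˡ 0ℚ)) (ℚₚ.+-identityʳ _)) ,
      pointwise (λ _ → ≡.cong₂ ℚ._+_ (ℚₚ.*-zeroʳ p) (ℚₚ.*-zeroˡ q))

  natural : ℕ → ℚ
  natural zero    = 0ℚ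
  natural (suc m) = 1ℚ ℚ.+ natural m

  fromℕ-rational : ∀ m → fromℕ m ≈ rational (natural m)
  fromℕ-rational zero    = refl
  fromℕ-rational (suc m) = trans (+-congˡ (fromℕ-rational m)) (rational-+ 1ℚ (natural m))

  natural-nonNegative : ∀ m → ℚ.NonNegative (natural m)
  natural-nonNegative zero    = _
  natural-nonNegative (suc m) = ℚₚ.nonNeg+nonNeg⇒nonNeg 1ℚ (natural m) {{natural-nonNegative m}}

  natural-positive : ∀ m → ℚ.Positive (natural (suc m))
  natural-positive m = ℚₚ.pos+nonNeg⇒pos 1ℚ (natural m) {{natural-nonNegative m}}

  invertible : InvertibleNumbers
  invertible m = rational (ℚ.1/ q) ,
    trans (*-congˡ {rational (ℚ.1/ q)} (fromℕ-rational (suc m)))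
      (trans (rational-* (ℚ.1/ q) q) (pointwise (λ _ → ℚₚ.*-inverseˡ q) , pointwise (λ _ → ≡.refl)))
    where
    q = natural (suc m)
    instance
      q≢0 : ℚ.NonZero q
      q≢0 = ℚₚ.pos⇒nonZero q {{natural-positive m}}

  nontrivial : ¬ 1# ≈ 0#
  -- Equal real parts would eventually be within ½ of each other, while the constant sequences 1 and
  -- 0 stay at distance 1.
  nontrivial (1≃0 , _) with N , close ← null 1≃0 ½ (ℚₚ.positive⁻¹ ½) =
    toWitnessFalse {a? = 1ℚ ℚₚ.<? ½} _ (close N ℕₚ.≤-refl)

-- Parity of the number of moved points, and the isomorphism

half-gap : ∀ n b → b ≤ n → b % 2 ≡ n % 2 → n ≡ b ℕ.+ (((n ∸ b) / 2) ℕ.+ ((n ∸ b) / 2))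
half-gap n b b≤n b≡n = ≡.trans (≡.sym (ℕₚ.m+[n∸m]≡n b≤n)) (≡.cong (b ℕ.+_) (begin
  n ∸ b                          ≡⟨ DivMod.m≡m%n+[m/n]*n (n ∸ b) 2 ⟩
  (n ∸ b) % 2 ℕ.+ (n ∸ b) / 2 ℕ.* 2  ≡⟨ ≡.cong (ℕ._+ (n ∸ b) / 2 ℕ.* 2) even ⟩
  (n ∸ b) / 2 ℕ.* 2              ≡⟨ solve 1 (λ x → x :* con 2 := x :+ x) ≡.refl ((n ∸ b) / 2) ⟩
  (n ∸ b) / 2 ℕ.+ (n ∸ b) / 2    ∎))
  where
  open ≡.≡-Reasoning
  open +-*-Solver
  even : (n ∸ b) % 2 ≡ 0
  -- The equal remainders cancel in the difference and leave a multiple of two.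
  even = ≡.trans (≡.cong (_% 2) (begin
    n ∸ b
      ≡⟨ ≡.cong₂ _∸_ (DivMod.m≡m%n+[m/n]*n n 2) (DivMod.m≡m%n+[m/n]*n b 2) ⟩
    (n % 2 ℕ.+ n / 2 ℕ.* 2) ∸ (b % 2 ℕ.+ b / 2 ℕ.* 2)
      ≡⟨ ≡.cong (λ r → (n % 2 ℕ.+ n / 2 ℕ.* 2) ∸ (r ℕ.+ b / 2 ℕ.* 2)) b≡n ⟩
    (n % 2 ℕ.+ n / 2 ℕ.* 2) ∸ (n % 2 ℕ.+ b / 2 ℕ.* 2)
      ≡⟨ ℕₚ.[m+n]∸[m+o]≡n∸o (n % 2) _ _ ⟩
    n / 2 ℕ.* 2 ∸ b / 2 ℕ.* 2
      ≡⟨ ℕₚ.*-distribʳ-∸ 2 (n / 2) (b / 2) ⟨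
    (n / 2 ∸ b / 2) ℕ.* 2  ∎))
    (DivMod.m*n%n≡0 (n / 2 ∸ b / 2) 2)

corollary5p2 : (n a a′ d : ℕ) →
    0 < n →
    a ⊔ a′ ≤ n →
    a % 2 ≡ a′ % 2 →
    a′ % 2 ≡ n % 2 →
    d ≤ a ⊓ a′ ⊓ ((n ∸ a) / 2) ⊓ ((n ∸ a′) / 2) →
    GModuleIsomorphism (𝔖 n) ComplexNumbers.ℂ-commutativeRing (R𝓜 n a d) (R𝓜 n a′ d)
corollary5p2 n@(suc _) a a′ d 0<n a⊔a′≤n a≡a′ a′≡n d≤ = record
  -- Both modules have the same homogeneous polynomials and the same operations and differ only in
  -- their equality, so every law of a homomorphism is reflexivity.
  { to = λ p → p
  ; isModuleIsomorphism = record
    { isModuleMonomorphism = record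
      { isModuleHomomorphism = record
        { isBimoduleHomomorphism = record
          { +ᴹ-isGroupHomomorphism = record
            { isMonoidHomomorphism = record
              { isMagmaHomomorphism = record
                { isRelHomomorphism = record { cong = λ {p} {q} → forward p q }
                ; homo = λ p q → W.≈ᴹ-refl {p W.+ᴹ q}
                }
              ; ε-homo = W.≈ᴹ-refl {W.0ᴹ}
              }
            ; ⁻¹-homo = λ p → W.≈ᴹ-refl {W.-ᴹ p}
            }
          ; *ₗ-homo = λ k p → W.≈ᴹ-refl {k W.*ₗ p}
          ; *ᵣ-homo = λ k p → W.≈ᴹ-refl {p W.*ᵣ k}
          }
        }
      ; injective = λ {p} {q} → backward p q
      }
    ; surjective = λ q → q , λ {p} → forward p q
    }
  ; equivariant = λ g p → W.≈ᴹ-refl {g W.• p}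
  }
  where
  module V = GModule (R𝓜 n a d)
  module W = GModule (R𝓜 n a′ d)
  open OrbitHarmonics ComplexNumbers.ℂ-commutativeRing n using (mk∼; difference; Homogeneous)
  open ComplexScalars using (invertible; nontrivial)
  d≤k′ = ℕₚ.m≤n⊓o⇒m≤o (a ⊓ a′ ⊓ ((n ∸ a) / 2)) ((n ∸ a′) / 2) d≤
  d≤aa′k = ℕₚ.m≤n⊓o⇒m≤n (a ⊓ a′ ⊓ ((n ∸ a) / 2)) ((n ∸ a′) / 2) d≤
  d≤k = ℕₚ.m≤n⊓o⇒m≤o (a ⊓ a′) ((n ∸ a) / 2) d≤aa′k
  d≤aa′ = ℕₚ.m≤n⊓o⇒m≤n (a ⊓ a′) ((n ∸ a) / 2) d≤aa′k
  n≡a = half-gap n a (ℕₚ.m⊔n≤o⇒m≤o a a′ a⊔a′≤n) (≡.trans a≡a′ a′≡n)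
  n≡a′ = half-gap n a′ (ℕₚ.m⊔n≤o⇒n≤o a a′ a⊔a′≤n) a′≡n
  -- The index `zero` is the vertex that n > 0 supplies.
  module Forward = Inclusion ComplexNumbers.ℂ-commutativeRing n invertible nontrivial zero
    a ((n ∸ a) / 2) n≡a a′ ((n ∸ a′) / 2) n≡a′
  module Backward = Inclusion ComplexNumbers.ℂ-commutativeRing n invertible nontrivial zero
    a′ ((n ∸ a′) / 2) n≡a′ a ((n ∸ a) / 2) n≡a
  forward : ∀ p q → p V.≈ᴹ q → p W.≈ᴹ q
  -- Equality in the quotient is membership of the difference, which is again homogeneous of degree
  -- `d`.
  forward p q p∼q = mk∼ (Forward.homogeneous-gr-⊆ (proj₂ (p V.+ᴹ V.-ᴹ q)) d≤k
    (ℕₚ.m≤n⊓o⇒m≤n a a′ d≤aa′) (difference p∼q))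
  backward : ∀ p q → p W.≈ᴹ q → p V.≈ᴹ q
  backward p q p∼q = mk∼ (Backward.homogeneous-gr-⊆ (proj₂ (p V.+ᴹ V.-ᴹ q)) d≤k′
    (ℕₚ.m≤n⊓o⇒m≤o a a′ d≤aa′) (difference p∼q))
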